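{- $\mathsf{RG}^2_{8,4}$ implies $\mathsf{SRT}^2_2$ over $\mathsf{RCA}_0$.
   Context: A graph $(G,E)$ is a Rado graph if for every two disjoint finite sets of vertices $F_0,F_1$ there is a vertex adjacent to all of $F_0$ and to none of $F_1$. Fix a computable Rado graph $\mathcal R$. $\mathsf{RG}^2_{k,\ell}$: for every coloring $f:[\mathcal R]^2\to k$ of the $2$-element vertex sets of $\mathcal R$ there is an induced subgraph $\mathcal R'$ of $\mathcal R$ isomorphic to $\mathcal R$ with $|f([\mathcal R']^2)|\le\ell$. A coloring $f:[\omega]^2\to2$ is stable if for every $x$, $\lim_y f(x,y)$ exists. $\mathsf{SRT}^2_2$: every stable $f:[\omega]^2\to2$ has an infinite set $H$ with $f$ constant on $[H]^2$. -}

module Defs where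

open import Data.Nat.Base using (ℕ; zero; suc; _+_)
open import Data.Fin.Base using (Fin; zero; suc; _↑ˡ_)
open import Data.List.Base using (List; []; _∷_; map)
open import Data.List.Membership.Propositional using () renaming (_∈_ to _∈ˡ_)
open import Data.Vec.Base using (Vec; []; _∷_; lookup)
open import Function.Base using (id; _∘_)

infixl 8 _·_
infixl 7 _⊕_
infix  6 _≈_ _<_ _∈_
infixr 5 ∀¹_ ∀²_
infixr 2 _⇒_
infix  0 _∣_⊢_ _⊢_

-- The language L₂ of second-order arithmetic with de Bruijn indices: m counts
-- the free number variables, s the free set variables, in separate scopes.

data Term (m : ℕ) : Set where
  var     : Fin m → Term m
  𝟎 𝟏     : Term m
  _⊕_ _·_ : Term m → Term m → Term m

data Formula (m s : ℕ) : Set where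
  ⊥       : Formula m s
  _≈_ _<_ : Term m → Term m → Formula m s
  _∈_     : Term m → Fin s → Formula m s
  _⇒_     : Formula m s → Formula m s → Formula m s
  ∀¹_     : Formula (suc m) s → Formula m s
  ∀²_     : Formula m (suc s) → Formula m s

-- The logic is classical, so the other connectives are abbreviations.

infix  6 _≉_
infixr 5 ¬_ ∃¹_ ∃²_
infixr 4 _∧_
infixr 3 _∨_
infix  1 _⇔_

¬_ : ∀ {m s} → Formula m s → Formula m s
¬ φ = φ ⇒ ⊥

⊤ : ∀ {m s} → Formula m s
⊤ = ¬ ⊥

_∧_ _∨_ _⇔_ : ∀ {m s} → Formula m s → Formula m s → Formula m s
φ ∧ ψ = ¬ (φ ⇒ ¬ ψ)
φ ∨ ψ = ¬ φ ⇒ ψ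
φ ⇔ ψ = (φ ⇒ ψ) ∧ (ψ ⇒ φ)

∃¹_ : ∀ {m s} → Formula (suc m) s → Formula m s
∃¹ φ = ¬ (∀¹ (¬ φ))

∃²_ : ∀ {m s} → Formula m (suc s) → Formula m s
∃² φ = ¬ (∀² (¬ φ))

_≉_ : ∀ {m s} → Term m → Term m → Formula m s
t ≉ u = ¬ (t ≈ u)

⋁ : ∀ {m s} (n : ℕ) → (Fin n → Formula m s) → Formula m s
⋁ zero    φ = ⊥
⋁ (suc n) φ = φ zero ∨ ⋁ n (φ ∘ suc)

∃¹^ : ∀ {m s} (n : ℕ) → Formula (n + m) s → Formula m s
∃¹^ zero    φ = φ
∃¹^ (suc n) φ = ∃¹^ n (∃¹ φ)

-- Set variables are the only set terms of L₂, so substitution for them is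
-- renaming.

subT : ∀ {m n} → (Fin m → Term n) → Term m → Term n
subT σ (var i) = σ i
subT σ 𝟎       = 𝟎
subT σ 𝟏       = 𝟏
subT σ (t ⊕ u) = subT σ t ⊕ subT σ u
subT σ (t · u) = subT σ t · subT σ u

↑ : ∀ {m} → Term m → Term (suc m)
↑ = subT (var ∘ suc)

lift¹ : ∀ {m n} → (Fin m → Term n) → Fin (suc m) → Term (suc n)
lift¹ σ zero    = var zero
lift¹ σ (suc i) = ↑ (σ i)

lift² : ∀ {s r} → (Fin s → Fin r) → Fin (suc s) → Fin (suc r)
lift² ρ zero    = zero
lift² ρ (suc X) = suc (ρ X)

sub : ∀ {m n s r} → (Fin m → Term n) → (Fin s → Fin r) → Formula m s → Formula n r
sub σ ρ ⊥       = ⊥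
sub σ ρ (t ≈ u) = subT σ t ≈ subT σ u
sub σ ρ (t < u) = subT σ t < subT σ u
sub σ ρ (t ∈ X) = subT σ t ∈ ρ X
sub σ ρ (φ ⇒ ψ) = sub σ ρ φ ⇒ sub σ ρ ψ
sub σ ρ (∀¹ φ)  = ∀¹ sub (lift¹ σ) ρ φ
sub σ ρ (∀² φ)  = ∀² sub σ (lift² ρ) φ

wk¹ : ∀ {m s} → Formula m s → Formula (suc m) s
wk¹ = sub (var ∘ suc) id

wk² : ∀ {m s} → Formula m s → Formula m (suc s)
wk² = sub var suc

_[_]¹ : ∀ {m s} → Formula (suc m) s → Term m → Formula m s
φ [ t ]¹ = sub (λ { zero → t ; (suc i) → var i }) id φ

_[_]² : ∀ {m s} → Formula m (suc s) → Fin s → Formula m s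
φ [ X ]² = sub var (λ { zero → X ; (suc Y) → Y }) φ

_⟨_⟩ : ∀ {n m s} → Formula n 0 → Vec (Term m) n → Formula m s
φ ⟨ ts ⟩ = sub (lookup ts) (λ ()) φ

x₀ : ∀ {m} → Term (1 + m)
x₀ = var zero

x₁ : ∀ {m} → Term (2 + m)
x₁ = var (suc zero)

x₂ : ∀ {m} → Term (3 + m)
x₂ = var (suc (suc zero))

x₃ : ∀ {m} → Term (4 + m)
x₃ = var (suc (suc (suc zero)))

-- Classical two-sorted natural deduction.  The axioms of a theory may have
-- free variables (parameters); this amounts to taking universal closures.

Theory : Set₁
Theory = ∀ {m s} → Formula m s → Set

data _∣_⊢_ (T : Theory) {m s : ℕ} (Γ : List (Formula m s)) : Formula m s → Set where
  hyp  : ∀ {φ} → φ ∈ˡ Γ → T ∣ Γ ⊢ φ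
  ax   : ∀ {φ} → T φ → T ∣ Γ ⊢ φ
  ⇒I   : ∀ {φ ψ} → T ∣ φ ∷ Γ ⊢ ψ → T ∣ Γ ⊢ φ ⇒ ψ
  ⇒E   : ∀ {φ ψ} → T ∣ Γ ⊢ φ ⇒ ψ → T ∣ Γ ⊢ φ → T ∣ Γ ⊢ ψ
  raa  : ∀ {φ} → T ∣ (¬ φ) ∷ Γ ⊢ ⊥ → T ∣ Γ ⊢ φ
  ∀¹I  : ∀ {φ} → T ∣ map wk¹ Γ ⊢ φ → T ∣ Γ ⊢ ∀¹ φ
  ∀¹E  : ∀ {φ} → T ∣ Γ ⊢ ∀¹ φ → (t : Term m) → T ∣ Γ ⊢ φ [ t ]¹
  ∀²I  : ∀ {φ} → T ∣ map wk² Γ ⊢ φ → T ∣ Γ ⊢ ∀² φ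
  ∀²E  : ∀ {φ} → T ∣ Γ ⊢ ∀² φ → (X : Fin s) → T ∣ Γ ⊢ φ [ X ]²
  ≈I   : ∀ {t} → T ∣ Γ ⊢ t ≈ t
  ≈E   : ∀ {t u} φ → T ∣ Γ ⊢ t ≈ u → T ∣ Γ ⊢ φ [ t ]¹ → T ∣ Γ ⊢ φ [ u ]¹

_⊢_ : Theory → Formula 0 0 → Set
T ⊢ φ = T ∣ [] ⊢ φ

-- Set parameters are allowed; weakening keeps the bound variable out of the
-- bounding term.
data Δ⁰₀ {m s : ℕ} : Formula m s → Set where
  ⊥    : Δ⁰₀ ⊥
  _≈_  : ∀ t u → Δ⁰₀ (t ≈ u)
  _<_  : ∀ t u → Δ⁰₀ (t < u)
  _∈_  : ∀ t X → Δ⁰₀ (t ∈ X)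
  _⇒_  : ∀ {φ ψ} → Δ⁰₀ φ → Δ⁰₀ ψ → Δ⁰₀ (φ ⇒ ψ)
  ∀<   : ∀ t {φ} → Δ⁰₀ φ → Δ⁰₀ (∀¹ (x₀ < ↑ t ⇒ φ))

data Σ⁰₁ {m s : ℕ} : Formula m s → Set where
  ∃Δ⁰₀ : ∀ {θ} → Δ⁰₀ θ → Σ⁰₁ (∃¹ θ)

data Π⁰₁ {m s : ℕ} : Formula m s → Set where
  ∀Δ⁰₀ : ∀ {θ} → Δ⁰₀ θ → Π⁰₁ (∀¹ θ)

-- φ(n + 1), where n is the number variable 0 of φ.
next : ∀ {m s} → Formula (suc m) s → Formula (suc m) s
next = sub (λ { zero → x₀ ⊕ 𝟏 ; (suc i) → var (suc i) }) id

data RCA₀ {m s : ℕ} : Formula m s → Set where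
  suc≉0   : RCA₀ (∀¹ x₀ ⊕ 𝟏 ≉ 𝟎)
  suc-inj : RCA₀ (∀¹ ∀¹ (x₁ ⊕ 𝟏 ≈ x₀ ⊕ 𝟏 ⇒ x₁ ≈ x₀))
  +-zero  : RCA₀ (∀¹ x₀ ⊕ 𝟎 ≈ x₀)
  +-suc   : RCA₀ (∀¹ ∀¹ x₁ ⊕ (x₀ ⊕ 𝟏) ≈ (x₁ ⊕ x₀) ⊕ 𝟏)
  *-zero  : RCA₀ (∀¹ x₀ · 𝟎 ≈ 𝟎)
  *-suc   : RCA₀ (∀¹ ∀¹ x₁ · (x₀ ⊕ 𝟏) ≈ (x₁ · x₀) ⊕ x₁)
  ≮0      : RCA₀ (∀¹ ¬ x₀ < 𝟎)
  <-suc   : RCA₀ (∀¹ ∀¹ (x₁ < x₀ ⊕ 𝟏 ⇔ x₁ < x₀ ∨ x₁ ≈ x₀))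
  Σ⁰₁-ind : ∀ {φ : Formula (suc m) s} → Σ⁰₁ φ →
            RCA₀ (φ [ 𝟎 ]¹ ∧ (∀¹ (φ ⇒ next φ)) ⇒ ∀¹ φ)
  Δ⁰₁-CA  : ∀ {φ ψ : Formula (suc m) s} → Σ⁰₁ φ → Π⁰₁ ψ →
            RCA₀ ((∀¹ (φ ⇔ ψ)) ⇒ ∃² ∀¹ (x₀ ∈ zero ⇔ wk² φ))

num : ∀ {m} → ℕ → Term m
num zero    = 𝟎
num (suc k) = num k ⊕ 𝟏

-- The pairing map (i , j) ↦ (i + j)² + i.
⟪_,_⟫ : ∀ {m} → Term m → Term m → Term m
⟪ i , j ⟫ = (i ⊕ j) · (i ⊕ j) ⊕ i

-- A definable class of numbers, with set parameters only.
Class : ℕ → Set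
Class s = ∀ {m} → Term m → Formula m s

module _ {s : ℕ} where

  ω : Class s
  ω t = ⊤

  ⟦_⟧ : Fin s → Class s
  ⟦ X ⟧ t = t ∈ X

  below : ℕ → Class s
  below k t = t < num k

  -- [C]²: two-element subsets {x , y} of C, coded by ⟪ x , y ⟫ with x < y.
  Pairs : Class s → Class s
  Pairs C t = ∃¹ ∃¹ (↑ (↑ t) ≈ ⟪ x₁ , x₀ ⟫ ∧ x₁ < x₀ ∧ C x₁ ∧ C x₀)

  image : Fin s → Class s → Class s
  image f C t = ∃¹ (C x₀ ∧ ⟪ x₀ , ↑ t ⟫ ∈ f)

  infix 6 _⊆_
  _⊆_ : ∀ {m} → Class s → Class s → Formula m s
  C ⊆ D = ∀¹ (C x₀ ⇒ D x₀)

  Disjoint : ∀ {m} → Class s → Class s → Formula m s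
  Disjoint C D = ∀¹ ¬ (C x₀ ∧ D x₀)

  -- Finite and infinite sets of numbers are the bounded and unbounded ones.
  Finite : ∀ {m} → Class s → Formula m s
  Finite C = ∃¹ ∀¹ (C x₀ ⇒ x₀ < x₁)

  Infinite : ∀ {m} → Class s → Formula m s
  Infinite C = ∀¹ ∃¹ (C x₀ ∧ x₁ < x₀)

  -- C has at most ℓ elements: it is contained in some {c₀ , … , c_{ℓ-1}}.
  AtMost : ∀ {m} → ℕ → Class s → Formula m s
  AtMost {m} ℓ C = ∃¹^ ℓ (∀¹ (C x₀ ⇒ ⋁ ℓ λ i → x₀ ≈ var (suc (i ↑ˡ m))))

  Function : ∀ {m} → Fin s → Class s → Class s → Formula m s
  Function f C D =
      (∀¹ (x₀ ∈ f ⇒ ∃¹ ∃¹ (x₂ ≈ ⟪ x₁ , x₀ ⟫ ∧ C x₁ ∧ D x₀)))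
    ∧ (∀¹ (C x₀ ⇒ ∃¹ (⟪ x₁ , x₀ ⟫ ∈ f)))
    ∧ (∀¹ ∀¹ ∀¹ (⟪ x₂ , x₁ ⟫ ∈ f ∧ ⟪ x₂ , x₀ ⟫ ∈ f ⇒ x₁ ≈ x₀))

  Bijection : ∀ {m} → Fin s → Class s → Class s → Formula m s
  Bijection g C D =
      Function g C D
    ∧ (∀¹ ∀¹ ∀¹ (⟪ x₂ , x₀ ⟫ ∈ g ∧ ⟪ x₁ , x₀ ⟫ ∈ g ⇒ x₂ ≈ x₁))
    ∧ (∀¹ (D x₀ ⇒ ∃¹ (⟪ x₀ , x₁ ⟫ ∈ g)))

-- Graphs are given by a vertex set V and a set E of codes of ordered pairs.

module _ {s : ℕ} where

  Graph : ∀ {m} → Fin s → Fin s → Formula m s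
  Graph V E =
      (∀¹ ∀¹ (⟪ x₁ , x₀ ⟫ ∈ E ⇒ x₁ ∈ V ∧ x₀ ∈ V))
    ∧ (∀¹ ¬ ⟪ x₀ , x₀ ⟫ ∈ E)
    ∧ (∀¹ ∀¹ (⟪ x₁ , x₀ ⟫ ∈ E ⇒ ⟪ x₀ , x₁ ⟫ ∈ E))

  InducedSubgraph : ∀ {m} → (V′ E′ V E : Fin s) → Formula m s
  InducedSubgraph V′ E′ V E =
      ⟦ V′ ⟧ ⊆ ⟦ V ⟧
    ∧ (∀¹ ∀¹ (⟪ x₁ , x₀ ⟫ ∈ E′ ⇔ x₁ ∈ V′ ∧ x₀ ∈ V′ ∧ ⟪ x₁ , x₀ ⟫ ∈ E))

  GraphIsomorphism : ∀ {m} → (g V E V′ E′ : Fin s) → Formula m s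
  GraphIsomorphism g V E V′ E′ =
      Bijection g ⟦ V ⟧ ⟦ V′ ⟧
    ∧ (∀¹ ∀¹ ∀¹ ∀¹ (⟪ x₃ , x₁ ⟫ ∈ g ∧ ⟪ x₂ , x₀ ⟫ ∈ g ⇒
                     (⟪ x₃ , x₂ ⟫ ∈ E ⇔ ⟪ x₁ , x₀ ⟫ ∈ E′)))

RadoGraph : ∀ {m s} → Fin s → Fin s → Formula m s
RadoGraph {m} {s} V E = Graph V E ∧ (∀² ∀² extension)
  where
  F₀ F₁ V⁺ E⁺ : Fin (2 + s)
  F₀ = suc zero
  F₁ = zero
  V⁺ = suc (suc V)
  E⁺ = suc (suc E)

  extension : Formula m (2 + s)
  extension =
    ⟦ F₀ ⟧ ⊆ ⟦ V⁺ ⟧ ∧ ⟦ F₁ ⟧ ⊆ ⟦ V⁺ ⟧ ∧ Finite ⟦ F₀ ⟧ ∧ Finite ⟦ F₁ ⟧ ∧ Disjoint ⟦ F₀ ⟧ ⟦ F₁ ⟧ ⇒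
    ∃¹ (x₀ ∈ V⁺ ∧ (∀¹ (x₀ ∈ F₀ ⇒ ⟪ x₁ , x₀ ⟫ ∈ E⁺))
                ∧ (∀¹ (x₀ ∈ F₁ ⇒ ¬ ⟪ x₁ , x₀ ⟫ ∈ E⁺)))

-- A graph with parameter-free Δ⁰₁ vertex set and edge relation.
record Δ⁰₁Graph : Set where
  field
    vertexΣ vertexΠ : Formula 1 0
    edgeΣ edgeΠ     : Formula 2 0
    vertexΣ-Σ⁰₁     : Σ⁰₁ vertexΣ
    vertexΠ-Π⁰₁     : Π⁰₁ vertexΠ
    edgeΣ-Σ⁰₁       : Σ⁰₁ edgeΣ
    edgeΠ-Π⁰₁       : Π⁰₁ edgeΠ
    vertex-Δ⁰₁      : RCA₀ ⊢ ∀¹ (vertexΣ ⇔ vertexΠ)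
    edge-Δ⁰₁        : RCA₀ ⊢ ∀¹ ∀¹ (edgeΣ ⇔ edgeΠ)

  Is : ∀ {m s} → Fin s → Fin s → Formula m s
  Is V E = (∀¹ (x₀ ∈ V ⇔ vertexΣ ⟨ x₀ ∷ [] ⟩))
         ∧ (∀¹ ∀¹ (⟪ x₁ , x₀ ⟫ ∈ E ⇔ edgeΣ ⟨ x₁ ∷ x₀ ∷ [] ⟩))

-- "Computable" and "Rado" are understood inside the base theory: RCA₀ proves
-- that the defining formulas are Δ⁰₁ and that the graph is a Rado graph.
record ComputableRadoGraph : Set where
  field
    graph  : Δ⁰₁Graph
    isRado : RCA₀ ⊢ ∀² ∀² (Δ⁰₁Graph.Is graph (suc zero) zero ⇒ RadoGraph (suc zero) zero)

  open Δ⁰₁Graph graph public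

-- f : [C]² → k, with colors 0 , … , k - 1.
Coloring : ∀ {m s} → Fin s → Class s → ℕ → Formula m s
Coloring f C k = Function f (Pairs C) (below k)

RG² : ComputableRadoGraph → (k ℓ : ℕ) → Formula 0 0
RG² R k ℓ =
  ∀² ∀² (ComputableRadoGraph.Is R (suc zero) zero ⇒
    ∀² (Coloring zero ⟦ suc (suc zero) ⟧ k ⇒
      ∃² ∃² ∃² body))
  where
  V E f V′ E′ g : Fin 6
  V  = suc (suc (suc (suc (suc zero))))
  E  = suc (suc (suc (suc zero)))
  f  = suc (suc (suc zero))
  V′ = suc (suc zero)
  E′ = suc zero
  g  = zero

  body : Formula 0 6
  body = InducedSubgraph V′ E′ V E
       ∧ GraphIsomorphism g V E V′ E′
       ∧ AtMost ℓ (image f (Pairs ⟦ V′ ⟧))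

-- x₃ is the point x, x₂ the limit, x₁ the stage from which f(x , y) has settled
-- and x₀ is y.
Stable : ∀ {m s} → Fin s → Formula m s
Stable f = ∀¹ ∃¹ ∃¹ ∀¹ (x₁ < x₀ ∧ x₃ < x₀ ⇒ ⟪ ⟪ x₃ , x₀ ⟫ , x₂ ⟫ ∈ f)

Homogeneous : ∀ {m s} → Fin s → Fin s → Formula m s
Homogeneous f H = ∃¹ ∀¹ (Pairs ⟦ H ⟧ x₀ ⇒ ⟪ x₀ , x₁ ⟫ ∈ f)

SRT²₂ : Formula 0 0
SRT²₂ =
  ∀² (Coloring zero ω 2 ∧ Stable zero ⇒
    ∃² (Infinite ⟦ zero ⟧ ∧ Homogeneous (suc zero) zero))

{-# OPTIONS --safe #-}
module Submission where

-- By a constructive Henkin argument it suffices to derive the implication in all models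
-- of RCA₀ in which ⊥ is interpreted by an arbitrary type B and atoms are stable under
-- double negation relative to B.
--
-- In such a model, order the vertices lexicographically by the characteristic functions of
-- their neighbourhoods, and color a pair x < y by whether x and y are adjacent, whether x is
-- left of y, and by f(x, y).  In a copy of the Rado graph each of the four types (adjacency,
-- order) occurs, so if only four colors are used then f depends only on the type.  If f
-- ignores the order on edges or on non-edges, an infinite clique or independent set is
-- homogeneous.  By stability f cannot be the parity of the type: for x₁ < x₂ the four
-- adjacency patterns of late vertices z would realise all positions of z relative to x₁ and
-- x₂.  There remains the case that f is given by the order.  Applied to a coloring that
-- compares bounded patterns, the argument so far proves the infinite pigeonhole principle
-- for such patterns.  Hence some pattern on the vertices up to x₁ is shared by infinitely
-- many vertices.  These all have the same limit color, and by transitivity of the order a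
-- homogeneous set is found greedily among them.

open import Algebra.Bundles using (CommutativeSemiring)
open import Algebra.Structures.Biased using (IsCommutativeMonoidˡ; IsCommutativeSemiringˡ)
open import Data.Bool.Base using (Bool; true; false; not; _xor_)
open import Data.Bool.Properties using (_≟_; ¬-not; not-¬; not-involutive)
import Data.Empty as Empty
open import Data.Empty using (⊥-elim)
open import Data.Fin.Base as Fin using (Fin; zero; suc; _↑ˡ_; _↑ʳ_; splitAt)
open import Data.Fin.Properties using () renaming (pigeonhole to Fin-pigeonhole)
open import Data.List.Base using (List; []; _∷_; _++_; map; allFin; cartesianProductWith; upTo; concatMap)
open import Data.List.Membership.Propositional using () renaming (_∈_ to _∈ˡ_)
open import Data.List.Membership.Propositional.Properties
open import Data.List.Relation.Binary.Subset.Propositional using () renaming (_⊆_ to _⊆ˡ_)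
open import Data.List.Relation.Binary.Subset.Propositional.Properties using (map⁺; ∷⁺ʳ)
open import Data.List.Relation.Unary.All as All using (All; []; _∷_)
import Data.List.Relation.Unary.All.Properties as All
open import Data.List.Relation.Unary.Any using (here; there)
open import Data.Nat.Base as ℕ using (ℕ; zero; suc; _⊔_; z≤n; s≤s)
import Data.Nat.Properties as ℕ
open import Data.Product.Base using (Σ; ∃; _×_; _,_; proj₁; proj₂; swap)
open import Data.Sum.Base using (_⊎_; inj₁; inj₂; [_,_]; [_,_]′)
open import Data.Vec.Base using (Vec; []; _∷_; lookup) renaming (_++_ to _++ᵛ_)
open import Data.Vec.Properties using (lookup-++ˡ; lookup-++ʳ; lookup-splitAt)
open import Function.Base using (id; _∘_)
open import Relation.Binary.Definitions using (tri<; tri≈; tri>)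
open import Relation.Binary.PropositionalEquality using (_≡_; refl; sym; trans; cong; cong₂; subst; subst₂)
open import Relation.Binary.Structures using (IsEquivalence)
open import Relation.Nullary using (yes; no)

open import Defs

-- Only completeness is needed, never soundness: what RCA₀ proves about the given graph enters the
-- semantic statement as antecedents, which the given derivations discharge at the end. In the term
-- model `B` is derivability of a contradiction from the limit theory, so no question of consistency
-- is ever decided.
--
-- The weakness of RCA₀ shapes the combinatorics in two ways. Comparing whole neighbourhoods is not
-- a bounded matter, so two vertices are compared only below the smaller one. The order is then Δ⁰₀,
-- at the price of ties, and a vertex with a prescribed adjacency to x₁ is used to rule a tie out.
-- Moreover, Σ⁰₁ induction does not show that one of n parts of an infinite set is infinite when n
-- may be nonstandard. The patterns below x₁ + 1 form such a partition, so this principle has to be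
-- extracted from the Ramsey statement itself.

-- Substitution and weakening

subT-ext : ∀ {m n} {σ τ : Fin m → Term n} → (∀ i → σ i ≡ τ i) → ∀ t → subT σ t ≡ subT τ t
subT-ext e (var i) = e i
subT-ext e 𝟎       = refl
subT-ext e 𝟏       = refl
subT-ext e (t ⊕ u) = cong₂ _⊕_ (subT-ext e t) (subT-ext e u)
subT-ext e (t · u) = cong₂ _·_ (subT-ext e t) (subT-ext e u)

subT-∘ : ∀ {l m n} (τ : Fin m → Term n) (σ : Fin l → Term m) t →
         subT τ (subT σ t) ≡ subT (subT τ ∘ σ) t
subT-∘ τ σ (var i) = refl
subT-∘ τ σ 𝟎       = refl
subT-∘ τ σ 𝟏       = refl
subT-∘ τ σ (t ⊕ u) = cong₂ _⊕_ (subT-∘ τ σ t) (subT-∘ τ σ u)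
subT-∘ τ σ (t · u) = cong₂ _·_ (subT-∘ τ σ t) (subT-∘ τ σ u)

subT-var : ∀ {m} (t : Term m) → subT var t ≡ t
subT-var (var i) = refl
subT-var 𝟎       = refl
subT-var 𝟏       = refl
subT-var (t ⊕ u) = cong₂ _⊕_ (subT-var t) (subT-var u)
subT-var (t · u) = cong₂ _·_ (subT-var t) (subT-var u)

subT-lift-↑ : ∀ {m n} (σ : Fin m → Term n) t → subT (lift¹ σ) (↑ t) ≡ ↑ (subT σ t)
subT-lift-↑ σ t = trans (subT-∘ (lift¹ σ) (var ∘ suc) t) (sym (subT-∘ (var ∘ suc) σ t))

lift¹-ext : ∀ {m n} {σ τ : Fin m → Term n} → (∀ i → σ i ≡ τ i) → ∀ i → lift¹ σ i ≡ lift¹ τ i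
lift¹-ext e zero    = refl
lift¹-ext e (suc i) = cong ↑ (e i)

lift²-ext : ∀ {s r} {σ τ : Fin s → Fin r} → (∀ i → σ i ≡ τ i) → ∀ i → lift² σ i ≡ lift² τ i
lift²-ext e zero    = refl
lift²-ext e (suc i) = cong suc (e i)

sub-ext : ∀ {m n s r} {σ τ : Fin m → Term n} {ρ π : Fin s → Fin r} →
          (∀ i → σ i ≡ τ i) → (∀ X → ρ X ≡ π X) → ∀ φ → sub σ ρ φ ≡ sub τ π φ
sub-ext e d ⊥       = refl
sub-ext e d (t ≈ u) = cong₂ _≈_ (subT-ext e t) (subT-ext e u)
sub-ext e d (t < u) = cong₂ _<_ (subT-ext e t) (subT-ext e u)
sub-ext e d (t ∈ X) = cong₂ _∈_ (subT-ext e t) (d X)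
sub-ext e d (φ ⇒ ψ) = cong₂ _⇒_ (sub-ext e d φ) (sub-ext e d ψ)
sub-ext e d (∀¹ φ)  = cong ∀¹_ (sub-ext (lift¹-ext e) d φ)
sub-ext e d (∀² φ)  = cong ∀²_ (sub-ext e (lift²-ext d) φ)

sub-∘ : ∀ {l m n s r q} (τ : Fin m → Term n) (σ : Fin l → Term m)
        (π : Fin r → Fin q) (ρ : Fin s → Fin r) φ →
        sub τ π (sub σ ρ φ) ≡ sub (subT τ ∘ σ) (π ∘ ρ) φ
sub-∘ τ σ π ρ ⊥       = refl
sub-∘ τ σ π ρ (t ≈ u) = cong₂ _≈_ (subT-∘ τ σ t) (subT-∘ τ σ u)
sub-∘ τ σ π ρ (t < u) = cong₂ _<_ (subT-∘ τ σ t) (subT-∘ τ σ u)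
sub-∘ τ σ π ρ (t ∈ X) = cong (_∈ π (ρ X)) (subT-∘ τ σ t)
sub-∘ τ σ π ρ (φ ⇒ ψ) = cong₂ _⇒_ (sub-∘ τ σ π ρ φ) (sub-∘ τ σ π ρ ψ)
sub-∘ τ σ π ρ (∀¹ φ)  = cong ∀¹_ (trans (sub-∘ (lift¹ τ) (lift¹ σ) π ρ φ) (sub-ext eq (λ _ → refl) φ))
  where
  eq : ∀ i → subT (lift¹ τ) (lift¹ σ i) ≡ lift¹ (subT τ ∘ σ) i
  eq zero    = refl
  eq (suc i) = subT-lift-↑ τ (σ i)
sub-∘ τ σ π ρ (∀² φ)  = cong ∀²_ (trans (sub-∘ τ σ (lift² π) (lift² ρ) φ) (sub-ext (λ _ → refl) eq φ))
  where
  eq : ∀ X → lift² π (lift² ρ X) ≡ lift² (π ∘ ρ) X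
  eq zero    = refl
  eq (suc X) = refl

Δ⁰₀-sub : ∀ {m n s r} {σ : Fin m → Term n} {ρ : Fin s → Fin r} {φ} → Δ⁰₀ φ → Δ⁰₀ (sub σ ρ φ)
Δ⁰₀-sub ⊥            = ⊥
Δ⁰₀-sub (t ≈ u)      = _ ≈ _
Δ⁰₀-sub (t < u)      = _ < _
Δ⁰₀-sub (t ∈ X)      = _ ∈ _
Δ⁰₀-sub (φ ⇒ ψ)      = Δ⁰₀-sub φ ⇒ Δ⁰₀-sub ψ
Δ⁰₀-sub {σ = σ} {ρ} (∀< t {φ} Δφ) =
  subst (λ u → Δ⁰₀ (∀¹ (x₀ < u ⇒ sub (lift¹ σ) ρ φ))) (sym (subT-lift-↑ σ t)) (∀< (subT σ t) (Δ⁰₀-sub Δφ))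

Σ⁰₁-sub : ∀ {m n s r} {σ : Fin m → Term n} {ρ : Fin s → Fin r} {φ} → Σ⁰₁ φ → Σ⁰₁ (sub σ ρ φ)
Σ⁰₁-sub (∃Δ⁰₀ Δθ) = ∃Δ⁰₀ (Δ⁰₀-sub Δθ)

Π⁰₁-sub : ∀ {m n s r} {σ : Fin m → Term n} {ρ : Fin s → Fin r} {φ} → Π⁰₁ φ → Π⁰₁ (sub σ ρ φ)
Π⁰₁-sub (∀Δ⁰₀ Δθ) = ∀Δ⁰₀ (Δ⁰₀-sub Δθ)

-- Axioms have free parameters rather than universal closures. In the term model the parameters
-- become arbitrary terms, so validity of the axioms there rests on this closure property.
RCA₀-sub : ∀ {m n s r} {σ : Fin m → Term n} {ρ : Fin s → Fin r} {φ} → RCA₀ φ → RCA₀ (sub σ ρ φ)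
RCA₀-sub suc≉0   = suc≉0
RCA₀-sub suc-inj = suc-inj
RCA₀-sub +-zero  = +-zero
RCA₀-sub +-suc   = +-suc
RCA₀-sub *-zero  = *-zero
RCA₀-sub *-suc   = *-suc
RCA₀-sub ≮0      = ≮0
RCA₀-sub <-suc   = <-suc
RCA₀-sub {σ = σ} {ρ} (Σ⁰₁-ind {φ} Σφ) =
  subst₂ (λ α β → RCA₀ (α ∧ (∀¹ (φ′ ⇒ β)) ⇒ ∀¹ φ′))
    (trans (sub-∘ _ _ _ _ φ) (trans (sub-ext eq₀ (λ _ → refl) φ) (sym (sub-∘ _ _ _ _ φ))))
    (trans (sub-∘ _ _ _ _ φ) (trans (sub-ext eq₁ (λ _ → refl) φ) (sym (sub-∘ _ _ _ _ φ))))
    (Σ⁰₁-ind (Σ⁰₁-sub Σφ))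
  where
  φ′ = sub (lift¹ σ) ρ φ
  eq₀ : ∀ i → _ ≡ _
  eq₀ zero    = refl
  eq₀ (suc i) = trans (subT-∘ _ _ (σ i)) (subT-var (σ i))
  eq₁ : ∀ i → _ ≡ _
  eq₁ zero    = refl
  eq₁ (suc i) = subT-∘ _ _ (σ i)
RCA₀-sub {σ = σ} {ρ} (Δ⁰₁-CA {φ} {ψ} Σφ Πψ) =
  subst (λ α → RCA₀ ((∀¹ (φ′ ⇔ ψ′)) ⇒ ∃² ∀¹ (x₀ ∈ zero ⇔ α)))
    (trans (sub-∘ _ _ _ _ φ) (trans (sub-ext eq (λ _ → refl) φ) (sym (sub-∘ _ _ _ _ φ))))
    (Δ⁰₁-CA (Σ⁰₁-sub Σφ) (Π⁰₁-sub Πψ))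
  where
  φ′ = sub (lift¹ σ) ρ φ
  ψ′ = sub (lift¹ σ) ρ ψ
  eq : ∀ i → subT var (lift¹ σ i) ≡ lift¹ σ i
  eq i = subT-var (lift¹ σ i)

weaken : ∀ {m s} {Γ Δ : List (Formula m s)} {φ} → Γ ⊆ˡ Δ → RCA₀ ∣ Γ ⊢ φ → RCA₀ ∣ Δ ⊢ φ
weaken ι (hyp x)      = hyp (ι x)
weaken ι (ax a)       = ax a
weaken ι (⇒I d)       = ⇒I (weaken (∷⁺ʳ _ ι) d)
weaken ι (⇒E d e)     = ⇒E (weaken ι d) (weaken ι e)
weaken ι (raa d)      = raa (weaken (∷⁺ʳ _ ι) d)
weaken ι (∀¹I d)      = ∀¹I (weaken (map⁺ _ ι) d)
weaken ι (∀¹E d t)    = ∀¹E (weaken ι d) t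
weaken ι (∀²I d)      = ∀²I (weaken (map⁺ _ ι) d)
weaken ι (∀²E d X)    = ∀²E (weaken ι d) X
weaken ι ≈I           = ≈I
weaken ι (≈E φ d e)   = ≈E φ (weaken ι d) (weaken ι e)

exfalso : ∀ {m s} {Γ : List (Formula m s)} {φ} → RCA₀ ∣ Γ ⊢ ⊥ → RCA₀ ∣ Γ ⊢ φ
exfalso d = raa (weaken there d)

-- Models with an arbitrary falsity

record Structure : Set₁ where
  infix 4 _≋_ _≺_ _ε_
  infixl 6 _+_
  infixl 7 _*_
  field
    N S     : Set
    B       : Set
    _≋_ _≺_ : N → N → Set
    _ε_     : N → S → Set
    0#  1#  : N
    _+_ _*_ : N → N → N

module Semantics (M : Structure) where
  open Structure M

  ⟦_⟧ᵗ : ∀ {m} → Term m → Vec N m → N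
  ⟦ var i ⟧ᵗ η = lookup η i
  ⟦ 𝟎 ⟧ᵗ     η = 0#
  ⟦ 𝟏 ⟧ᵗ     η = 1#
  ⟦ t ⊕ u ⟧ᵗ η = ⟦ t ⟧ᵗ η + ⟦ u ⟧ᵗ η
  ⟦ t · u ⟧ᵗ η = ⟦ t ⟧ᵗ η * ⟦ u ⟧ᵗ η

  ⟦_⟧ᶠ : ∀ {m s} → Formula m s → Vec N m → Vec S s → Set
  ⟦ ⊥ ⟧ᶠ     η ρ = B
  ⟦ t ≈ u ⟧ᶠ η ρ = ⟦ t ⟧ᵗ η ≋ ⟦ u ⟧ᵗ η
  ⟦ t < u ⟧ᶠ η ρ = ⟦ t ⟧ᵗ η ≺ ⟦ u ⟧ᵗ η
  ⟦ t ∈ X ⟧ᶠ η ρ = ⟦ t ⟧ᵗ η ε lookup ρ X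
  ⟦ φ ⇒ ψ ⟧ᶠ η ρ = ⟦ φ ⟧ᶠ η ρ → ⟦ ψ ⟧ᶠ η ρ
  ⟦ ∀¹ φ ⟧ᶠ  η ρ = ∀ a → ⟦ φ ⟧ᶠ (a ∷ η) ρ
  ⟦ ∀² φ ⟧ᶠ  η ρ = ∀ X → ⟦ φ ⟧ᶠ η (X ∷ ρ)

-- Falsity is interpreted by an arbitrary type B with respect to which the atoms
-- are double-negation stable.  For such models completeness is constructive.
record Model : Set₁ where
  field structure : Structure
  open Structure structure public
  open Semantics structure public
  field
    ≋-refl   : ∀ {a} → a ≋ a
    leibniz  : ∀ {m s} (φ : Formula (suc m) s) η ρ {a b} → a ≋ b → ⟦ φ ⟧ᶠ (a ∷ η) ρ → ⟦ φ ⟧ᶠ (b ∷ η) ρ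
    ≋-stable : ∀ {a b} → ((a ≋ b → B) → B) → a ≋ b
    ≺-stable : ∀ {a b} → ((a ≺ b → B) → B) → a ≺ b
    ε-stable : ∀ {a X} → ((a ε X → B) → B) → a ε X
    axiom    : ∀ {m s} {φ : Formula m s} → RCA₀ φ → ∀ η ρ → ⟦ φ ⟧ᶠ η ρ

-- Completeness

-- The variables `v i` are an inexhaustible supply of Henkin constants; they become terms of a
-- finite scope only through `inst`.
data Tm : Set where
  v       : ℕ → Tm
  𝟎 𝟏     : Tm
  _⊕_ _·_ : Tm → Tm → Tm

inst : ∀ {m} → Tm → (ℕ → Term m) → Term m
inst (v i)   ν = ν i
inst 𝟎       ν = 𝟎
inst 𝟏       ν = 𝟏
inst (t ⊕ u) ν = inst t ν ⊕ inst u ν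
inst (t · u) ν = inst t ν · inst u ν

-- The substitution is kept delayed so that the truth lemma can recurse on the formula alone.
Closure : Set
Closure = ∃ λ m → ∃ λ s → Formula m s × Vec Tm m × Vec ℕ s

-- A formula over two countable supplies of variables, given by its instances
-- in all finite scopes.
Open : Set
Open = ∀ m s → (ℕ → Term m) → (ℕ → Fin s) → Formula m s

⌈_⌉ : Closure → Open
⌈ _ , _ , φ , η , ρ ⌉ _ _ ν μ = sub (λ i → inst (lookup η i) ν) (λ X → μ (lookup ρ X)) φ

infixr 2 _⇒ᵒ_
_⇒ᵒ_ : Open → Open → Open
(d ⇒ᵒ e) m s ν μ = d m s ν μ ⇒ e m s ν μ

⊥ᵒ : Open
⊥ᵒ _ _ _ _ = ⊥

infix 0 _⊩_ _⊢*_
-- Uniformity over all scopes and valuations stands in for a single infinite scope, which the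
-- calculus does not have.
_⊩_ : List Open → Open → Set
Γ ⊩ d = ∀ m s ν μ → RCA₀ ∣ map (λ e → e m s ν μ) Γ ⊢ d m s ν μ

record _⊢*_ (P : Open → Set) (d : Open) : Set where
  constructor derived
  field
    {context}  : List Open
    axioms     : All P context
    derivation : context ⊩ d

weaken* : ∀ {Γ Δ d} → Γ ⊆ˡ Δ → Γ ⊩ d → Δ ⊩ d
weaken* ι p m s ν μ = weaken (map⁺ _ ι) (p m s ν μ)

module _ {P : Open → Set} where

  hyp* : ∀ {d} → P d → P ⊢* d
  hyp* p = derived (p ∷ []) λ _ _ _ _ → hyp (here refl)

  valid* : ∀ {d} → (∀ Γ → Γ ⊩ d) → P ⊢* d
  valid* p = derived [] (p [])

  zip* : ∀ {c d e} → (∀ {m s} {Γ : List (Formula m s)} ν μ →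
           RCA₀ ∣ Γ ⊢ c m s ν μ → RCA₀ ∣ Γ ⊢ d m s ν μ → RCA₀ ∣ Γ ⊢ e m s ν μ) →
         P ⊢* c → P ⊢* d → P ⊢* e
  zip* r (derived {Γ} p f) (derived q g) = derived (All.++⁺ p q) λ m s ν μ →
    r ν μ (weaken* ∈-++⁺ˡ f m s ν μ) (weaken* (∈-++⁺ʳ Γ) g m s ν μ)

  infixl 9 _$*_
  _$*_ : ∀ {d e} → P ⊢* (d ⇒ᵒ e) → P ⊢* d → P ⊢* e
  _$*_ = zip* (λ _ _ → ⇒E)

  map* : ∀ {d e} → (∀ {m s} {Γ : List (Formula m s)} ν μ → RCA₀ ∣ Γ ⊢ d m s ν μ → RCA₀ ∣ Γ ⊢ e m s ν μ) →
         P ⊢* d → P ⊢* e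
  map* f (derived p g) = derived p λ m s ν μ → f ν μ (g m s ν μ)

  conv* : ∀ {d e} → (∀ {m s} ν μ → d m s ν μ ≡ e m s ν μ) → P ⊢* d → P ⊢* e
  conv* eq = map* (λ ν μ → subst (RCA₀ ∣ _ ⊢_) (eq ν μ))

  strip : ∀ {e Γ} → All (λ d → P d ⊎ d ≡ e) Γ → ∃ λ Δ → All P Δ × Γ ⊆ˡ (e ∷ Δ)
  strip [] = [] , [] , λ ()
  strip (inj₁ p ∷ ps) with Δ , q , ι ← strip ps =
    _ ∷ Δ , p ∷ q , λ { (here refl) → there (here refl) ; (there x) → ∷⁺ʳ _ there (ι x) }
  strip (inj₂ refl ∷ ps) with Δ , q , ι ← strip ps =
    Δ , q , λ { (here refl) → here refl ; (there x) → ι x }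

  ⇒I* : ∀ {d e} → (λ f → P f ⊎ f ≡ d) ⊢* e → P ⊢* (d ⇒ᵒ e)
  ⇒I* (derived p f) with Δ , q , ι ← strip p = derived q λ m s ν μ → ⇒I (weaken* ι f m s ν μ)

mono* : ∀ {P Q : Open → Set} {d} → (∀ {e} → P e → Q e) → P ⊢* d → Q ⊢* d
mono* ι (derived p f) = derived (All.map ι p) f

-- Below k d: the value of d depends only on the variables below k, and d
-- commutes with substitution.
Below : ℕ → Open → Set
Below k d = ∀ {m s m′ s′} (σ : Fin m → Term m′) (τ : Fin s → Fin s′) ν μ ν′ μ′ →
  (∀ i → i ℕ.< k → subT σ (ν i) ≡ ν′ i) → (∀ i → i ℕ.< k → τ (μ i) ≡ μ′ i) →
  sub σ τ (d m s ν μ) ≡ d m′ s′ ν′ μ′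

Below-mono : ∀ {k l d} → k ℕ.≤ l → Below k d → Below l d
Below-mono k≤l b σ τ ν μ ν′ μ′ e e′ =
  b σ τ ν μ ν′ μ′ (λ i i<k → e i (ℕ.<-≤-trans i<k k≤l)) (λ i i<k → e′ i (ℕ.<-≤-trans i<k k≤l))

boundᵗ : Tm → ℕ
boundᵗ (v i)   = suc i
boundᵗ 𝟎       = 0
boundᵗ 𝟏       = 0
boundᵗ (t ⊕ u) = boundᵗ t ⊔ boundᵗ u
boundᵗ (t · u) = boundᵗ t ⊔ boundᵗ u

boundᵛ : ∀ {A : Set} {n} → (A → ℕ) → Vec A n → ℕ
boundᵛ f []       = 0
boundᵛ f (x ∷ xs) = f x ⊔ boundᵛ f xs

lookup≤boundᵛ : ∀ {A : Set} {n} (f : A → ℕ) (xs : Vec A n) i → f (lookup xs i) ℕ.≤ boundᵛ f xs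
lookup≤boundᵛ f (x ∷ xs) zero    = ℕ.m≤m⊔n _ _
lookup≤boundᵛ f (x ∷ xs) (suc i) = ℕ.≤-trans (lookup≤boundᵛ f xs i) (ℕ.m≤n⊔m _ _)

bound : Closure → ℕ
bound (_ , _ , _ , η , ρ) = boundᵛ boundᵗ η ⊔ boundᵛ suc ρ

inst-sub : ∀ {m n} (σ : Fin m → Term n) ν ν′ t → (∀ i → i ℕ.< boundᵗ t → subT σ (ν i) ≡ ν′ i) →
           subT σ (inst t ν) ≡ inst t ν′
inst-sub σ ν ν′ (v i)   e = e i ℕ.≤-refl
inst-sub σ ν ν′ 𝟎       e = refl
inst-sub σ ν ν′ 𝟏       e = refl
inst-sub σ ν ν′ (t ⊕ u) e =
  cong₂ _⊕_ (inst-sub σ ν ν′ t λ i p → e i (ℕ.≤-trans p (ℕ.m≤m⊔n _ _)))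
            (inst-sub σ ν ν′ u λ i p → e i (ℕ.≤-trans p (ℕ.m≤n⊔m (boundᵗ t) _)))
inst-sub σ ν ν′ (t · u) e =
  cong₂ _·_ (inst-sub σ ν ν′ t λ i p → e i (ℕ.≤-trans p (ℕ.m≤m⊔n _ _)))
            (inst-sub σ ν ν′ u λ i p → e i (ℕ.≤-trans p (ℕ.m≤n⊔m (boundᵗ t) _)))

⌈⌉-below : ∀ c → Below (bound c) ⌈ c ⌉
⌈⌉-below (m , s , φ , η , ρ) σ τ ν μ ν′ μ′ e e′ = trans (sub-∘ _ _ _ _ φ) (sub-ext
  (λ i → inst-sub σ ν ν′ (lookup η i) λ j p →
     e j (ℕ.≤-trans p (ℕ.≤-trans (lookup≤boundᵛ boundᵗ η i) (ℕ.m≤m⊔n _ _))))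
  (λ X → e′ (lookup ρ X) (ℕ.≤-trans (lookup≤boundᵛ suc ρ X) (ℕ.m≤n⊔m (boundᵛ boundᵗ η) _))) φ)

-- Henkin axioms

-- As ∃ is an abbreviation, only universal formulas need witnesses: `k` is a generic counterexample,
-- and if the instance at `k` holds then so does the universal statement. All other closures get a
-- tautology, so that every closure can be treated alike.
henkin : ℕ → Closure → Open
henkin k c@(m , s , ∀¹ φ , η , ρ) = ⌈ suc m , s , φ , v k ∷ η , ρ ⌉ ⇒ᵒ ⌈ c ⌉
henkin k c@(m , s , ∀² φ , η , ρ) = ⌈ m , suc s , φ , η , k ∷ ρ ⌉ ⇒ᵒ ⌈ c ⌉
henkin k _                        = ⊥ᵒ ⇒ᵒ ⊥ᵒ

henkin-below : ∀ k c → bound c ℕ.≤ k → Below (suc k) (henkin k c)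
henkin-below k (m , s , ⊥ , η , ρ) b     _ _ _ _ _ _ _ _ = refl
henkin-below k (m , s , _ ≈ _ , η , ρ) b _ _ _ _ _ _ _ _ = refl
henkin-below k (m , s , _ < _ , η , ρ) b _ _ _ _ _ _ _ _ = refl
henkin-below k (m , s , _ ∈ _ , η , ρ) b _ _ _ _ _ _ _ _ = refl
henkin-below k (m , s , (_ ⇒ _) , η , ρ) b _ _ _ _ _ _ _ _ = refl
henkin-below k c@(m , s , ∀¹ φ , η , ρ) b σ τ ν μ ν′ μ′ e e′ = cong₂ _⇒_
  (Below-mono {bound (suc m , s , φ , v k ∷ η , ρ)} {d = ⌈ suc m , s , φ , v k ∷ η , ρ ⌉}
    (ℕ.⊔-lub (ℕ.⊔-lub (ℕ.≤-refl {suc k}) (ℕ.≤-trans (ℕ.≤-trans (ℕ.m≤m⊔n (boundᵛ boundᵗ η) _) b) (ℕ.n≤1+n k)))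
             (ℕ.≤-trans (ℕ.≤-trans (ℕ.m≤n⊔m (boundᵛ boundᵗ η) (boundᵛ suc ρ)) b) (ℕ.n≤1+n k)))
    (⌈⌉-below (suc m , s , φ , v k ∷ η , ρ)) σ τ ν μ ν′ μ′ e e′)
  (Below-mono {bound c} {d = ⌈ c ⌉} (ℕ.≤-trans b (ℕ.n≤1+n k)) (⌈⌉-below c) σ τ ν μ ν′ μ′ e e′)
henkin-below k c@(m , s , ∀² φ , η , ρ) b σ τ ν μ ν′ μ′ e e′ = cong₂ _⇒_
  (Below-mono {bound (m , suc s , φ , η , k ∷ ρ)} {d = ⌈ m , suc s , φ , η , k ∷ ρ ⌉}
    (ℕ.⊔-lub (ℕ.≤-trans (ℕ.≤-trans (ℕ.m≤m⊔n (boundᵛ boundᵗ η) _) b) (ℕ.n≤1+n k))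
             (ℕ.⊔-lub (ℕ.≤-refl {suc k}) (ℕ.≤-trans (ℕ.≤-trans (ℕ.m≤n⊔m (boundᵛ boundᵗ η) (boundᵛ suc ρ)) b) (ℕ.n≤1+n k))))
    (⌈⌉-below (m , suc s , φ , η , k ∷ ρ)) σ τ ν μ ν′ μ′ e e′)
  (Below-mono {bound c} {d = ⌈ c ⌉} (ℕ.≤-trans b (ℕ.n≤1+n k)) (⌈⌉-below c) σ τ ν μ ν′ μ′ e e′)

update : ∀ {A : Set} → ℕ → A → (ℕ → A) → ℕ → A
update k a f i with i ℕ.≟ k
... | yes _ = a
... | no  _ = f i

update-same : ∀ {A : Set} k (a : A) f → update k a f k ≡ a
update-same k a f with k ℕ.≟ k
... | yes _  = refl
... | no k≢k = ⊥-elim (k≢k refl)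

update-below : ∀ {A : Set} k (a : A) f i → i ℕ.< k → update k a f i ≡ f i
update-below k a f i i<k with i ℕ.≟ k
... | yes refl = ⊥-elim (ℕ.<-irrefl refl i<k)
... | no _     = refl

map-below : ∀ {k Γ m s m′ s′} (σ : Fin m → Term m′) (τ : Fin s → Fin s′) ν μ ν′ μ′ →
  (∀ i → i ℕ.< k → subT σ (ν i) ≡ ν′ i) → (∀ i → i ℕ.< k → τ (μ i) ≡ μ′ i) →
  All (Below k) Γ → map (λ e → e m′ s′ ν′ μ′) Γ ≡ map (sub σ τ) (map (λ e → e m s ν μ) Γ)
map-below σ τ ν μ ν′ μ′ e e′ []       = refl
map-below σ τ ν μ ν′ μ′ e e′ (b ∷ bs) =
  cong₂ _∷_ (sym (b σ τ ν μ ν′ μ′ e e′)) (map-below σ τ ν μ ν′ μ′ e e′ bs)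

-- A Henkin axiom with a fresh witness refutes nothing new: from Γ, φ(k) ⇒ ∀φ ⊢ ⊥
-- one gets both Γ ⊢ φ(k), hence Γ ⊢ ∀φ, and Γ ⊢ ¬∀φ.
cut-henkin : ∀ {k Γ} c → bound c ℕ.≤ k → All (Below k) Γ → henkin k c ∷ Γ ⊩ ⊥ᵒ → Γ ⊩ ⊥ᵒ
cut-henkin (m , s , ⊥ , η , ρ) b bs p     m′ s′ ν μ = ⇒E (⇒I (p m′ s′ ν μ)) (⇒I (hyp (here refl)))
cut-henkin (m , s , _ ≈ _ , η , ρ) b bs p m′ s′ ν μ = ⇒E (⇒I (p m′ s′ ν μ)) (⇒I (hyp (here refl)))
cut-henkin (m , s , _ < _ , η , ρ) b bs p m′ s′ ν μ = ⇒E (⇒I (p m′ s′ ν μ)) (⇒I (hyp (here refl)))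
cut-henkin (m , s , _ ∈ _ , η , ρ) b bs p m′ s′ ν μ = ⇒E (⇒I (p m′ s′ ν μ)) (⇒I (hyp (here refl)))
cut-henkin (m , s , (_ ⇒ _) , η , ρ) b bs p m′ s′ ν μ = ⇒E (⇒I (p m′ s′ ν μ)) (⇒I (hyp (here refl)))
cut-henkin {k} {Γ} (m , s , ∀¹ φ , η , ρ) b bs p m′ s′ ν μ =
  ⇒E (⇒I (p m′ s′ ν μ)) (⇒I (weaken there all))
  where
  -- The fresh variable is interpreted by the newly bound one. `Γ` and the closure look only at
  -- variables below `k` and see a plain weakening.
  ν′ = update k x₀ (↑ ∘ ν)
  eq : ∀ i → inst (lookup (v k ∷ η) i) ν′ ≡ lift¹ (λ j → inst (lookup η j) ν) i
  eq zero    = update-same k x₀ (↑ ∘ ν)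
  eq (suc i) = sym (inst-sub (var ∘ suc) ν ν′ (lookup η i) λ j q → sym (update-below k x₀ (↑ ∘ ν) j
    (ℕ.<-≤-trans q (ℕ.≤-trans (lookup≤boundᵛ boundᵗ η i) (ℕ.≤-trans (ℕ.m≤m⊔n _ _) b)))))
  all : RCA₀ ∣ map (λ e → e m′ s′ ν μ) Γ ⊢ ∀¹ sub (lift¹ (λ i → inst (lookup η i) ν)) (λ X → μ (lookup ρ X)) φ
  all = ∀¹I (subst₂ (RCA₀ ∣_⊢_)
    (map-below (var ∘ suc) id ν μ ν′ μ (λ i i<k → sym (update-below k x₀ (↑ ∘ ν) i i<k)) (λ _ _ → refl) bs)
    (sub-ext eq (λ _ → refl) φ)
    (raa (⇒E (weaken there (⇒I (p (suc m′) s′ ν′ μ)))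
             (⇒I (exfalso (⇒E (hyp (there (here refl))) (hyp (here refl))))))))
cut-henkin {k} {Γ} (m , s , ∀² φ , η , ρ) b bs p m′ s′ ν μ =
  ⇒E (⇒I (p m′ s′ ν μ)) (⇒I (weaken there all))
  where
  μ′ = update k zero (suc ∘ μ)
  eq : ∀ X → μ′ (lookup (k ∷ ρ) X) ≡ lift² (λ Y → μ (lookup ρ Y)) X
  eq zero    = update-same k zero (suc ∘ μ)
  eq (suc X) = update-below k zero (suc ∘ μ) _
    (ℕ.≤-trans (lookup≤boundᵛ suc ρ X) (ℕ.≤-trans (ℕ.m≤n⊔m (boundᵛ boundᵗ η) _) b))
  all : RCA₀ ∣ map (λ e → e m′ s′ ν μ) Γ ⊢ ∀² sub (λ i → inst (lookup η i) ν) (lift² (λ X → μ (lookup ρ X))) φ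
  all = ∀²I (subst₂ (RCA₀ ∣_⊢_)
    (map-below var suc ν μ ν μ′ (λ i _ → subT-var (ν i)) (λ i i<k → sym (update-below k zero (suc ∘ μ) i i<k)) bs)
    (sub-ext (λ _ → refl) eq φ)
    (raa (⇒E (weaken there (⇒I (p m′ (suc s′) ν μ′)))
             (⇒I (exfalso (⇒E (hyp (there (here refl))) (hyp (here refl))))))))

-- Enumeration of all closures

enumᵗ : ℕ → ∀ m → List (Term m)
enumᵗ zero    m = []
enumᵗ (suc n) m = enumᵗ n m ++ 𝟎 ∷ 𝟏 ∷ map var (allFin m)
  ++ cartesianProductWith _⊕_ (enumᵗ n m) (enumᵗ n m) ++ cartesianProductWith _·_ (enumᵗ n m) (enumᵗ n m)

enum : ℕ → ∀ m s → List (Formula m s)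
enum zero    m s = []
enum (suc n) m s = enum n m s ++ ⊥ ∷ map ∀¹_ (enum n (suc m) s) ++ map ∀²_ (enum n m (suc s))
  ++ cartesianProductWith _⇒_ (enum n m s) (enum n m s)
  ++ cartesianProductWith _≈_ (enumᵗ n m) (enumᵗ n m) ++ cartesianProductWith _<_ (enumᵗ n m) (enumᵗ n m)
  ++ cartesianProductWith _∈_ (enumᵗ n m) (allFin s)

enumᵐ : ℕ → List Tm
enumᵐ zero    = []
enumᵐ (suc n) = enumᵐ n ++ v n ∷ 𝟎 ∷ 𝟏 ∷
  cartesianProductWith _⊕_ (enumᵐ n) (enumᵐ n) ++ cartesianProductWith _·_ (enumᵐ n) (enumᵐ n)

enumᵛ : ∀ {A : Set} → List A → ∀ n → List (Vec A n)
enumᵛ xs zero    = [] ∷ []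
enumᵛ xs (suc n) = cartesianProductWith _∷_ xs (enumᵛ xs n)

module _ {A : Set} (L : ℕ → List A) (grow : ∀ n → L n ⊆ˡ L (suc n)) where

  grow-≤ : ∀ {m n} → m ℕ.≤ n → L m ⊆ˡ L n
  grow-≤ {m} m≤n with k , refl ← ℕ.m≤n⇒∃[o]m+o≡n m≤n = subst (λ j → L m ⊆ˡ L j) (ℕ.+-comm k m) (go k)
    where
    go : ∀ k → L m ⊆ˡ L (k ℕ.+ m)
    go zero    x = x
    go (suc k) x = grow (k ℕ.+ m) (go k x)

  merge : ∀ {a b} → ∃ (λ n → a ∈ˡ L n) → ∃ (λ n → b ∈ˡ L n) → ∃ λ n → a ∈ˡ L n × b ∈ˡ L n
  merge (m , x) (n , y) = m ⊔ n , grow-≤ (ℕ.m≤m⊔n m n) x , grow-≤ (ℕ.m≤n⊔m m n) y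

module _ {m : ℕ} where

  private
    L = λ n → enumᵗ n m

  mergeᵗ = merge L (λ _ → ∈-++⁺ˡ)

  enumᵗ-complete : (t : Term m) → ∃ λ n → t ∈ˡ enumᵗ n m
  enumᵗ-complete (var i) = 1 , there (there (∈-++⁺ˡ (∈-map⁺ var (∈-allFin i))))
  enumᵗ-complete 𝟎       = 1 , here refl
  enumᵗ-complete 𝟏       = 1 , there (here refl)
  enumᵗ-complete (t ⊕ u) with n , x , y ← mergeᵗ (enumᵗ-complete t) (enumᵗ-complete u) =
    suc n , ∈-++⁺ʳ (L n) (there (there (∈-++⁺ʳ (map var (allFin m)) (∈-++⁺ˡ (∈-cartesianProductWith⁺ _⊕_ x y)))))
  enumᵗ-complete (t · u) with n , x , y ← mergeᵗ (enumᵗ-complete t) (enumᵗ-complete u) =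
    suc n , ∈-++⁺ʳ (L n) (there (there (∈-++⁺ʳ (map var (allFin m))
      (∈-++⁺ʳ (cartesianProductWith _⊕_ (L n) (L n)) (∈-cartesianProductWith⁺ _·_ x y)))))

enum-complete : ∀ {m s} (φ : Formula m s) → ∃ λ n → φ ∈ˡ enum n m s
enum-complete ⊥ = 1 , here refl
enum-complete {m} {s} (t ≈ u) with n , x , y ← mergeᵗ (enumᵗ-complete t) (enumᵗ-complete u) =
  suc n , ∈-++⁺ʳ (enum n m s) (there (∈-++⁺ʳ (map ∀¹_ (enum n (suc m) s)) (∈-++⁺ʳ (map ∀²_ (enum n m (suc s)))
    (∈-++⁺ʳ (cartesianProductWith _⇒_ (enum n m s) (enum n m s)) (∈-++⁺ˡ (∈-cartesianProductWith⁺ _≈_ x y))))))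
enum-complete {m} {s} (t < u) with n , x , y ← mergeᵗ (enumᵗ-complete t) (enumᵗ-complete u) =
  suc n , ∈-++⁺ʳ (enum n m s) (there (∈-++⁺ʳ (map ∀¹_ (enum n (suc m) s)) (∈-++⁺ʳ (map ∀²_ (enum n m (suc s)))
    (∈-++⁺ʳ (cartesianProductWith _⇒_ (enum n m s) (enum n m s))
    (∈-++⁺ʳ (cartesianProductWith _≈_ (enumᵗ n m) (enumᵗ n m)) (∈-++⁺ˡ (∈-cartesianProductWith⁺ _<_ x y)))))))
enum-complete {m} {s} (t ∈ X) with n , x ← enumᵗ-complete t =
  suc n , ∈-++⁺ʳ (enum n m s) (there (∈-++⁺ʳ (map ∀¹_ (enum n (suc m) s)) (∈-++⁺ʳ (map ∀²_ (enum n m (suc s)))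
    (∈-++⁺ʳ (cartesianProductWith _⇒_ (enum n m s) (enum n m s))
    (∈-++⁺ʳ (cartesianProductWith _≈_ (enumᵗ n m) (enumᵗ n m)) (∈-++⁺ʳ (cartesianProductWith _<_ (enumᵗ n m) (enumᵗ n m))
    (∈-cartesianProductWith⁺ _∈_ x (∈-allFin X))))))))
enum-complete {m} {s} (φ ⇒ ψ)
  with n , x , y ← merge (λ n → enum n m s) (λ _ → ∈-++⁺ˡ) (enum-complete φ) (enum-complete ψ) =
  suc n , ∈-++⁺ʳ (enum n m s) (there (∈-++⁺ʳ (map ∀¹_ (enum n (suc m) s)) (∈-++⁺ʳ (map ∀²_ (enum n m (suc s)))
    (∈-++⁺ˡ (∈-cartesianProductWith⁺ _⇒_ x y)))))
enum-complete {m} {s} (∀¹ φ) with n , x ← enum-complete φ =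
  suc n , ∈-++⁺ʳ (enum n m s) (there (∈-++⁺ˡ (∈-map⁺ ∀¹_ x)))
enum-complete {m} {s} (∀² φ) with n , x ← enum-complete φ =
  suc n , ∈-++⁺ʳ (enum n m s) (there (∈-++⁺ʳ (map ∀¹_ (enum n (suc m) s)) (∈-++⁺ˡ (∈-map⁺ ∀²_ x))))

enumᵐ-complete : (t : Tm) → ∃ λ n → t ∈ˡ enumᵐ n
enumᵐ-complete (v i) = suc i , ∈-++⁺ʳ (enumᵐ i) (here refl)
enumᵐ-complete 𝟎     = 1 , there (here refl)
enumᵐ-complete 𝟏     = 1 , there (there (here refl))
enumᵐ-complete (t ⊕ u)
  with n , x , y ← merge enumᵐ (λ _ → ∈-++⁺ˡ) (enumᵐ-complete t) (enumᵐ-complete u) =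
  suc n , ∈-++⁺ʳ (enumᵐ n) (there (there (there (∈-++⁺ˡ (∈-cartesianProductWith⁺ _⊕_ x y)))))
enumᵐ-complete (t · u)
  with n , x , y ← merge enumᵐ (λ _ → ∈-++⁺ˡ) (enumᵐ-complete t) (enumᵐ-complete u) =
  suc n , ∈-++⁺ʳ (enumᵐ n) (there (there (there
    (∈-++⁺ʳ (cartesianProductWith _⊕_ (enumᵐ n) (enumᵐ n)) (∈-cartesianProductWith⁺ _·_ x y)))))

enumᵛ-complete : ∀ {A : Set} (L : ℕ → List A) → (∀ n → L n ⊆ˡ L (suc n)) → (∀ a → ∃ λ n → a ∈ˡ L n) →
                 ∀ {k} (w : Vec A k) → ∃ λ n → ∀ {m} → n ℕ.≤ m → w ∈ˡ enumᵛ (L m) k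
enumᵛ-complete L grow c []      = 0 , λ _ → here refl
enumᵛ-complete L grow c (a ∷ w) with n , x ← c a | n′ , y ← enumᵛ-complete L grow c w =
  n ⊔ n′ , λ p → ∈-cartesianProductWith⁺ _∷_ (grow-≤ L grow (ℕ.≤-trans (ℕ.m≤m⊔n n n′) p) x)
                   (y (ℕ.≤-trans (ℕ.m≤n⊔m n n′) p))

enumᶜ : ℕ → List Closure
enumᶜ n = concatMap (λ m → concatMap (λ s → cartesianProductWith (λ φ (η , ρ) → m , s , φ , η , ρ) (enum n m s)
  (cartesianProductWith _,_ (enumᵛ (enumᵐ n) m) (enumᵛ (upTo n) s))) (upTo n)) (upTo n)

enumᶜ-complete : ∀ c → ∃ λ n → c ∈ˡ enumᶜ n
enumᶜ-complete (m , s , φ , η , ρ)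
  with a , x ← enum-complete φ
     | b , y ← enumᵛ-complete enumᵐ (λ _ → ∈-++⁺ˡ) enumᵐ-complete η
     | d , w ← enumᵛ-complete upTo (λ n x → ∈-upTo⁺ (ℕ.m≤n⇒m≤1+n (∈-upTo⁻ x))) (λ i → suc i , ∈-upTo⁺ ℕ.≤-refl) ρ =
  n , ∈-concat⁺′ (∈-concat⁺′ (∈-cartesianProductWith⁺ _
    (grow-≤ (λ k → enum k m s) (λ _ → ∈-++⁺ˡ) (ℕ.m≤n+m a e) x)
    (∈-cartesianProductWith⁺ _,_
      (y (ℕ.≤-trans (ℕ.≤-trans (ℕ.m≤n+m b (suc m ℕ.+ suc s)) (ℕ.m≤m+n _ d)) (ℕ.m≤m+n e a)))
      (w (ℕ.≤-trans (ℕ.m≤n+m d (suc m ℕ.+ suc s ℕ.+ b)) (ℕ.m≤m+n e a)))))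
    (∈-map⁺ _ (∈-upTo⁺ (ℕ.≤-trans (ℕ.≤-trans (ℕ.m≤n+m (suc s) (suc m)) (ℕ.m≤m+n _ b))
      (ℕ.≤-trans (ℕ.m≤m+n _ d) (ℕ.m≤m+n e a))))))
    (∈-map⁺ _ (∈-upTo⁺ (ℕ.≤-trans (ℕ.≤-trans (ℕ.m≤m+n (suc m) (suc s)) (ℕ.m≤m+n _ b))
      (ℕ.≤-trans (ℕ.m≤m+n _ d) (ℕ.m≤m+n e a)))))
  where
  e = suc m ℕ.+ suc s ℕ.+ b ℕ.+ d
  n = e ℕ.+ a

abstract
  closures : ∃ λ (L : ℕ → List Closure) → ∀ c → ∃ λ n → c ∈ˡ L n
  closures = enumᶜ , enumᶜ-complete

-- The limit theory and its term model

module TermModel (goal : Formula 0 0) where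

  ¬goal : Closure
  ¬goal = 0 , 0 , (¬ goal) , [] , []

  -- The successor leaves room for the witness of `c`, which is the very number under the successor.
  fresh : List Closure → ℕ
  fresh []      = 0
  fresh (c ∷ h) = suc (fresh h ⊔ bound c)

  witness : Closure → List Closure → ℕ
  witness c h = fresh h ⊔ bound c

  -- The theory after the closures in the list (last one first) have been
  -- treated.  A closure is added provided this does not refute more than before;
  -- this proviso need not be decidable.
  Ω Ω′ : List Closure → Closure → Open → Set
  Th : List Closure → Open → Set
  Ω  h c d = Th h d ⊎ d ≡ henkin (witness c h) c
  Ω′ h c d = Ω h c d ⊎ d ≡ ⌈ c ⌉
  Th []      d = d ≡ ⌈ ¬goal ⌉
  Th (c ∷ h) d = Ω h c d ⊎ (d ≡ ⌈ c ⌉ × (Ω′ h c ⊢* ⊥ᵒ → Ω h c ⊢* ⊥ᵒ))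

  Th-below : ∀ h {d} → Th h d → Below (fresh h) d
  Th-below []      refl = ⌈⌉-below ¬goal
  Th-below (c ∷ h) {d} (inj₁ (inj₁ p)) =
    Below-mono {fresh h} {d = d} (ℕ.m≤n⇒m≤1+n (ℕ.m≤m⊔n (fresh h) (bound c))) (Th-below h p)
  Th-below (c ∷ h) (inj₁ (inj₂ refl)) = henkin-below (witness c h) c (ℕ.m≤n⊔m (fresh h) (bound c))
  Th-below (c ∷ h) (inj₂ (refl , _)) =
    Below-mono {bound c} {d = ⌈ c ⌉} (ℕ.m≤n⇒m≤1+n (ℕ.m≤n⊔m (fresh h) (bound c))) (⌈⌉-below c)

  -- Whether `c` was added need not be decided. If the context contains `⌈ c ⌉` as an added closure,
  -- its membership proof carries the proviso that removes it; otherwise the derivation already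
  -- lives in `Ω h c`.
  drop-add : ∀ {h c} → Th (c ∷ h) ⊢* ⊥ᵒ → Ω h c ⊢* ⊥ᵒ
  drop-add {h} {c} (derived p f) = [ (λ p′ → derived p′ f) , (λ g → g (derived (All.map weak p) f)) ] (split p)
    where
    weak : ∀ {d} → Th (c ∷ h) d → Ω′ h c d
    weak (inj₁ x)       = inj₁ x
    weak (inj₂ (e , _)) = inj₂ e
    split : ∀ {Γ} → All (Th (c ∷ h)) Γ → All (Ω h c) Γ ⊎ (Ω′ h c ⊢* ⊥ᵒ → Ω h c ⊢* ⊥ᵒ)
    split []                 = inj₁ []
    split (inj₂ (_ , g) ∷ _) = inj₂ g
    split (inj₁ q ∷ qs)      = [ (λ qs′ → inj₁ (q ∷ qs′)) , inj₂ ] (split qs)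

  drop-henkin : ∀ {h c} → Ω h c ⊢* ⊥ᵒ → Th h ⊢* ⊥ᵒ
  drop-henkin {h} {c} (derived p f) with Δ , q , ι ← strip p =
    derived q (cut-henkin c (ℕ.m≤n⊔m (fresh h) (bound c))
      (All.map {P = Th h} {Q = Below (witness c h)}
        (λ {d} x → Below-mono {fresh h} {d = d} (ℕ.m≤m⊔n (fresh h) (bound c)) (Th-below h x)) q)
      (weaken* ι f))

  Th-conservative : ∀ h → Th h ⊢* ⊥ᵒ → Th [] ⊢* ⊥ᵒ
  Th-conservative []      p = p
  Th-conservative (c ∷ h) p = Th-conservative h (drop-henkin {c = c} (drop-add p))

  Th-++ : ∀ g {h d} → Th h d → Th (g ++ h) d
  Th-++ []      p = p
  Th-++ (c ∷ g) p = inj₁ (inj₁ (Th-++ g p))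

  stage : ℕ → List Closure
  stage zero    = []
  stage (suc n) = proj₁ closures n ++ stage n

  stage-mono : ∀ {m n d} → m ℕ.≤ n → Th (stage m) d → Th (stage n) d
  stage-mono {n = zero}  z≤n p = p
  stage-mono {m} {suc n} le  p with ℕ.m≤n⇒m<n∨m≡n le
  ... | inj₁ (s≤s le′) = Th-++ (proj₁ closures n) (stage-mono le′ p)
  ... | inj₂ refl      = p

  record Th∞ (d : Open) : Set where
    constructor at
    field
      n       : ℕ
      treated : Th (stage n) d

  infix 0 ⊢∞_
  ⊢∞_ : Open → Set
  ⊢∞ d = Th∞ ⊢* d

  collect : ∀ {Γ} → All Th∞ Γ → ∃ λ n → All (Th (stage n)) Γ
  collect []             = 0 , []
  collect (at m p ∷ ps) with n , qs ← collect ps =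
    m ⊔ n , stage-mono (ℕ.m≤m⊔n m n) p ∷ All.map (stage-mono (ℕ.m≤n⊔m m n)) qs

  ⊢∞-conservative : ⊢∞ ⊥ᵒ → Th [] ⊢* ⊥ᵒ
  ⊢∞-conservative (derived p f) with n , q ← collect p = Th-conservative (stage n) (derived q f)

  treated : ∀ c → ∃ λ n → ∃ λ g → ∃ λ h → stage n ≡ g ++ c ∷ h
  treated c with n , x ← proj₂ closures c with g , h , eq ← ∈-∃++ (∈-++⁺ˡ {ys = stage n} x) =
    suc n , g , h , eq

  ⊢∞-henkin : ∀ c → ∃ λ k → ⊢∞ henkin k c
  ⊢∞-henkin c with n , g , h , eq ← treated c =
    witness c h , hyp* (at n (subst (λ l → Th l (henkin (witness c h) c)) (sym eq) (Th-++ g (inj₁ (inj₂ refl)))))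

  Ω⇒Th∞ : ∀ n g h c {d} → stage n ≡ g ++ c ∷ h → Ω h c d → Th∞ d
  Ω⇒Th∞ n g h c {d} eq p = at n (subst (λ l → Th l d) (sym eq) (Th-++ g (inj₁ p)))

  -- Maximality of the limit theory. The proviso speaks of the stage at which `c` is treated; a
  -- refutation from the limit returns to that stage because the limit is conservative for ⊥ over
  -- `Th []`, which every stage contains.
  ⊢∞-add : ∀ c → ((λ d → Th∞ d ⊎ d ≡ ⌈ c ⌉) ⊢* ⊥ᵒ → ⊢∞ ⊥ᵒ) → ⊢∞ ⌈ c ⌉
  ⊢∞-add c f with n , g , h , eq ← treated c =
    hyp* (at n (subst (λ l → Th l ⌈ c ⌉) (sym eq) (Th-++ g (inj₂ (refl , λ p → back (f (mono* up p)))))))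
    where
    up : ∀ {d} → Ω′ h c d → Th∞ d ⊎ d ≡ ⌈ c ⌉
    up (inj₁ p) = inj₁ (Ω⇒Th∞ n g h c eq p)
    up (inj₂ e) = inj₂ e
    back : ⊢∞ ⊥ᵒ → Ω h c ⊢* ⊥ᵒ
    back p = mono* (λ q → inj₁ (base h q)) (⊢∞-conservative p)
      where
      base : ∀ h {d} → Th [] d → Th h d
      base []      q = q
      base (c ∷ h) q = inj₁ (inj₁ (base h q))

  structure : Structure
  structure = record
    { N = Tm ; S = ℕ ; B = ⊢∞ ⊥ᵒ
    ; _≋_ = λ a b → ⊢∞ λ _ _ ν _ → inst a ν ≈ inst b ν
    ; _≺_ = λ a b → ⊢∞ λ _ _ ν _ → inst a ν < inst b ν
    ; _ε_ = λ a X → ⊢∞ λ _ _ ν μ → inst a ν ∈ μ X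
    ; 0# = 𝟎 ; 1# = 𝟏 ; _+_ = _⊕_ ; _*_ = _·_ }

  open Semantics structure

  inst-⟦⟧ : ∀ {m n} (t : Term m) (η : Vec Tm m) (ν : ℕ → Term n) →
            inst (⟦ t ⟧ᵗ η) ν ≡ subT (λ i → inst (lookup η i) ν) t
  inst-⟦⟧ (var i) η ν = refl
  inst-⟦⟧ 𝟎       η ν = refl
  inst-⟦⟧ 𝟏       η ν = refl
  inst-⟦⟧ (t ⊕ u) η ν = cong₂ _⊕_ (inst-⟦⟧ t η ν) (inst-⟦⟧ u η ν)
  inst-⟦⟧ (t · u) η ν = cong₂ _·_ (inst-⟦⟧ t η ν) (inst-⟦⟧ u η ν)

  inst-∷ : ∀ {m s n r} (φ : Formula (suc m) s) (a : Tm) (η : Vec Tm m) (ρ : Vec ℕ s) (ν : ℕ → Term n) (μ : ℕ → Fin r) →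
    sub (lift¹ (λ i → inst (lookup η i) ν)) (λ X → μ (lookup ρ X)) φ [ inst a ν ]¹ ≡ ⌈ _ , _ , φ , a ∷ η , ρ ⌉ n r ν μ
  inst-∷ φ a η ρ ν μ = trans (sub-∘ _ _ _ _ φ) (sub-ext eq (λ _ → refl) φ)
    where
    eq : ∀ i → _ ≡ inst (lookup (a ∷ η) i) ν
    eq zero    = refl
    eq (suc i) = trans (subT-∘ _ _ (inst (lookup η i) ν)) (subT-var _)

  inst-∷² : ∀ {m s n r} (φ : Formula m (suc s)) (Y : ℕ) (η : Vec Tm m) (ρ : Vec ℕ s) (ν : ℕ → Term n) (μ : ℕ → Fin r) →
    sub (λ i → inst (lookup η i) ν) (lift² (λ X → μ (lookup ρ X))) φ [ μ Y ]² ≡ ⌈ _ , _ , φ , η , Y ∷ ρ ⌉ n r ν μ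
  inst-∷² φ Y η ρ ν μ = trans (sub-∘ _ _ _ _ φ) (sub-ext (λ i → subT-var _) eq φ)
    where
    eq : ∀ X → _ ≡ μ (lookup (Y ∷ ρ) X)
    eq zero    = refl
    eq (suc X) = refl

  -- The two directions are mutually recursive since implication exchanges them. As `B` is itself
  -- derivability of ⊥, no case asks whether a formula is derivable.
  truth  : ∀ {m s} (φ : Formula m s) η ρ → ⟦ φ ⟧ᶠ η ρ → ⊢∞ ⌈ m , s , φ , η , ρ ⌉
  truth′ : ∀ {m s} (φ : Formula m s) η ρ → ⊢∞ ⌈ m , s , φ , η , ρ ⌉ → ⟦ φ ⟧ᶠ η ρ

  truth ⊥       η ρ p = p
  truth (t ≈ u) η ρ p = conv* (λ ν μ → cong₂ _≈_ (inst-⟦⟧ t η ν) (inst-⟦⟧ u η ν)) p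
  truth (t < u) η ρ p = conv* (λ ν μ → cong₂ _<_ (inst-⟦⟧ t η ν) (inst-⟦⟧ u η ν)) p
  truth (t ∈ X) η ρ p = conv* (λ ν μ → cong (_∈ _) (inst-⟦⟧ t η ν)) p
  -- Suppose that adding φ ⇒ ψ leads to ⊥. Then its negation is derivable and classically yields φ;
  -- so φ is true, hence ψ is, and ψ gives back φ ⇒ ψ.
  truth (φ ⇒ ψ) η ρ p = ⊢∞-add (_ , _ , (φ ⇒ ψ) , η , ρ) λ q →
    let ¬φψ = ⇒I* q
        ⊢φ = map* (λ _ _ d → raa (⇒E (weaken there d) (⇒I (exfalso (⇒E (hyp (there (here refl))) (hyp (here refl))))))) ¬φψ
    in ¬φψ $* map* (λ _ _ d → ⇒I (weaken there d)) (truth ψ η ρ (p (truth′ φ η ρ ⊢φ)))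
  truth (∀¹ φ) η ρ p = let k , q = ⊢∞-henkin (_ , _ , (∀¹ φ) , η , ρ) in q $* truth φ (v k ∷ η) ρ (p (v k))
  truth (∀² φ) η ρ p = let k , q = ⊢∞-henkin (_ , _ , (∀² φ) , η , ρ) in q $* truth φ η (k ∷ ρ) (p k)

  truth′ ⊥       η ρ p = p
  truth′ (t ≈ u) η ρ p = conv* (λ ν μ → sym (cong₂ _≈_ (inst-⟦⟧ t η ν) (inst-⟦⟧ u η ν))) p
  truth′ (t < u) η ρ p = conv* (λ ν μ → sym (cong₂ _<_ (inst-⟦⟧ t η ν) (inst-⟦⟧ u η ν))) p
  truth′ (t ∈ X) η ρ p = conv* (λ ν μ → sym (cong (_∈ _) (inst-⟦⟧ t η ν))) p
  truth′ (φ ⇒ ψ) η ρ p q = truth′ ψ η ρ (p $* truth φ η ρ q)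
  truth′ (∀¹ φ) η ρ p a = truth′ φ (a ∷ η) ρ
    (map* (λ ν μ d → subst (RCA₀ ∣ _ ⊢_) (inst-∷ φ a η ρ ν μ) (∀¹E d (inst a ν))) p)
  truth′ (∀² φ) η ρ p Y = truth′ φ η (Y ∷ ρ)
    (map* (λ ν μ d → subst (RCA₀ ∣ _ ⊢_) (inst-∷² φ Y η ρ ν μ) (∀²E d (μ Y))) p)

  stable∞ : ∀ {d} → ((⊢∞ d → ⊢∞ ⊥ᵒ) → ⊢∞ ⊥ᵒ) → (∃ λ c → ∀ {m s} ν μ → ⌈ c ⌉ m s ν μ ≡ d m s ν μ) → ⊢∞ d
  stable∞ p (c , eq) = conv* eq (⊢∞-add c λ q → p λ r → ⇒I* q $* conv* (λ ν μ → sym (eq ν μ)) r)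

  model : Model
  model = record
    { structure = structure
    ; ≋-refl    = valid* (λ _ _ _ _ _ → ≈I)
    ; leibniz   = λ φ η ρ {a} {b} e p → truth′ φ (b ∷ η) ρ (leib φ η ρ a b e (truth φ (a ∷ η) ρ p))
    ; ≋-stable  = λ {a} {b} p → stable∞ p ((2 , 0 , x₀ ≈ x₁ , a ∷ b ∷ [] , []) , λ _ _ → refl)
    ; ≺-stable  = λ {a} {b} p → stable∞ p ((2 , 0 , x₀ < x₁ , a ∷ b ∷ [] , []) , λ _ _ → refl)
    ; ε-stable  = λ {a} {X} p → stable∞ p ((1 , 1 , x₀ ∈ zero , a ∷ [] , X ∷ []) , λ _ _ → refl)
    ; axiom     = λ {_} {_} {φ} a η ρ → truth′ φ η ρ (valid* (λ _ _ _ _ _ → ax (RCA₀-sub a)))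
    }
    where
    leib : ∀ {m s} (φ : Formula (suc m) s) η ρ a b → (⊢∞ λ _ _ ν _ → inst a ν ≈ inst b ν) →
           ⊢∞ ⌈ _ , _ , φ , a ∷ η , ρ ⌉ → ⊢∞ ⌈ _ , _ , φ , b ∷ η , ρ ⌉
    leib φ η ρ a b = zip* λ ν μ d e → subst (RCA₀ ∣ _ ⊢_) (inst-∷ φ b η ρ ν μ)
      (≈E (sub (lift¹ (λ i → inst (lookup η i) ν)) (λ X → μ (lookup ρ X)) φ) d
        (subst (RCA₀ ∣ _ ⊢_) (sym (inst-∷ φ a η ρ ν μ)) e))

  refute : ⟦ goal ⟧ᶠ [] [] → Th [] ⊢* ⊥ᵒ
  refute p = ⊢∞-conservative (hyp* {d = ⌈ ¬goal ⌉} (at 0 refl) $* truth goal [] [] p)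

-- The set existing by Δ⁰₁ comprehension provides the set variable needed to
-- instantiate an open formula.
complete : (φ : Formula 0 0) → (∀ M → Model.⟦_⟧ᶠ M φ [] []) → RCA₀ ⊢ φ
complete φ valid = raa (⇒E (⇒E (ax (Δ⁰₁-CA (∃Δ⁰₀ (𝟎 ≈ 𝟎)) (∀Δ⁰₀ (𝟎 ≈ 𝟎)))) trivial) (∀²I no-set))
  where
  open TermModel φ
  trivial : RCA₀ ∣ (¬ φ) ∷ [] ⊢ ∀¹ ((∃¹ 𝟎 ≈ 𝟎) ⇔ (∀¹ 𝟎 ≈ 𝟎))
  trivial = ∀¹I (⇒I (⇒E (⇒E (hyp (here refl)) (⇒I (∀¹I ≈I))) (⇒I (⇒I (⇒E (∀¹E (hyp (here refl)) 𝟎) ≈I)))))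
  instance-of-¬φ : ∀ {d} → Th [] d → d 0 1 (λ _ → 𝟎) (λ _ → zero) ≡ wk² (¬ φ)
  instance-of-¬φ refl = sub-ext (λ ()) (λ ()) (¬ φ)
  contradiction : RCA₀ ∣ wk² (¬ φ) ∷ [] ⊢ ⊥
  contradiction with derived p f ← refute (valid model) =
    weaken (λ x → only p x) (f 0 1 (λ _ → 𝟎) (λ _ → zero))
    where
    only : ∀ {Γ ψ} → All (Th []) Γ → ψ ∈ˡ map (λ d → d 0 1 (λ _ → 𝟎) (λ _ → zero)) Γ → ψ ∈ˡ wk² (¬ φ) ∷ []
    only (q ∷ qs) (here refl) = here (instance-of-¬φ q)
    only (q ∷ qs) (there x)   = only qs x
  no-set : RCA₀ ∣ wk² (¬ φ) ∷ [] ⊢ _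
  no-set = ⇒I (weaken there contradiction)

-- Double-negation reasoning inside a model

module InModel (M : Model) where
  open Model M

  -- Disjunctions and existential statements of the object language are negated, so a model reveals
  -- their witnesses only while an element of `B` is being produced: this is the continuation monad
  -- with answers in `B`.
  K : Set → Set
  K A = (A → B) → B

  return : ∀ {A} → A → K A
  return a k = k a

  infixl 1 _>>=_
  _>>=_ : ∀ {A C} → K A → (A → K C) → K C
  (m >>= f) k = m λ a → f a k

  em : ∀ {A : Set} → K (A ⊎ (A → B))
  em k = k (inj₂ (k ∘ inj₁))

  Iff : Set → Set → Set
  Iff A C = (A → C) × (C → A)

  Iff-trans : ∀ {A C D} → Iff A C → Iff C D → Iff A D
  Iff-trans (f , g) (h , i) = h ∘ f , g ∘ i

  ∃ᴷ : (N → Set) → Set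
  ∃ᴷ P = K (Σ N P)

  -- Stability of the atoms passes through ⇒ and ∀, so a witness found under `K` may be used towards
  -- any goal that is a formula.
  stable : ∀ {m s} (φ : Formula m s) {η ρ} → K (⟦ φ ⟧ᶠ η ρ) → ⟦ φ ⟧ᶠ η ρ
  stable ⊥       k = k id
  stable (t ≈ u) k = ≋-stable k
  stable (t < u) k = ≺-stable k
  stable (t ∈ X) k = ε-stable k
  stable (φ ⇒ ψ) k = λ p → stable ψ λ q → k λ f → q (f p)
  stable (∀¹ φ)  k = λ a → stable φ λ q → k λ f → q (f a)
  stable (∀² φ)  k = λ X → stable φ λ q → k λ f → q (f X)

  ⟦⟧ᵗ-sub : ∀ {m n} (t : Term m) {σ : Fin m → Term n} {η η′} → (∀ i → ⟦ σ i ⟧ᵗ η′ ≡ lookup η i) →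
            ⟦ subT σ t ⟧ᵗ η′ ≡ ⟦ t ⟧ᵗ η
  ⟦⟧ᵗ-sub (var i) e = e i
  ⟦⟧ᵗ-sub 𝟎       e = refl
  ⟦⟧ᵗ-sub 𝟏       e = refl
  ⟦⟧ᵗ-sub (t ⊕ u) e = cong₂ _+_ (⟦⟧ᵗ-sub t e) (⟦⟧ᵗ-sub u e)
  ⟦⟧ᵗ-sub (t · u) e = cong₂ _*_ (⟦⟧ᵗ-sub t e) (⟦⟧ᵗ-sub u e)

  ⟦⟧ᵗ-↑ : ∀ {m} (t : Term m) {a η} → ⟦ ↑ t ⟧ᵗ (a ∷ η) ≡ ⟦ t ⟧ᵗ η
  ⟦⟧ᵗ-↑ t = ⟦⟧ᵗ-sub t λ _ → refl

  ≡⇒Iff : ∀ {A C} → A ≡ C → Iff A C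
  ≡⇒Iff refl = id , id

  ⟦⟧-sub : ∀ {m n s r} (φ : Formula m s) {σ : Fin m → Term n} {τ : Fin s → Fin r} {η η′ ρ ρ′} →
           (∀ i → ⟦ σ i ⟧ᵗ η′ ≡ lookup η i) → (∀ X → lookup ρ′ (τ X) ≡ lookup ρ X) →
           Iff (⟦ sub σ τ φ ⟧ᶠ η′ ρ′) (⟦ φ ⟧ᶠ η ρ)
  ⟦⟧-sub ⊥       e d = id , id
  ⟦⟧-sub (t ≈ u) e d = ≡⇒Iff (cong₂ _≋_ (⟦⟧ᵗ-sub t e) (⟦⟧ᵗ-sub u e))
  ⟦⟧-sub (t < u) e d = ≡⇒Iff (cong₂ _≺_ (⟦⟧ᵗ-sub t e) (⟦⟧ᵗ-sub u e))
  ⟦⟧-sub (t ∈ X) e d = ≡⇒Iff (cong₂ _ε_ (⟦⟧ᵗ-sub t e) (d X))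
  ⟦⟧-sub (φ ⇒ ψ) e d with f , f′ ← ⟦⟧-sub φ e d | g , g′ ← ⟦⟧-sub ψ e d =
    (λ h x → g (h (f′ x))) , (λ h x → g′ (h (f x)))
  ⟦⟧-sub (∀¹ φ) {σ} {η = η} {η′} e d = (λ h a → proj₁ (i a) (h a)) , (λ h a → proj₂ (i a) (h a))
    where
    e′ : ∀ a i → ⟦ lift¹ σ i ⟧ᵗ (a ∷ η′) ≡ lookup (a ∷ η) i
    e′ a zero    = refl
    e′ a (suc i) = trans (⟦⟧ᵗ-↑ (σ i)) (e i)
    i = λ a → ⟦⟧-sub φ (e′ a) d
  ⟦⟧-sub (∀² φ) {τ = τ} {ρ = ρ} {ρ′} e d = (λ h a → proj₁ (i a) (h a)) , (λ h a → proj₂ (i a) (h a))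
    where
    d′ : ∀ X Y → lookup (X ∷ ρ′) (lift² τ Y) ≡ lookup (X ∷ ρ) Y
    d′ X zero    = refl
    d′ X (suc Y) = d Y
    i = λ X → ⟦⟧-sub φ e (d′ X)

  ⟦⟧-wk¹ : ∀ {m s} (φ : Formula m s) {a η ρ} → Iff (⟦ wk¹ φ ⟧ᶠ (a ∷ η) ρ) (⟦ φ ⟧ᶠ η ρ)
  ⟦⟧-wk¹ φ = ⟦⟧-sub φ (λ _ → refl) (λ _ → refl)

  induction : ∀ {m s} (φ : Formula (suc m) s) → Σ⁰₁ φ → ∀ η ρ → ⟦ φ ⟧ᶠ (0# ∷ η) ρ →
              (∀ a → ⟦ φ ⟧ᶠ (a ∷ η) ρ → ⟦ φ ⟧ᶠ (a + 1# ∷ η) ρ) → ∀ a → ⟦ φ ⟧ᶠ (a ∷ η) ρ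
  induction φ Σφ η ρ p q = axiom (Σ⁰₁-ind Σφ) η ρ λ k →
    k (proj₂ (⟦⟧-sub φ (λ { zero → refl ; (suc i) → refl }) (λ _ → refl)) p)
      (λ a r → proj₂ (⟦⟧-sub φ (λ { zero → refl ; (suc i) → refl }) (λ _ → refl)) (q a r))

  -- The abbreviation `φ ∧ ψ` means `(A → C → B) → B` and `∃¹ φ` means `(∀ a → P a → B) → B`. These
  -- four maps translate between such types and ordinary products and sums.
  unpair : ∀ {A C : Set} → ((A → C → B) → B) → K (A × C)
  unpair f k = f λ a c → k (a , c)

  pair : ∀ {A C : Set} → A → C → (A → C → B) → B
  pair a c k = k a c

  unex : ∀ {A : Set} {P : A → Set} → ((∀ a → P a → B) → B) → K (Σ A P)
  unex f k = f λ a p → k (a , p)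

  ex : ∀ {A : Set} {P : A → Set} → K (Σ A P) → (∀ a → P a → B) → B
  ex f k = f λ (a , p) → k a p

  comprehension : ∀ {m s} (φ ψ : Formula (suc m) s) → Σ⁰₁ φ → Π⁰₁ ψ → ∀ η ρ →
    (∀ a → Iff (⟦ φ ⟧ᶠ (a ∷ η) ρ) (⟦ ψ ⟧ᶠ (a ∷ η) ρ)) →
    K (Σ S λ X → ∀ a → Iff (a ε X) (⟦ φ ⟧ᶠ (a ∷ η) ρ))
  comprehension φ ψ Σφ Πψ η ρ e =
    unex (axiom (Δ⁰₁-CA Σφ Πψ) η ρ (λ a → pair (proj₁ (e a)) (proj₂ (e a)))) >>= λ (X , f) →
    return (X , λ a →
      let wk = ⟦⟧-sub φ (λ _ → refl) (λ _ → refl) in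
      (λ p → stable φ (unpair (f a) >>= λ (g , _) → return (proj₁ wk (g p)))) ,
      (λ p → ε-stable (unpair (f a) >>= λ (_ , h) → return (h (proj₂ wk p)))))

  -- Bounded formulas with k free variables and with parameters from the model.

  data Tmᵇ (k : ℕ) : Set where
    var     : Fin k → Tmᵇ k
    con     : N → Tmᵇ k
    _⊕_ _·_ : Tmᵇ k → Tmᵇ k → Tmᵇ k

  infixr 4 _∧ᵇ_
  infixr 3 _∨ᵇ_
  data BF (k : ℕ) : Set where
    ⊥         : BF k
    _≈_ _<_   : Tmᵇ k → Tmᵇ k → BF k
    _∈_       : Tmᵇ k → S → BF k
    _⇒_       : BF k → BF k → BF k
    _∧ᵇ_ _∨ᵇ_ : BF k → BF k → BF k
    ∀< ∃<     : Tmᵇ k → BF (suc k) → BF k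
    raw       : ∀ {n} (φ : Formula n 0) → Δ⁰₀ φ → Vec (Tmᵇ k) n → BF k
    call      : ∀ {n} → BF n → Vec (Tmᵇ k) n → BF k

  ⟦_⟧ᵇᵗ : ∀ {k} → Tmᵇ k → Vec N k → N
  ⟦ var i ⟧ᵇᵗ ξ = lookup ξ i
  ⟦ con a ⟧ᵇᵗ ξ = a
  ⟦ t ⊕ u ⟧ᵇᵗ ξ = ⟦ t ⟧ᵇᵗ ξ + ⟦ u ⟧ᵇᵗ ξ
  ⟦ t · u ⟧ᵇᵗ ξ = ⟦ t ⟧ᵇᵗ ξ * ⟦ u ⟧ᵇᵗ ξ

  ⟦_⟧ᵇᵛ : ∀ {k n} → Vec (Tmᵇ k) n → Vec N k → Vec N n
  ⟦ [] ⟧ᵇᵛ     ξ = []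
  ⟦ t ∷ ts ⟧ᵇᵛ ξ = ⟦ t ⟧ᵇᵗ ξ ∷ ⟦ ts ⟧ᵇᵛ ξ

  ⟦_⟧ᵇ : ∀ {k} → BF k → Vec N k → Set
  ⟦ ⊥ ⟧ᵇ          ξ = B
  ⟦ t ≈ u ⟧ᵇ      ξ = ⟦ t ⟧ᵇᵗ ξ ≋ ⟦ u ⟧ᵇᵗ ξ
  ⟦ t < u ⟧ᵇ      ξ = ⟦ t ⟧ᵇᵗ ξ ≺ ⟦ u ⟧ᵇᵗ ξ
  ⟦ t ∈ X ⟧ᵇ      ξ = ⟦ t ⟧ᵇᵗ ξ ε X
  ⟦ φ ⇒ ψ ⟧ᵇ      ξ = ⟦ φ ⟧ᵇ ξ → ⟦ ψ ⟧ᵇ ξ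
  ⟦ φ ∧ᵇ ψ ⟧ᵇ     ξ = ⟦ φ ⟧ᵇ ξ × ⟦ ψ ⟧ᵇ ξ
  ⟦ φ ∨ᵇ ψ ⟧ᵇ     ξ = K (⟦ φ ⟧ᵇ ξ ⊎ ⟦ ψ ⟧ᵇ ξ)
  ⟦ ∀< t φ ⟧ᵇ     ξ = ∀ a → a ≺ ⟦ t ⟧ᵇᵗ ξ → ⟦ φ ⟧ᵇ (a ∷ ξ)
  ⟦ ∃< t φ ⟧ᵇ     ξ = ∃ᴷ λ a → a ≺ ⟦ t ⟧ᵇᵗ ξ × ⟦ φ ⟧ᵇ (a ∷ ξ)
  ⟦ raw φ _ ts ⟧ᵇ ξ = ⟦ φ ⟧ᶠ (⟦ ts ⟧ᵇᵛ ξ) []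
  ⟦ call φ ts ⟧ᵇ  ξ = ⟦ φ ⟧ᵇ (⟦ ts ⟧ᵇᵛ ξ)

  numsᵗ : ∀ {k} → Tmᵇ k → ∃ (Vec N)
  numsᵗ (var i) = _ , []
  numsᵗ (con a) = _ , a ∷ []
  numsᵗ (t ⊕ u) = _ , proj₂ (numsᵗ t) ++ᵛ proj₂ (numsᵗ u)
  numsᵗ (t · u) = _ , proj₂ (numsᵗ t) ++ᵛ proj₂ (numsᵗ u)

  numsᵛ : ∀ {k n} → Vec (Tmᵇ k) n → ∃ (Vec N)
  numsᵛ []       = _ , []
  numsᵛ (t ∷ ts) = _ , proj₂ (numsᵗ t) ++ᵛ proj₂ (numsᵛ ts)

  nums : ∀ {k} → BF k → ∃ (Vec N)
  nums ⊥            = _ , []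
  nums (t ≈ u)      = _ , proj₂ (numsᵗ t) ++ᵛ proj₂ (numsᵗ u)
  nums (t < u)      = _ , proj₂ (numsᵗ t) ++ᵛ proj₂ (numsᵗ u)
  nums (t ∈ X)      = numsᵗ t
  nums (φ ⇒ ψ)      = _ , proj₂ (nums φ) ++ᵛ proj₂ (nums ψ)
  nums (φ ∧ᵇ ψ)     = _ , proj₂ (nums φ) ++ᵛ proj₂ (nums ψ)
  nums (φ ∨ᵇ ψ)     = _ , proj₂ (nums φ) ++ᵛ proj₂ (nums ψ)
  nums (∀< t φ)     = _ , proj₂ (numsᵗ t) ++ᵛ proj₂ (nums φ)
  nums (∃< t φ)     = _ , proj₂ (numsᵗ t) ++ᵛ proj₂ (nums φ)
  nums (raw φ _ ts) = numsᵛ ts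
  nums (call φ ts)  = _ , proj₂ (nums φ) ++ᵛ proj₂ (numsᵛ ts)

  sets : ∀ {k} → BF k → ∃ (Vec S)
  sets (t ∈ X)  = _ , X ∷ []
  sets (φ ⇒ ψ)  = _ , proj₂ (sets φ) ++ᵛ proj₂ (sets ψ)
  sets (φ ∧ᵇ ψ) = _ , proj₂ (sets φ) ++ᵛ proj₂ (sets ψ)
  sets (φ ∨ᵇ ψ) = _ , proj₂ (sets φ) ++ᵛ proj₂ (sets ψ)
  sets (∀< t φ) = sets φ
  sets (∃< t φ) = sets φ
  sets (call φ _) = sets φ
  sets _        = _ , []

  Env : ∀ {A : Set} {n l} → Vec A n → (Fin l → Fin n) → Vec A l → Set
  Env η ι w = ∀ j → lookup η (ι j) ≡ lookup w j

  envˡ : ∀ {A : Set} {n a b} (η : Vec A n) (ι : Fin (a ℕ.+ b) → Fin n) (w : Vec A a) (w′ : Vec A b) →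
         Env η ι (w ++ᵛ w′) → Env η (ι ∘ (_↑ˡ b)) w
  envˡ η ι w w′ e j = trans (e _) (lookup-++ˡ w w′ j)

  envʳ : ∀ {A : Set} {n a b} (η : Vec A n) (ι : Fin (a ℕ.+ b) → Fin n) (w : Vec A a) (w′ : Vec A b) →
         Env η ι (w ++ᵛ w′) → Env η (ι ∘ (a ↑ʳ_)) w′
  envʳ η ι w w′ e j = trans (e _) (lookup-++ʳ w w′ j)

  -- ι and κ say where the parameters are found in the environment of the compiled
  -- formula.
  module _ {m s : ℕ} where

    compileᵗ : ∀ {k} (t : Tmᵇ k) → (Fin (proj₁ (numsᵗ t)) → Fin m) → Term (k ℕ.+ m)
    compileᵗ     (var i) ι = var (i ↑ˡ m)
    compileᵗ {k} (con a) ι = var (k ↑ʳ ι zero)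
    compileᵗ     (t ⊕ u) ι = compileᵗ t (ι ∘ (_↑ˡ _)) ⊕ compileᵗ u (ι ∘ (_ ↑ʳ_))
    compileᵗ     (t · u) ι = compileᵗ t (ι ∘ (_↑ˡ _)) · compileᵗ u (ι ∘ (_ ↑ʳ_))

    compileᵛ : ∀ {k n} (ts : Vec (Tmᵇ k) n) → (Fin (proj₁ (numsᵛ ts)) → Fin m) → Vec (Term (k ℕ.+ m)) n
    compileᵛ []       ι = []
    compileᵛ (t ∷ ts) ι = compileᵗ t (ι ∘ (_↑ˡ _)) ∷ compileᵛ ts (ι ∘ (_ ↑ʳ_))

    args : ∀ {k n} (ts : Vec (Tmᵇ k) n) → (Fin (proj₁ (numsᵛ ts)) → Fin m) → Fin (n ℕ.+ m) → Term (k ℕ.+ m)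
    args {k} {n} ts ι i = [ lookup (compileᵛ ts ι) , (λ j → var (k ↑ʳ j)) ]′ (splitAt n i)

    compile : ∀ {k} (φ : BF k) → (Fin (proj₁ (nums φ)) → Fin m) → (Fin (proj₁ (sets φ)) → Fin s) →
              Formula (k ℕ.+ m) s
    compile ⊥            ι κ = ⊥
    compile (t ≈ u)      ι κ = compileᵗ t (ι ∘ (_↑ˡ _)) ≈ compileᵗ u (ι ∘ (_ ↑ʳ_))
    compile (t < u)      ι κ = compileᵗ t (ι ∘ (_↑ˡ _)) < compileᵗ u (ι ∘ (_ ↑ʳ_))
    compile (t ∈ X)      ι κ = compileᵗ t ι ∈ κ zero
    compile (φ ⇒ ψ)      ι κ = compile φ (ι ∘ (_↑ˡ _)) (κ ∘ (_↑ˡ _)) ⇒ compile ψ (ι ∘ (_ ↑ʳ_)) (κ ∘ (_ ↑ʳ_))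
    compile (φ ∧ᵇ ψ)     ι κ = compile φ (ι ∘ (_↑ˡ _)) (κ ∘ (_↑ˡ _)) ∧ compile ψ (ι ∘ (_ ↑ʳ_)) (κ ∘ (_ ↑ʳ_))
    compile (φ ∨ᵇ ψ)     ι κ = compile φ (ι ∘ (_↑ˡ _)) (κ ∘ (_↑ˡ _)) ∨ compile ψ (ι ∘ (_ ↑ʳ_)) (κ ∘ (_ ↑ʳ_))
    compile (∀< t φ)     ι κ = ∀¹ (x₀ < ↑ (compileᵗ t (ι ∘ (_↑ˡ _))) ⇒ compile φ (ι ∘ (_ ↑ʳ_)) κ)
    compile (∃< t φ)     ι κ = ¬ (∀¹ (x₀ < ↑ (compileᵗ t (ι ∘ (_↑ˡ _))) ⇒ ¬ compile φ (ι ∘ (_ ↑ʳ_)) κ))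
    compile (raw φ _ ts) ι κ = φ ⟨ compileᵛ ts ι ⟩
    compile (call φ ts)  ι κ = sub (args ts (ι ∘ (_ ↑ʳ_))) id (compile φ (ι ∘ (_↑ˡ _)) κ)

    compile-Δ⁰₀ : ∀ {k} (φ : BF k) ι κ → Δ⁰₀ (compile φ ι κ)
    compile-Δ⁰₀ ⊥            ι κ = ⊥
    compile-Δ⁰₀ (t ≈ u)      ι κ = _ ≈ _
    compile-Δ⁰₀ (t < u)      ι κ = _ < _
    compile-Δ⁰₀ (t ∈ X)      ι κ = _ ∈ _
    compile-Δ⁰₀ (φ ⇒ ψ)      ι κ = compile-Δ⁰₀ φ _ _ ⇒ compile-Δ⁰₀ ψ _ _
    compile-Δ⁰₀ (φ ∧ᵇ ψ)     ι κ = (compile-Δ⁰₀ φ _ _ ⇒ compile-Δ⁰₀ ψ _ _ ⇒ ⊥) ⇒ ⊥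
    compile-Δ⁰₀ (φ ∨ᵇ ψ)     ι κ = (compile-Δ⁰₀ φ _ _ ⇒ ⊥) ⇒ compile-Δ⁰₀ ψ _ _
    compile-Δ⁰₀ (∀< t φ)     ι κ = ∀< (compileᵗ t _) (compile-Δ⁰₀ φ _ _)
    compile-Δ⁰₀ (∃< t φ)     ι κ = ∀< (compileᵗ t _) (compile-Δ⁰₀ φ _ _ ⇒ ⊥) ⇒ ⊥
    compile-Δ⁰₀ (raw φ Δφ _) ι κ = Δ⁰₀-sub Δφ
    compile-Δ⁰₀ (call φ ts)  ι κ = Δ⁰₀-sub (compile-Δ⁰₀ φ _ _)

    module _ (η : Vec N m) (ρ : Vec S s) where

      compileᵗ-correct : ∀ {k} (t : Tmᵇ k) ι (ξ : Vec N k) → Env η ι (proj₂ (numsᵗ t)) →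
                         ⟦ compileᵗ t ι ⟧ᵗ (ξ ++ᵛ η) ≡ ⟦ t ⟧ᵇᵗ ξ
      compileᵗ-correct (var i) ι ξ e = lookup-++ˡ ξ η i
      compileᵗ-correct (con a) ι ξ e = trans (lookup-++ʳ ξ η (ι zero)) (e zero)
      compileᵗ-correct (t ⊕ u) ι ξ e = cong₂ _+_ (compileᵗ-correct t _ ξ (envˡ η ι (proj₂ (numsᵗ t)) _ e))
                                                 (compileᵗ-correct u _ ξ (envʳ η ι (proj₂ (numsᵗ t)) _ e))
      compileᵗ-correct (t · u) ι ξ e = cong₂ _*_ (compileᵗ-correct t _ ξ (envˡ η ι (proj₂ (numsᵗ t)) _ e))
                                                 (compileᵗ-correct u _ ξ (envʳ η ι (proj₂ (numsᵗ t)) _ e))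

      compileᵛ-correct : ∀ {k n} (ts : Vec (Tmᵇ k) n) ι (ξ : Vec N k) → Env η ι (proj₂ (numsᵛ ts)) →
                         ∀ i → ⟦ lookup (compileᵛ ts ι) i ⟧ᵗ (ξ ++ᵛ η) ≡ lookup (⟦ ts ⟧ᵇᵛ ξ) i
      compileᵛ-correct (t ∷ ts) ι ξ e zero    = compileᵗ-correct t _ ξ (envˡ η ι (proj₂ (numsᵗ t)) _ e)
      compileᵛ-correct (t ∷ ts) ι ξ e (suc i) = compileᵛ-correct ts _ ξ (envʳ η ι (proj₂ (numsᵗ t)) _ e) i

      compile-correct : ∀ {k} (φ : BF k) ι κ (ξ : Vec N k) →
                        Env η ι (proj₂ (nums φ)) → Env ρ κ (proj₂ (sets φ)) →
                        Iff (⟦ compile φ ι κ ⟧ᶠ (ξ ++ᵛ η) ρ) (⟦ φ ⟧ᵇ ξ)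
      compile-correct ⊥       ι κ ξ e d = id , id
      compile-correct (t ≈ u) ι κ ξ e d = ≡⇒Iff (cong₂ _≋_ (compileᵗ-correct t _ ξ (envˡ η ι (proj₂ (numsᵗ t)) _ e))
                                                           (compileᵗ-correct u _ ξ (envʳ η ι (proj₂ (numsᵗ t)) _ e)))
      compile-correct (t < u) ι κ ξ e d = ≡⇒Iff (cong₂ _≺_ (compileᵗ-correct t _ ξ (envˡ η ι (proj₂ (numsᵗ t)) _ e))
                                                           (compileᵗ-correct u _ ξ (envʳ η ι (proj₂ (numsᵗ t)) _ e)))
      compile-correct (t ∈ X) ι κ ξ e d = ≡⇒Iff (cong₂ _ε_ (compileᵗ-correct t _ ξ e) (d zero))
      compile-correct (φ ⇒ ψ) ι κ ξ e d
        with f , f′ ← compile-correct φ _ _ ξ (envˡ η ι (proj₂ (nums φ)) _ e) (envˡ ρ κ (proj₂ (sets φ)) _ d)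
           | g , g′ ← compile-correct ψ _ _ ξ (envʳ η ι (proj₂ (nums φ)) _ e) (envʳ ρ κ (proj₂ (sets φ)) _ d) =
        (λ h x → g (h (f′ x))) , (λ h x → g′ (h (f x)))
      compile-correct (φ ∧ᵇ ψ) ι κ ξ e d
        with f , f′ ← compile-correct φ _ _ ξ (envˡ η ι (proj₂ (nums φ)) _ e) (envˡ ρ κ (proj₂ (sets φ)) _ d)
           | g , g′ ← compile-correct ψ _ _ ξ (envʳ η ι (proj₂ (nums φ)) _ e) (envʳ ρ κ (proj₂ (sets φ)) _ d) =
        (λ h → f (stable (compile φ _ _) λ k → h λ p _ → k p) , g (stable (compile ψ _ _) λ k → h λ _ q → k q)) ,
        (λ (p , q) k → k (f′ p) (g′ q))
      compile-correct (φ ∨ᵇ ψ) ι κ ξ e d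
        with f , f′ ← compile-correct φ _ _ ξ (envˡ η ι (proj₂ (nums φ)) _ e) (envˡ ρ κ (proj₂ (sets φ)) _ d)
           | g , g′ ← compile-correct ψ _ _ ξ (envʳ η ι (proj₂ (nums φ)) _ e) (envʳ ρ κ (proj₂ (sets φ)) _ d) =
        (λ h k → k (inj₂ (g (h λ p → k (inj₁ (f p)))))) ,
        (λ h ¬p → stable (compile ψ _ _) λ k → h [ (λ p → ¬p (f′ p)) , (λ q → k (g′ q)) ])
      compile-correct (∀< t φ) ι κ ξ e d =
        (λ h a p → proj₁ (i a) (h a (subst (a ≺_) (sym eq) p))) ,
        (λ h a p → proj₂ (i a) (h a (subst (a ≺_) eq p)))
        where
        i  = λ a → compile-correct φ _ _ (a ∷ ξ) (envʳ η ι (proj₂ (numsᵗ t)) _ e) d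
        eq = λ {a} → trans (⟦⟧ᵗ-↑ (compileᵗ t _) {a}) (compileᵗ-correct t _ ξ (envˡ η ι (proj₂ (numsᵗ t)) _ e))
      compile-correct (∃< t φ) ι κ ξ e d =
        (λ h k → h λ a p q → k (a , subst (a ≺_) eq p , proj₁ (i a) q)) ,
        (λ h k → h λ (a , p , q) → k a (subst (a ≺_) (sym eq) p) (proj₂ (i a) q))
        where
        i  = λ a → compile-correct φ _ _ (a ∷ ξ) (envʳ η ι (proj₂ (numsᵗ t)) _ e) d
        eq = λ {a} → trans (⟦⟧ᵗ-↑ (compileᵗ t _) {a}) (compileᵗ-correct t _ ξ (envˡ η ι (proj₂ (numsᵗ t)) _ e))
      compile-correct (raw φ _ ts) ι κ ξ e d = ⟦⟧-sub φ (compileᵛ-correct ts ι ξ e) λ ()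
      compile-correct (call {n} φ ts) ι κ ξ e d =
        Iff-trans (⟦⟧-sub (compile φ _ _) args-correct (λ _ → refl))
                  (compile-correct φ _ κ (⟦ ts ⟧ᵇᵛ ξ) (envˡ η ι (proj₂ (nums φ)) _ e) d)
        where
        args-correct : ∀ i → ⟦ args ts (ι ∘ (_ ↑ʳ_)) i ⟧ᵗ (ξ ++ᵛ η) ≡ lookup (⟦ ts ⟧ᵇᵛ ξ ++ᵛ η) i
        args-correct i rewrite lookup-splitAt n (⟦ ts ⟧ᵇᵛ ξ) η i with splitAt n i
        ... | inj₁ j = compileᵛ-correct ts _ ξ (envʳ η ι (proj₂ (nums φ)) _ e) j
        ... | inj₂ j = lookup-++ʳ ξ η j

  compiled : ∀ {k} (φ : BF k) → Formula (k ℕ.+ proj₁ (nums φ)) (proj₁ (sets φ))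
  compiled φ = compile φ id id

  correct : ∀ {k} (φ : BF k) ξ → Iff (⟦ compiled φ ⟧ᶠ (ξ ++ᵛ proj₂ (nums φ)) (proj₂ (sets φ))) (⟦ φ ⟧ᵇ ξ)
  correct φ ξ = compile-correct _ _ φ id id ξ (λ _ → refl) (λ _ → refl)

  stableᵇ : ∀ {k} (φ : BF k) ξ → K (⟦ φ ⟧ᵇ ξ) → ⟦ φ ⟧ᵇ ξ
  stableᵇ φ ξ k = proj₁ (correct φ ξ) (stable (compiled φ) (k >>= λ p → return (proj₂ (correct φ ξ) p)))

  respect : ∀ {k} (φ : BF (suc k)) ξ {a b} → a ≋ b → ⟦ φ ⟧ᵇ (a ∷ ξ) → ⟦ φ ⟧ᵇ (b ∷ ξ)
  respect φ ξ e p = proj₁ (correct φ _) (leibniz (compiled φ) _ _ e (proj₂ (correct φ _) p))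

  Σ₁-induction : (φ : BF 2) → ∃ᴷ (λ y → ⟦ φ ⟧ᵇ (y ∷ 0# ∷ [])) →
    (∀ a → ∃ᴷ (λ y → ⟦ φ ⟧ᵇ (y ∷ a ∷ [])) → ∃ᴷ (λ y → ⟦ φ ⟧ᵇ (y ∷ a + 1# ∷ []))) →
    ∀ a → ∃ᴷ (λ y → ⟦ φ ⟧ᵇ (y ∷ a ∷ []))
  Σ₁-induction φ p q a = to (induction (∃¹ compiled φ) (∃Δ⁰₀ (compile-Δ⁰₀ φ id id)) _ _ (from p) (λ a r → from (q a (to r))) a)
    where
    to : ∀ {a} → ⟦ ∃¹ compiled φ ⟧ᶠ (a ∷ proj₂ (nums φ)) (proj₂ (sets φ)) → ∃ᴷ (λ y → ⟦ φ ⟧ᵇ (y ∷ a ∷ []))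
    to f k = f λ y p → k (y , proj₁ (correct φ _) p)
    from : ∀ {a} → ∃ᴷ (λ y → ⟦ φ ⟧ᵇ (y ∷ a ∷ [])) → ⟦ ∃¹ compiled φ ⟧ᶠ (a ∷ proj₂ (nums φ)) (proj₂ (sets φ))
    from f k = f λ (y , p) → k y (proj₂ (correct φ _) p)

  -- A dummy existential quantifier makes the bounded formula Σ⁰₁; stability removes it again.
  Δ₀-induction : (φ : BF 1) → ⟦ φ ⟧ᵇ (0# ∷ []) → (∀ a → ⟦ φ ⟧ᵇ (a ∷ []) → ⟦ φ ⟧ᵇ (a + 1# ∷ [])) → ∀ a → ⟦ φ ⟧ᵇ (a ∷ [])
  Δ₀-induction φ p q a =
    to (induction (∃¹ wk¹ (compiled φ)) (∃Δ⁰₀ (Δ⁰₀-sub (compile-Δ⁰₀ φ id id))) _ _ (from p) (λ a r → from (q a (to r))) a)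
    where
    to : ∀ {a} → ⟦ ∃¹ wk¹ (compiled φ) ⟧ᶠ (a ∷ proj₂ (nums φ)) (proj₂ (sets φ)) → ⟦ φ ⟧ᵇ (a ∷ [])
    to f = stableᵇ φ _ λ k → f λ y p → k (proj₁ (correct φ _) (proj₁ (⟦⟧-wk¹ (compiled φ)) p))
    from : ∀ {a} → ⟦ φ ⟧ᵇ (a ∷ []) → ⟦ ∃¹ wk¹ (compiled φ) ⟧ᶠ (a ∷ proj₂ (nums φ)) (proj₂ (sets φ))
    from p k = k 0# (proj₂ (⟦⟧-wk¹ (compiled φ)) (proj₂ (correct φ _) p))

  Δ₁-comprehension : (φ ψ : BF 2) →
    (∀ a → Iff (∃ᴷ λ y → ⟦ φ ⟧ᵇ (y ∷ a ∷ [])) (∀ y → ⟦ ψ ⟧ᵇ (y ∷ a ∷ []))) →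
    K (Σ S λ X → ∀ a → Iff (a ε X) (∃ᴷ λ y → ⟦ φ ⟧ᵇ (y ∷ a ∷ [])))
  Δ₁-comprehension φ ψ e =
    comprehension (∃¹ φ′) (∀¹ ψ′) (∃Δ⁰₀ (compile-Δ⁰₀ φ _ _)) (∀Δ⁰₀ (compile-Δ⁰₀ ψ _ _)) η ρ
      (λ a → Iff-trans (ie a) (Iff-trans (e a) (ia a))) >>= λ (X , f) →
    return (X , λ a → Iff-trans (f a) (ie a))
    where
    -- The axiom wants both forms over the same parameters, hence the concatenation.
    η = proj₂ (nums φ) ++ᵛ proj₂ (nums ψ)
    ρ = proj₂ (sets φ) ++ᵛ proj₂ (sets ψ)
    φ′ = compile φ (_↑ˡ proj₁ (nums ψ)) (_↑ˡ proj₁ (sets ψ))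
    ψ′ = compile ψ (proj₁ (nums φ) ↑ʳ_) (proj₁ (sets φ) ↑ʳ_)
    i = λ y a → compile-correct η ρ φ _ _ (y ∷ a ∷ []) (lookup-++ˡ (proj₂ (nums φ)) _) (lookup-++ˡ (proj₂ (sets φ)) _)
    j = λ y a → compile-correct η ρ ψ _ _ (y ∷ a ∷ []) (lookup-++ʳ (proj₂ (nums φ)) _) (lookup-++ʳ (proj₂ (sets φ)) _)
    ie : ∀ a → Iff (⟦ ∃¹ φ′ ⟧ᶠ (a ∷ η) ρ) (∃ᴷ λ y → ⟦ φ ⟧ᵇ (y ∷ a ∷ []))
    ie a = (λ f k → f λ y p → k (y , proj₁ (i y a) p)) , (λ f k → f λ (y , p) → k y (proj₂ (i y a) p))
    ia : ∀ a → Iff (∀ y → ⟦ ψ ⟧ᵇ (y ∷ a ∷ [])) (⟦ ∀¹ ψ′ ⟧ᶠ (a ∷ η) ρ)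
    ia a = (λ f y → proj₂ (j y a) (f y)) , (λ f y → proj₁ (j y a) (f y))

  Δ₀-comprehension : (φ : BF 1) → K (Σ S λ X → ∀ a → Iff (a ε X) (⟦ φ ⟧ᵇ (a ∷ [])))
  Δ₀-comprehension φ =
    comprehension (∃¹ φ′) (∀¹ φ′) (∃Δ⁰₀ Δφ′) (∀Δ⁰₀ Δφ′) (proj₂ (nums φ)) (proj₂ (sets φ))
      (λ a → Iff-trans (ie a) (swap (ia a))) >>= λ (X , f) →
    return (X , λ a → Iff-trans (f a) (ie a))
    where
    φ′ = wk¹ (compiled φ)
    Δφ′ = Δ⁰₀-sub (compile-Δ⁰₀ φ id id)
    i = λ y a → Iff-trans (⟦⟧-wk¹ (compiled φ) {y}) (correct φ (a ∷ []))
    ie : ∀ a → Iff (⟦ ∃¹ φ′ ⟧ᶠ (a ∷ proj₂ (nums φ)) (proj₂ (sets φ))) (⟦ φ ⟧ᵇ (a ∷ []))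
    ie a = (λ f → stableᵇ φ _ λ k → f λ y p → k (proj₁ (i y a) p)) , (λ p k → k 0# (proj₂ (i 0# a) p))
    ia : ∀ a → Iff (⟦ ∀¹ φ′ ⟧ᶠ (a ∷ proj₂ (nums φ)) (proj₂ (sets φ))) (⟦ φ ⟧ᵇ (a ∷ []))
    ia a = (λ f → proj₁ (i 0# a) (f 0#)) , (λ p y → proj₂ (i y a) p)

  v₀ : ∀ {k} → Tmᵇ (1 ℕ.+ k)
  v₀ = var zero

  v₁ : ∀ {k} → Tmᵇ (2 ℕ.+ k)
  v₁ = var (suc zero)

  v₂ : ∀ {k} → Tmᵇ (3 ℕ.+ k)
  v₂ = var (suc (suc zero))

  v₃ : ∀ {k} → Tmᵇ (4 ℕ.+ k)
  v₃ = var (suc (suc (suc zero)))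

  v₄ : ∀ {k} → Tmᵇ (5 ℕ.+ k)
  v₄ = var (suc (suc (suc (suc zero))))

  -- Arithmetic

  ≋-sym : ∀ {a b} → a ≋ b → b ≋ a
  ≋-sym {a} e = respect (v₀ ≈ con a) [] e ≋-refl

  ≋-trans : ∀ {a b c} → a ≋ b → b ≋ c → a ≋ c
  ≋-trans {a} e f = respect (con a ≈ v₀) [] f e

  +-cong : ∀ {a b c d} → a ≋ b → c ≋ d → a + c ≋ b + d
  +-cong {a} {b} {c} e f =
    respect (con (a + c) ≈ con b ⊕ v₀) [] f (respect (con (a + c) ≈ v₀ ⊕ con c) [] e ≋-refl)

  *-cong : ∀ {a b c d} → a ≋ b → c ≋ d → a * c ≋ b * d
  *-cong {a} {b} {c} e f =
    respect (con (a * c) ≈ con b · v₀) [] f (respect (con (a * c) ≈ v₀ · con c) [] e ≋-refl)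

  ≺-resp : ∀ {a b c d} → a ≋ b → c ≋ d → a ≺ c → b ≺ d
  ≺-resp {a} {b} {c} e f p = respect (con b < v₀) [] f (respect (v₀ < con c) [] e p)

  ε-resp : ∀ {a b X} → a ≋ b → a ε X → b ε X
  ε-resp {X = X} e p = respect (v₀ ∈ X) [] e p

  +-identityʳ : ∀ a → a + 0# ≋ a
  +-identityʳ = axiom +-zero [] []

  +-sucʳ : ∀ a b → a + (b + 1#) ≋ a + b + 1#
  +-sucʳ = axiom +-suc [] []

  *-zeroʳ : ∀ a → a * 0# ≋ 0#
  *-zeroʳ = axiom *-zero [] []

  *-sucʳ : ∀ a b → a * (b + 1#) ≋ a * b + a
  *-sucʳ = axiom *-suc [] []

  suc-cong : ∀ {a b} → a ≋ b → a + 1# ≋ b + 1#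
  suc-cong e = +-cong e ≋-refl

  +-identityˡ : ∀ a → 0# + a ≋ a
  +-identityˡ = Δ₀-induction (con 0# ⊕ v₀ ≈ v₀) (+-identityʳ 0#)
    λ a e → ≋-trans (+-sucʳ 0# a) (suc-cong e)

  +-sucˡ : ∀ a b → a + 1# + b ≋ a + b + 1#
  +-sucˡ a = Δ₀-induction (con (a + 1#) ⊕ v₀ ≈ con a ⊕ v₀ ⊕ con 1#)
    (≋-trans (+-identityʳ _) (suc-cong (≋-sym (+-identityʳ a))))
    λ b e → ≋-trans (+-sucʳ _ b) (suc-cong (≋-trans e (≋-sym (+-sucʳ a b))))

  +-comm : ∀ a b → a + b ≋ b + a
  +-comm a = Δ₀-induction (con a ⊕ v₀ ≈ v₀ ⊕ con a)
    (≋-trans (+-identityʳ a) (≋-sym (+-identityˡ a)))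
    λ b e → ≋-trans (+-sucʳ a b) (≋-trans (suc-cong e) (≋-sym (+-sucˡ b a)))

  +-assoc : ∀ a b c → a + b + c ≋ a + (b + c)
  +-assoc a b = Δ₀-induction (con (a + b) ⊕ v₀ ≈ con a ⊕ (con b ⊕ v₀))
    (≋-trans (+-identityʳ _) (+-cong ≋-refl (≋-sym (+-identityʳ b))))
    λ c e → ≋-trans (+-sucʳ _ c) (≋-trans (suc-cong e)
              (≋-trans (≋-sym (+-sucʳ a _)) (+-cong ≋-refl (≋-sym (+-sucʳ b c)))))

  *-zeroˡ : ∀ a → 0# * a ≋ 0#
  *-zeroˡ = Δ₀-induction (con 0# · v₀ ≈ con 0#) (*-zeroʳ 0#)
    λ a e → ≋-trans (*-sucʳ 0# a) (≋-trans (+-identityʳ _) e)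

  *-sucˡ : ∀ a b → (a + 1#) * b ≋ a * b + b
  *-sucˡ a = Δ₀-induction (con (a + 1#) · v₀ ≈ con a · v₀ ⊕ v₀)
    (≋-trans (*-zeroʳ _) (≋-sym (≋-trans (+-identityʳ _) (*-zeroʳ a))))
    λ b e → ≋-trans (*-sucʳ _ b) (≋-trans (+-sucʳ _ a) (≋-trans
      (suc-cong (≋-trans (+-cong e ≋-refl) (≋-trans (+-assoc _ b a)
        (≋-trans (+-cong ≋-refl (+-comm b a)) (≋-trans (≋-sym (+-assoc _ a b)) (+-cong (≋-sym (*-sucʳ a b)) ≋-refl))))))
      (≋-sym (+-sucʳ _ b))))

  *-comm : ∀ a b → a * b ≋ b * a
  *-comm a = Δ₀-induction (con a · v₀ ≈ v₀ · con a)
    (≋-trans (*-zeroʳ a) (≋-sym (*-zeroˡ a)))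
    λ b e → ≋-trans (*-sucʳ a b) (≋-trans (+-cong e ≋-refl) (≋-sym (*-sucˡ b a)))

  *-distribˡ : ∀ a b c → a * (b + c) ≋ a * b + a * c
  *-distribˡ a b = Δ₀-induction (con a · (con b ⊕ v₀) ≈ con (a * b) ⊕ con a · v₀)
    (≋-trans (*-cong ≋-refl (+-identityʳ b)) (≋-sym (≋-trans (+-cong ≋-refl (*-zeroʳ a)) (+-identityʳ _))))
    λ c e → ≋-trans (*-cong ≋-refl (+-sucʳ b c)) (≋-trans (*-sucʳ a _) (≋-trans (+-cong e ≋-refl)
              (≋-trans (+-assoc _ _ a) (+-cong ≋-refl (≋-sym (*-sucʳ a c))))))

  *-distribʳ : ∀ a b c → (b + c) * a ≋ b * a + c * a
  *-distribʳ a b c = ≋-trans (*-comm _ a) (≋-trans (*-distribˡ a b c) (+-cong (*-comm a b) (*-comm a c)))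

  *-assoc : ∀ a b c → a * b * c ≋ a * (b * c)
  *-assoc a b = Δ₀-induction (con (a * b) · v₀ ≈ con a · (con b · v₀))
    (≋-trans (*-zeroʳ _) (≋-sym (≋-trans (*-cong ≋-refl (*-zeroʳ b)) (*-zeroʳ a))))
    λ c e → ≋-trans (*-sucʳ _ c) (≋-trans (+-cong e ≋-refl)
              (≋-trans (≋-sym (*-distribˡ a _ b)) (*-cong ≋-refl (≋-sym (*-sucʳ b c)))))

  *-identityˡ : ∀ a → 1# * a ≋ a
  *-identityˡ a = ≋-trans (*-cong (≋-sym (+-identityˡ 1#)) ≋-refl)
    (≋-trans (*-sucˡ 0# a) (≋-trans (+-cong (*-zeroˡ a) ≋-refl) (+-identityˡ a)))

  commutativeSemiring : CommutativeSemiring _ _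
  commutativeSemiring = record
    { Carrier = N ; _≈_ = _≋_ ; _+_ = _+_ ; _*_ = _*_ ; 0# = 0# ; 1# = 1#
    ; isCommutativeSemiring = IsCommutativeSemiringˡ.isCommutativeSemiring (record
        { +-isCommutativeMonoid = IsCommutativeMonoidˡ.isCommutativeMonoid (record
            { isSemigroup = record { isMagma = record { isEquivalence = isEquiv ; ∙-cong = +-cong } ; assoc = +-assoc }
            ; identityˡ = +-identityˡ ; comm = +-comm })
        ; *-isCommutativeMonoid = IsCommutativeMonoidˡ.isCommutativeMonoid (record
            { isSemigroup = record { isMagma = record { isEquivalence = isEquiv ; ∙-cong = *-cong } ; assoc = *-assoc }
            ; identityˡ = *-identityˡ ; comm = *-comm })
        ; distribʳ = *-distribʳ ; zeroˡ = *-zeroˡ }) }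
    where
    isEquiv : IsEquivalence _≋_
    isEquiv = record { refl = ≋-refl ; sym = ≋-sym ; trans = ≋-trans }

  open import Algebra.Solver.Ring.NaturalCoefficients.Default commutativeSemiring public
    using (solve; _:=_; _:+_; _:*_) renaming (con to :con)

  ≺-suc⁻ : ∀ {a b} → a ≺ b + 1# → K (a ≺ b ⊎ a ≋ b)
  ≺-suc⁻ {a} {b} p = unpair (axiom <-suc [] [] a b) >>= λ (f , _) k → k (inj₂ (f p (k ∘ inj₁)))

  ≺-suc⁺ : ∀ {a b} → K (a ≺ b ⊎ a ≋ b) → a ≺ b + 1#
  ≺-suc⁺ {a} {b} p = ≺-stable (unpair (axiom <-suc [] [] a b) >>= λ (_ , g) →
    return (g λ n → ≋-stable λ k → p [ n , k ]))

  ≺0 : ∀ {a} → a ≺ 0# → B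
  ≺0 = axiom ≮0 [] [] _

  ≺-step : ∀ {a b} → a ≺ b → a ≺ b + 1#
  ≺-step p = ≺-suc⁺ (return (inj₁ p))

  n≺n+1 : ∀ {a} → a ≺ a + 1#
  n≺n+1 = ≺-suc⁺ (return (inj₂ ≋-refl))

  0≺suc : ∀ a → 0# ≺ a + 1#
  0≺suc = Δ₀-induction (con 0# < v₀ ⊕ con 1#) n≺n+1 λ a p → ≺-step p

  suc-mono : ∀ {a b} → a ≺ b → a + 1# ≺ b + 1#
  suc-mono {a} {b} = Δ₀-induction (con a < v₀ ⇒ con (a + 1#) < v₀ ⊕ con 1#) (λ p → ≺-stable λ _ → ≺0 p)
    (λ b f p → ≺-suc⁺ (≺-suc⁻ p >>= [ (λ q → return (inj₁ (f q))) , (λ e → return (inj₂ (suc-cong e))) ])) b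

  ≺⇒+ : ∀ {a b} → a ≺ b → ∃ᴷ λ c → b ≋ a + c + 1#
  -- The difference is sought below the induction variable, which keeps the induction formula
  -- bounded.
  ≺⇒+ {a} {b} p = Δ₀-induction (con a < v₀ ⇒ ∃< v₀ (v₁ ≈ con a ⊕ v₀ ⊕ con 1#)) (λ p k → ≺0 p)
    (λ b f p → ≺-suc⁻ p >>= [ (λ q → f q >>= λ (c , l , e) → return (c + 1# , suc-mono l , suc-cong (≋-trans e (≋-sym (+-sucʳ a c)))))
                            , (λ e → return (0# , 0≺suc b , suc-cong (≋-trans (≋-sym e) (≋-sym (+-identityʳ a))))) ]) b p
    >>= λ (c , _ , e) → return (c , e)

  ≺-trans : ∀ {a b c} → a ≺ b → b ≺ c → a ≺ c
  ≺-trans {a} {b} {c} p = Δ₀-induction (con b < v₀ ⇒ con a < v₀) (λ q → ≺-stable λ _ → ≺0 q)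
    (λ c f q → ≺-suc⁺ (≺-suc⁻ q >>= [ (λ r → return (inj₁ (f r))) , (λ e → return (inj₁ (≺-resp ≋-refl e p))) ])) c

  +⇒≺ : ∀ {a b} c → b ≋ a + c + 1# → a ≺ b
  +⇒≺ {a} {b} c e = ≺-resp ≋-refl (≋-sym e) (Δ₀-induction (con a < con a ⊕ v₀ ⊕ con 1#)
    (≺-resp ≋-refl (suc-cong (≋-sym (+-identityʳ a))) n≺n+1)
    (λ c p → ≺-resp ≋-refl (suc-cong (≋-sym (+-sucʳ a c))) (≺-step p)) c)

  ≺-irrefl : ∀ {a} → a ≺ a → B
  ≺-irrefl {a} = Δ₀-induction (v₀ < v₀ ⇒ ⊥) ≺0
    (λ a f p → ≺-suc⁻ p [ (λ q → f (≺-trans n≺n+1 q)) , (λ e → f (≺-resp ≋-refl e n≺n+1)) ]) a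

  ≺-asym : ∀ {a b} → a ≺ b → b ≺ a → B
  ≺-asym p q = ≺-irrefl (≺-trans p q)

  0-or-suc : ∀ a → K (a ≋ 0# ⊎ Σ N λ c → a ≋ c + 1#)
  0-or-suc a = Δ₀-induction (v₀ ≈ con 0# ∨ᵇ ∃< v₀ (v₁ ≈ v₀ ⊕ con 1#)) (return (inj₁ ≋-refl))
    (λ a _ → return (inj₂ (return (a , n≺n+1 , ≋-refl)))) a
    >>= [ (λ e → return (inj₁ e)) , (λ q → q >>= λ (c , _ , e) → return (inj₂ (c , e))) ]

  ≺-cmp : ∀ a b → K (a ≺ b ⊎ a ≋ b ⊎ b ≺ a)
  ≺-cmp a b = Δ₀-induction (v₀ < con b ∨ᵇ (v₀ ≈ con b ∨ᵇ con b < v₀)) base step a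
    >>= [ (λ p → return (inj₁ p)) , (λ q → q >>= λ r → return (inj₂ r)) ]
    where
    base : K (0# ≺ b ⊎ K (0# ≋ b ⊎ b ≺ 0#))
    base = 0-or-suc b >>= [ (λ e → return (inj₂ (return (inj₁ (≋-sym e)))))
                          , (λ (c , e) → return (inj₁ (≺-resp ≋-refl (≋-sym e) (0≺suc c)))) ]
    step : ∀ a → K (a ≺ b ⊎ K (a ≋ b ⊎ b ≺ a)) → K (a + 1# ≺ b ⊎ K (a + 1# ≋ b ⊎ b ≺ a + 1#))
    step a p = p >>= [ (λ q → ≺-suc⁻ (suc-mono q) >>= [ (λ r → return (inj₁ r)) , (λ e → return (inj₂ (return (inj₁ e)))) ])
                     , (λ q → q >>= λ r → return (inj₂ (return (inj₂ (
                          [ (λ e → ≺-resp e ≋-refl n≺n+1) , ≺-step ] r))))) ]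

  infix 4 _≼_
  _≼_ : N → N → Set
  a ≼ b = b ≺ a → B

  ≼-≺-trans : ∀ {a b c} → a ≼ b → b ≺ c → a ≺ c
  ≼-≺-trans {a} {b} p q = ≺-stable (≺-cmp a b >>=
    [ (λ r → return (≺-trans r q)) , [ (λ e → return (≺-resp (≋-sym e) ≋-refl q)) , (λ r k → p r) ] ])

  ≺-≼-trans : ∀ {a b c} → a ≺ b → b ≼ c → a ≺ c
  ≺-≼-trans {a} {b} {c} p q = ≺-stable (≺-cmp b c >>=
    [ (λ r → return (≺-trans p r)) , [ (λ e → return (≺-resp ≋-refl e p)) , (λ r k → q r) ] ])

  ≼-trans : ∀ {a b c} → a ≼ b → b ≼ c → a ≼ c
  ≼-trans p q r = q (≺-≼-trans r p)

  ≺⇒≼ : ∀ {a b} → a ≺ b → a ≼ b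
  ≺⇒≼ = ≺-asym

  ≋⇒≼ : ∀ {a b} → a ≋ b → a ≼ b
  ≋⇒≼ e p = ≺-irrefl (≺-resp (≋-sym e) ≋-refl p)

  ≼⇒≺suc : ∀ {a b} → a ≼ b → a ≺ b + 1#
  ≼⇒≺suc p = ≼-≺-trans p n≺n+1

  ≺suc⇒≼ : ∀ {a b} → a ≺ b + 1# → a ≼ b
  ≺suc⇒≼ p q = ≺-suc⁻ p [ ≺-asym q , (λ e → ≺-irrefl (≺-resp ≋-refl e q)) ]

  suc≼⇒≺ : ∀ {a b} → a + 1# ≼ b → a ≺ b
  suc≼⇒≺ = ≺-≼-trans n≺n+1

  ≺⇒suc≼ : ∀ {a b} → a ≺ b → a + 1# ≼ b
  ≺⇒suc≼ p q = ≺suc⇒≼ q p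

  ≼-or-≺ : ∀ a b → K (a ≼ b ⊎ b ≺ a)
  ≼-or-≺ a b = ≺-cmp a b >>= [ (λ p → return (inj₁ (≺⇒≼ p))) , [ (λ e → return (inj₁ (≋⇒≼ e))) , (λ p → return (inj₂ p)) ] ]

  ≼-≺-or-≋ : ∀ {a b} → a ≼ b → K (a ≺ b ⊎ a ≋ b)
  ≼-≺-or-≋ p = ≺-suc⁻ (≼⇒≺suc p)

  ≼-antisym : ∀ {a b} → a ≼ b → b ≼ a → a ≋ b
  ≼-antisym {a} {b} p q = ≋-stable (≼-≺-or-≋ p >>= [ (λ r k → q r) , return ])

  +⇒≼ : ∀ {a b} c → b ≋ a + c → a ≼ b
  +⇒≼ c e = ≺suc⇒≼ (+⇒≺ c (suc-cong e))

  m≼m+n : ∀ {a} b → a ≼ a + b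
  m≼m+n b = +⇒≼ b ≋-refl

  n≼m+n : ∀ a {b} → b ≼ a + b
  n≼m+n a {b} = +⇒≼ a (+-comm a b)

  +-monoˡ-≺ : ∀ {a b} c → a ≺ b → a + c ≺ b + c
  +-monoˡ-≺ {a} {b} c p = ≺-stable (≺⇒+ p >>= λ (d , e) → return (+⇒≺ d (≋-trans (+-cong e ≋-refl)
    (solve 3 (λ a c d → a :+ d :+ :con 1 :+ c := a :+ c :+ d :+ :con 1) ≋-refl a c d))))

  +-cancelʳ : ∀ {a b} c → a + c ≋ b + c → a ≋ b
  +-cancelʳ {a} {b} c e = ≋-stable (≺-cmp a b >>=
    [ (λ p k → ≺-irrefl (≺-resp e ≋-refl (+-monoˡ-≺ c p)))
    , [ return , (λ p k → ≺-irrefl (≺-resp (≋-sym e) ≋-refl (+-monoˡ-≺ c p))) ] ])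

  +-cancelˡ : ∀ {a b} c → c + a ≋ c + b → a ≋ b
  +-cancelˡ {a} {b} c e = +-cancelʳ c (≋-trans (+-comm a c) (≋-trans e (+-comm c b)))

  -- Pairing

  ⟨_,_⟩ : N → N → N
  ⟨ i , j ⟩ = (i + j) * (i + j) + i

  ⟪_,_⟫ᵇ : ∀ {k} → Tmᵇ k → Tmᵇ k → Tmᵇ k
  ⟪ t , u ⟫ᵇ = (t ⊕ u) · (t ⊕ u) ⊕ t

  ⟨⟩-cong : ∀ {i j k l} → i ≋ k → j ≋ l → ⟨ i , j ⟩ ≋ ⟨ k , l ⟩
  ⟨⟩-cong e f = +-cong (*-cong (+-cong e f) (+-cong e f)) e

  -- With s = i + j, the code s² + i lies below (s + 1)², so the sum of the components decides
  -- first.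
  ⟨⟩-sum-mono : ∀ {i j k l} → i + j ≺ k + l → ⟨ i , j ⟩ ≺ ⟨ k , l ⟩
  ⟨⟩-sum-mono {i} {j} {k} {l} p = ≺-stable (≺⇒+ p >>= λ (d , e) → return
    (+⇒≺ (i + j + j + (i + j + (i + j)) * d + d * d + d + d + k)
      (≋-trans (+-cong (*-cong e e) ≋-refl)
        (solve 4 (λ i j d k → (i :+ j :+ d :+ :con 1) :* (i :+ j :+ d :+ :con 1) :+ k :=
           (i :+ j) :* (i :+ j) :+ i :+ (i :+ j :+ j :+ (i :+ j :+ (i :+ j)) :* d :+ d :* d :+ d :+ d :+ k) :+ :con 1)
         ≋-refl i j d k))))

  ⟨⟩-injective : ∀ {i j k l} → ⟨ i , j ⟩ ≋ ⟨ k , l ⟩ → i ≋ k × j ≋ l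
  ⟨⟩-injective {i} {j} {k} {l} e = i≋k , +-cancelˡ k (≋-trans (+-cong (≋-sym i≋k) ≋-refl) s≋t)
    where
    s≋t : i + j ≋ k + l
    s≋t = ≋-stable (≺-cmp (i + j) (k + l) >>=
      [ (λ p k → ≺-irrefl (≺-resp e ≋-refl (⟨⟩-sum-mono p)))
      , [ return , (λ p k → ≺-irrefl (≺-resp (≋-sym e) ≋-refl (⟨⟩-sum-mono p))) ] ])
    i≋k : i ≋ k
    i≋k = +-cancelˡ ((k + l) * (k + l)) (≋-trans (+-cong (≋-sym (*-cong s≋t s≋t)) ≋-refl) e)

  i≺⟨i,j⟩+1 : ∀ i j → i ≺ ⟨ i , j ⟩ + 1#
  i≺⟨i,j⟩+1 i j = ≼⇒≺suc (n≼m+n _)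

  j≺⟨i,j⟩+1 : ∀ i j → j ≺ ⟨ i , j ⟩ + 1#
  j≺⟨i,j⟩+1 i j = ≺-stable (0-or-suc j >>=
    [ (λ e → return (≺-resp (≋-sym e) ≋-refl (0≺suc _)))
    , (λ (c , e) → return (≺-resp (≋-sym e) (suc-cong (⟨⟩-cong ≋-refl (≋-sym e))) (+⇒≺ ((i + c) * (i + c) + i + i + i + c)
        (solve 2 (λ i c → (i :+ (c :+ :con 1)) :* (i :+ (c :+ :con 1)) :+ i :+ :con 1 :=
          c :+ :con 1 :+ ((i :+ c) :* (i :+ c) :+ i :+ i :+ i :+ c) :+ :con 1) ≋-refl i c)))) ])

  -- Comprehension for binary relations

  Δ₁-comprehension² : (φ ψ : BF 3) →
    (∀ a b → Iff (∃ᴷ λ w → ⟦ φ ⟧ᵇ (w ∷ a ∷ b ∷ [])) (∀ w → ⟦ ψ ⟧ᵇ (w ∷ a ∷ b ∷ []))) →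
    K (Σ S λ X → (∀ p → p ε X → K (Σ N λ a → Σ N λ b → p ≋ ⟨ a , b ⟩)) ×
                 (∀ a b → Iff (⟨ a , b ⟩ ε X) (∃ᴷ λ w → ⟦ φ ⟧ᵇ (w ∷ a ∷ b ∷ []))))
  Δ₁-comprehension² φ ψ e = Δ₁-comprehension
      (isPair (call φ (v₂ ∷ v₁ ∷ v₀ ∷ [])))
      -- The universal form is vacuous for numbers that are not pairs, so being a pair is demanded
      -- separately. Components are bounded by the code, which keeps both matrices Δ⁰₀.
      (isPair (v₀ ≈ v₀) ∧ᵇ ∀< (v₁ ⊕ con 1#) (∀< (v₂ ⊕ con 1#) (v₃ ≈ ⟪ v₁ , v₀ ⟫ᵇ ⇒ call ψ (v₂ ∷ v₁ ∷ v₀ ∷ []))))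
      (λ p → (λ h w → (h >>= λ (_ , h) → h >>= λ (a , l , h) → h >>= λ (b , l′ , f , _) →
                        return (a , l , return (b , l′ , f , ≋-refl))) ,
                      (λ a _ b _ f → proj₁ (e a b) (h >>= λ (w , h) → h >>= λ (c , _ , h) → h >>= λ (d , _ , g , r) →
                        return (w , transport φ (≋-trans (≋-sym g) f) r)) w)) ,
             (λ h → proj₁ (h 0#) >>= λ (a , l , h′) → h′ >>= λ (b , l′ , f , _) →
               proj₂ (e a b) (λ w → proj₂ (h w) a l b l′ f) >>= λ (w , r) →
               return (w , return (a , l , return (b , l′ , f , r)))))
    >>= λ (X , f) → return (X ,
      (λ p m → proj₁ (f p) m >>= λ (_ , h) → h >>= λ (a , _ , h) → h >>= λ (b , _ , g , _) → return (a , b , g)) ,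
      λ a b →
      (λ m → proj₁ (f _) m >>= λ (w , h) → h >>= λ (c , _ , h) → h >>= λ (d , _ , g , r) → return (w , transport φ (≋-sym g) r)) ,
      (λ h → ε-stable (h >>= λ (w , r) →
        return (proj₂ (f _) (return (w , return (a , i≺⟨i,j⟩+1 a b , return (b , j≺⟨i,j⟩+1 a b , ≋-refl , r))))))))
    where
    isPair : BF 4 → BF 2
    isPair χ = ∃< (v₁ ⊕ con 1#) (∃< (v₂ ⊕ con 1#) (v₃ ≈ ⟪ v₁ , v₀ ⟫ᵇ ∧ᵇ χ))
    transport : (χ : BF 3) → ∀ {w a b c d} → ⟨ a , b ⟩ ≋ ⟨ c , d ⟩ → ⟦ χ ⟧ᵇ (w ∷ a ∷ b ∷ []) → ⟦ χ ⟧ᵇ (w ∷ c ∷ d ∷ [])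
    transport χ {w} {a} {b} {c} {d} g r = let e₁ , e₂ = ⟨⟩-injective g in
      respect (call χ (con w ∷ con c ∷ v₀ ∷ [])) [] e₂ (respect (call χ (con w ∷ v₀ ∷ con b ∷ [])) [] e₁ r)

  Δ₀-relation : (φ : BF 2) → K (Σ S λ X → (∀ p → p ε X → K (Σ N λ a → Σ N λ b → p ≋ ⟨ a , b ⟩)) ×
                                           (∀ a b → Iff (⟨ a , b ⟩ ε X) (⟦ φ ⟧ᵇ (a ∷ b ∷ []))))
  Δ₀-relation φ = Δ₁-comprehension² φ′ φ′ (λ a b → (λ h _ → stab h) , (λ h → return (0# , h 0#))) >>= λ (X , f , g) →
    return (X , f , λ a b → (λ m → stab (proj₁ (g a b) m)) , λ h → proj₂ (g a b) (return (0# , h)))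
    where
    φ′ : BF 3
    φ′ = call φ (v₁ ∷ v₂ ∷ [])
    stab : ∀ {a b} → ∃ᴷ (λ w → ⟦ φ′ ⟧ᵇ (w ∷ a ∷ b ∷ [])) → ⟦ φ ⟧ᵇ (a ∷ b ∷ [])
    stab h = stableᵇ φ _ (h >>= λ (_ , r) → return r)

  Δ₀-comprehension² : (φ : BF 2) → K (Σ S λ X → ∀ a b → Iff (⟨ a , b ⟩ ε X) (⟦ φ ⟧ᵇ (a ∷ b ∷ [])))
  Δ₀-comprehension² φ = Δ₀-relation φ >>= λ (X , _ , f) → return (X , f)

  -- Least number principles

  least : (φ : BF 1) → ∀ {a} → ⟦ φ ⟧ᵇ (a ∷ []) → ∃ᴷ λ m → ⟦ φ ⟧ᵇ (m ∷ []) × (∀ x → x ≺ m → ⟦ φ ⟧ᵇ (x ∷ []) → B)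
  least φ {a} p k = Δ₀-induction (∀< v₀ (call φ (v₀ ∷ []) ⇒ ⊥)) (λ x q → λ _ → ≺0 q)
    (λ a f x q r → k (x , r , λ y y≺x → f y (≺-≼-trans y≺x (≺suc⇒≼ q)))) (a + 1#) a n≺n+1 p

  -- If there were no least element, induction on a would yield a single w below which each y < a
  -- has its counterexample. Collecting the counterexamples under one bound keeps this statement Σ⁰₁
  -- without a prior bounding principle.
  least-Π₁ : (φ : BF 2) → ∀ {a} → (∀ x → ⟦ φ ⟧ᵇ (x ∷ a ∷ [])) →
    ∃ᴷ λ m → (∀ x → ⟦ φ ⟧ᵇ (x ∷ m ∷ [])) × (∀ b → b ≺ m → (∀ x → ⟦ φ ⟧ᵇ (x ∷ b ∷ [])) → B)
  least-Π₁ φ {a} p k = Σ₁-induction θ (return (0# , λ x q _ → ≺0 q)) step (a + 1#) λ (w , f) →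
    f a n≺n+1 λ (x , _ , ¬q) → ¬q (p x)
    where
    θ : BF 2
    θ = ∀< v₁ (∃< v₁ (call φ (v₀ ∷ v₁ ∷ []) ⇒ ⊥))
    step : ∀ b → ∃ᴷ (λ w → ⟦ θ ⟧ᵇ (w ∷ b ∷ [])) → ∃ᴷ (λ w → ⟦ θ ⟧ᵇ (w ∷ b + 1# ∷ []))
    step b h = h >>= λ (w , f) →
      (λ c → k (b , (λ x → stableᵇ φ _ λ ¬q → c (x , ¬q)) , λ y y≺b q → f y y≺b λ (x , _ , ¬q) → ¬q (q x)))
      >>= λ (x₁ , ¬q₁) → return (w + x₁ + 1# , λ y y≺sb → ≺-suc⁻ y≺sb >>=
        [ (λ y≺b → f y y≺b >>= λ (x , x≺w , ¬q) → return (x , ≺-trans (≺-≼-trans x≺w (m≼m+n x₁)) n≺n+1 , ¬q))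
        , (λ e → return (x₁ , ≼⇒≺suc (n≼m+n w) , λ q → ¬q₁ (respect (call φ (con x₁ ∷ v₀ ∷ [])) [] e q))) ])

  strong-induction : (φ : BF 1) → (∀ x → (∀ y → y ≺ x → ⟦ φ ⟧ᵇ (y ∷ [])) → ⟦ φ ⟧ᵇ (x ∷ [])) → ∀ x → ⟦ φ ⟧ᵇ (x ∷ [])
  strong-induction φ f x = Δ₀-induction (∀< v₀ (call φ (v₀ ∷ []))) (λ y p → stableᵇ φ _ λ _ → ≺0 p)
    (λ a g y p → f y λ z q → g z (≺-≼-trans q (≺suc⇒≼ p))) (x + 1#) x n≺n+1

  *-pos : ∀ {a b} → 0# ≺ a → 0# ≺ b → 0# ≺ a * b
  *-pos {a} {b} p q = ≺-stable (≺⇒+ p >>= λ (c , e) → ≺⇒+ q >>= λ (d , f) → return (+⇒≺ (c * d + c + d)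
    (≋-trans (*-cong e f) (solve 2 (λ c d → (:con 0 :+ c :+ :con 1) :* (:con 0 :+ d :+ :con 1) :=
      :con 0 :+ (c :* d :+ c :+ d) :+ :con 1) ≋-refl c d))))

  -- Finite sets of numbers are coded as in Gödel's β-function: i belongs to the set
  -- coded by a and b if (i + 1) b + 1 divides a.

  -- e ∣⁺ a says that e + 1 divides a.
  infix 4 _∣⁺_
  _∣⁺_ : N → N → Set
  e ∣⁺ a = ∃ᴷ λ q → q ≺ a + 1# × (e + 1#) * q ≋ a

  ∣⁺ᵇ : BF 2
  ∣⁺ᵇ = ∃< (v₁ ⊕ con 1#) ((v₁ ⊕ con 1#) · v₀ ≈ v₂)

  ∣⁺-intro : ∀ {e a} q → (e + 1#) * q ≋ a → e ∣⁺ a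
  ∣⁺-intro {e} {a} q f = return (q , ≼⇒≺suc (+⇒≼ (e * q) (≋-trans (≋-sym f)
    (solve 2 (λ e q → (e :+ :con 1) :* q := q :+ e :* q) ≋-refl e q))) , f)

  ∣⁺-respʳ : ∀ {e a b} → a ≋ b → e ∣⁺ a → e ∣⁺ b
  ∣⁺-respʳ {e} f d = respect (call ∣⁺ᵇ (con e ∷ v₀ ∷ [])) [] f d

  ∣⁺-respˡ : ∀ {e f a} → e ≋ f → e ∣⁺ a → f ∣⁺ a
  ∣⁺-respˡ {a = a} e d = respect ∣⁺ᵇ (a ∷ []) e d

  ∣⁺-mulˡ : ∀ {e a} c → e ∣⁺ a → e ∣⁺ c * a
  ∣⁺-mulˡ {e} c d = d >>= λ (q , _ , f) → ∣⁺-intro (c * q)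
    (≋-trans (solve 3 (λ e c q → (e :+ :con 1) :* (c :* q) := c :* ((e :+ :con 1) :* q)) ≋-refl e c q) (*-cong ≋-refl f))

  ∣⁺-cancel : ∀ {e a b} → e ∣⁺ a + b → e ∣⁺ a → e ∣⁺ b
  ∣⁺-cancel {e} {a} {b} d d′ = d >>= λ (q , _ , f) → d′ >>= λ (q′ , _ , f′) → ≼-or-≺ q′ q >>=
    [ (λ p → ≼-≺-or-≋ p >>=
        [ (λ p → ≺⇒+ p >>= λ (r , g) → ∣⁺-intro (r + 1#) (+-cancelˡ a (≋-trans
            (+-cong (≋-sym f′) ≋-refl) (≋-trans (≋-trans
              (solve 3 (λ e q r → (e :+ :con 1) :* q :+ (e :+ :con 1) :* (r :+ :con 1) := (e :+ :con 1) :* (q :+ r :+ :con 1))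
                ≋-refl e q′ r) (*-cong ≋-refl (≋-sym g))) f))))
        , (λ g → ∣⁺-intro 0# (+-cancelˡ a (≋-trans (≋-trans
            (solve 2 (λ e a → a :+ (e :+ :con 1) :* :con 0 := a) ≋-refl e a) (≋-sym f′)) (≋-trans (*-cong ≋-refl g) f)))) ])
    , (λ p k → ≺⇒+ p λ (r , g) → ≺-irrefl (+⇒≺ {(e + 1#) * q} ((e + 1#) * r + e + b) (≋-trans f (≋-trans
        (+-cong (≋-trans (≋-sym f′) (*-cong ≋-refl g)) ≋-refl)
        (solve 4 (λ e q r b → (e :+ :con 1) :* (q :+ r :+ :con 1) :+ b :=
           (e :+ :con 1) :* q :+ ((e :+ :con 1) :* r :+ e :+ b) :+ :con 1) ≋-refl e q r b))))) ]

  -- Used twice: `c = 0`, `d = 1` gives a common multiple of 1, ..., n, and `c = 1` with that number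
  -- as `d` gives a common multiple of the moduli.
  common-multiple : ∀ c d n → ∃ᴷ λ a → 0# ≺ a × (∀ i → i ≺ n → (i + c) * d ∣⁺ a)
  common-multiple c d = Σ₁-induction φ (return (1# , ≺-resp ≋-refl (+-identityˡ 1#) n≺n+1 , λ i p → λ _ → ≺0 p)) step
    where
    φ : BF 2
    φ = con 0# < v₀ ∧ᵇ ∀< v₁ (call ∣⁺ᵇ ((v₀ ⊕ con c) · con d ∷ v₁ ∷ []))
    step : ∀ n → ∃ᴷ (λ a → ⟦ φ ⟧ᵇ (a ∷ n ∷ [])) → ∃ᴷ (λ a → ⟦ φ ⟧ᵇ (a ∷ n + 1# ∷ []))
    step n h = h >>= λ (a , p , f) → return (((n + c) * d + 1#) * a , *-pos (0≺suc _) p , λ i q →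
      ≺-suc⁻ q >>= [ (λ r → ∣⁺-mulˡ _ (f i r)) , (λ e → ∣⁺-intro a (*-cong (suc-cong (*-cong (+-cong e ≋-refl) ≋-refl)) ≋-refl)) ])

  modulus : N → N → N
  modulus b i = (i + 1#) * b

  Memᵇ : BF 3
  Memᵇ = call ∣⁺ᵇ ((v₀ ⊕ con 1#) · v₂ ∷ v₁ ∷ [])

  Mem : N → N → N → Set
  Mem i a b = modulus b i ∣⁺ a

  -- `b` is divisible by 1, ..., n, which makes the moduli coprime. `full` is divisible by all
  -- moduli; it codes everything below `n` and will bound the codes of all Σ⁰₁ subsets.
  record Base (n : N) : Set where
    field
      b full    : N
      b-pos     : 0# ≺ b
      b-good    : ∀ k → k ≺ n → k ∣⁺ b
      full-pos  : 0# ≺ full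
      full-good : ∀ i → i ≺ n → Mem i full b

  base : ∀ n → K (Base n)
  base n = common-multiple 0# 1# n >>= λ (b , p , f) → common-multiple 1# b n >>= λ (a , q , g) → return record
    { b = b ; full = a ; b-pos = p ; full-pos = q ; full-good = g
    ; b-good = λ k r → ∣⁺-respˡ (solve 1 (λ k → (k :+ :con 0) :* :con 1 := k) ≋-refl k) (f k r) }

  module _ {n : N} (C : Base n) where
    open Base C

    -- The moduli of i and j are coprime since their difference is a multiple
    -- (k + 1) b of b with k + 1 dividing b.
    modulus-coprime : ∀ {i j x} → i ≺ n → j ≺ n → (i ≋ j → B) → Mem j ((modulus b i + 1#) * x) b → Mem j x b
    modulus-coprime {i} {j} {x} i≺n j≺n i≢j d = ≺-cmp i j >>=
      [ (λ p → ≺⇒+ p >>= λ (k , e) → tail k (diff≺ e)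
          (∣⁺-cancel {a = (modulus b i + 1#) * x}
            (∣⁺-respʳ (≋-trans (*-cong ≋-refl (suc-cong (*-cong (suc-cong e) ≋-refl)))
              (solve 4 (λ i k b x → x :* ((i :+ k :+ :con 1 :+ :con 1) :* b :+ :con 1) :=
                 ((i :+ :con 1) :* b :+ :con 1) :* x :+ x :* ((k :+ :con 1) :* b)) ≋-refl i k b x)) self) d))
      , [ (λ e _ → i≢j e)
        , (λ p → ≺⇒+ p >>= λ (k , e) → tail k (≺-trans (+⇒≺ j (≋-trans e (suc-cong (+-comm j k)))) i≺n)
            (∣⁺-cancel {a = x * (modulus b j + 1#)} (∣⁺-respʳ
              (≋-trans (*-cong (suc-cong (*-cong (suc-cong e) ≋-refl)) ≋-refl)
                (solve 4 (λ j k b x → ((j :+ k :+ :con 1 :+ :con 1) :* b :+ :con 1) :* x :=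
                   x :* ((j :+ :con 1) :* b :+ :con 1) :+ x :* ((k :+ :con 1) :* b)) ≋-refl j k b x)) d) self)) ] ]
      where
      self : ∀ {y} → Mem j (y * (modulus b j + 1#)) b
      self {y} = ∣⁺-intro y (*-comm _ y)
      diff≺ : ∀ {k} → j ≋ i + k + 1# → k ≺ n
      diff≺ {k} e = ≺-trans (+⇒≺ i (≋-trans e (suc-cong (+-comm i k)))) j≺n
      drop-b : ∀ {y} → Mem j (y * b) b → Mem j y b
      drop-b {y} d = ∣⁺-cancel (∣⁺-respʳ (solve 3 (λ y j b → y :* ((j :+ :con 1) :* b :+ :con 1) :=
        (j :+ :con 1) :* (y :* b) :+ y) ≋-refl y j b) self) (∣⁺-mulˡ (j + 1#) d)
      tail : ∀ k → k ≺ n → Mem j (x * ((k + 1#) * b)) b → Mem j x b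
      tail k k≺n d = b-good k k≺n >>= λ (c , _ , e) → drop-b (∣⁺-respʳ
        (≋-trans (solve 3 (λ c x k → c :* (x :* (k :+ :con 1)) := x :* ((k :+ :con 1) :* c)) ≋-refl c x k) (*-cong ≋-refl e))
        (∣⁺-mulˡ c (drop-b (∣⁺-respʳ (≋-sym (*-assoc x (k + 1#) b)) d))))

    -- The least a which codes a superset of {i < n | ∃ x φ(x, i)} codes this set.
    code : (φ : BF 2) → ∃ᴷ λ a → a ≼ full × (∀ i → i ≺ n → Iff (Mem i a b) (∃ᴷ λ x → ⟦ φ ⟧ᵇ (x ∷ i ∷ [])))
    code φ = least-Π₁ θ {full} (λ x → full-pos , λ i p _ → full-good i p) >>= λ (a , f , min) →
      return (a , (λ p → min full p λ x → full-pos , λ i q _ → full-good i q) , λ i p →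
        -- If i were coded without satisfying ∃x φ, the quotient q of a by the modulus of i would,
        -- by coprimality, be a smaller code of a superset.
        (λ d k → d λ (q , _ , e) → min q (smaller (proj₁ (f 0#)) e) λ x →
           positive (proj₁ (f 0#)) e , λ j r s →
           modulus-coprime p r (λ i≋j → k (x , respect (call φ (con x ∷ v₀ ∷ [])) [] (≋-sym i≋j) s))
             (∣⁺-respʳ (≋-sym e) (proj₂ (f x) j r s))) ,
        (λ g → g >>= λ (x , s) → proj₂ (f x) i p s))
      where
      θ : BF 2
      θ = con 0# < v₁ ∧ᵇ ∀< (con n) (call φ (v₁ ∷ v₀ ∷ []) ⇒ call Memᵇ (v₀ ∷ v₂ ∷ con b ∷ []))
      positive : ∀ {a q m} → 0# ≺ a → m * q ≋ a → 0# ≺ q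
      positive {a} {q} {m} p e = ≺-stable λ k → 0-or-suc q
        [ (λ f → ≺0 (≺-resp ≋-refl (≋-trans (≋-sym e) (≋-trans (*-cong ≋-refl f) (*-zeroʳ m))) p))
        , (λ (c , f) → k (≺-resp ≋-refl (≋-sym f) (0≺suc c))) ]
      smaller : ∀ {a q i} → 0# ≺ a → (modulus b i + 1#) * q ≋ a → q ≺ a
      smaller {a} {q} {i} p e = ≺-stable (≺⇒+ (*-pos (*-pos (0≺suc i) b-pos) (positive p e)) >>= λ (c , f) →
        return (+⇒≺ c (≋-trans (≋-sym e) (≋-trans (*-distribʳ q _ 1#) (≋-trans (+-cong f (*-identityˡ q))
            (solve 2 (λ c q → :con 0 :+ c :+ :con 1 :+ q := q :+ c :+ :con 1) ≋-refl c q))))))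

  -- Strong bounding and finitely many patterns

  -- Which i have a witness is only a Σ⁰₁ matter, but the set of these i below n has a code. With
  -- the code as a parameter, the statement that all coded i < j have a witness below w is bounded,
  -- and Σ⁰₁ induction on j applies.
  strong-bounding : (φ : BF 2) → ∀ n → ∃ᴷ λ w → ∀ i → i ≺ n → ∀ x → ⟦ φ ⟧ᵇ (x ∷ i ∷ []) →
                    ∃ᴷ λ y → y ≺ w × ⟦ φ ⟧ᵇ (y ∷ i ∷ [])
  strong-bounding φ n = base n >>= λ C → code C φ >>= λ (a , _ , f) →
    let open Base C
        ψ : BF 2
        ψ = ∀< v₁ (v₀ < con n ⇒ call Memᵇ (v₀ ∷ con a ∷ con b ∷ []) ⇒ ∃< v₁ (call φ (v₀ ∷ v₁ ∷ [])))
        step : ∀ j → ∃ᴷ (λ w → ⟦ ψ ⟧ᵇ (w ∷ j ∷ [])) → ∃ᴷ (λ w → ⟦ ψ ⟧ᵇ (w ∷ j + 1# ∷ []))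
        step j h = h >>= λ (w , g) → em {Σ N λ x → ⟦ φ ⟧ᵇ (x ∷ j ∷ [])} >>= λ d → return (
          [ (λ (x , p) → w + x + 1# , λ i q r m → ≺-suc⁻ q >>=
              [ (λ i≺j → g i i≺j r m >>= λ (y , y≺w , s) → return (y , ≺-trans (≺-≼-trans y≺w (m≼m+n x)) n≺n+1 , s))
              , (λ e → return (x , ≼⇒≺suc (n≼m+n w) , respect (call φ (con x ∷ v₀ ∷ [])) [] (≋-sym e) p)) ])
          , (λ ¬p → w , λ i q r m → ≺-suc⁻ q >>=
              [ (λ i≺j → g i i≺j r m)
              , (λ e k → proj₁ (f i r) m λ (x , s) → ¬p (x , respect (call φ (con x ∷ v₀ ∷ [])) [] e s)) ]) ] d)
    in Σ₁-induction ψ (return (0# , λ i p _ _ _ → ≺0 p)) step n >>= λ (w , g) →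
       return (w , λ i p x s → g i p p (proj₂ (f i p) (return (x , s))))

  Agree : S → N → N → N → Set
  Agree G n x y = ∀ i → i ≺ n → Iff (⟨ x , i ⟩ ε G) (⟨ y , i ⟩ ε G)

  -- There are only finitely many patterns below n.
  representatives : ∀ (G X : S) n → ∃ᴷ λ w → ∀ x → x ε X → ∃ᴷ λ y → y ≺ w × y ε X × Agree G n x y
  representatives G X n = base n >>= λ C →
    let open Base C
        φ : BF 2
        φ = v₀ ∈ X ∧ᵇ ∀< (con n) ((call Memᵇ (v₀ ∷ v₂ ∷ con b ∷ []) ⇒ ⟪ v₁ , v₀ ⟫ᵇ ∈ G)
                                ∧ᵇ (⟪ v₁ , v₀ ⟫ᵇ ∈ G ⇒ call Memᵇ (v₀ ∷ v₂ ∷ con b ∷ [])))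
    -- Patterns are represented by codes up to `full`. Bounding over the codes puts, for every
    -- pattern that occurs in X, an element with this pattern below w.
    in strong-bounding φ (full + 1#) >>= λ (w , f) → return (w , λ x x∈X →
       code C (⟪ con x , v₁ ⟫ᵇ ∈ G) >>= λ (a , a≼ , g) →
       f a (≼⇒≺suc a≼) x (x∈X , λ i p → (λ m → ε-stable (proj₁ (g i p) m >>= λ (_ , s) → return s))
                                      , (λ s → proj₂ (g i p) (return (0# , s)))) >>= λ (y , y≺w , y∈X , h) →
       return (y , y≺w , y∈X , λ i p →
         (λ s → proj₁ (h i p) (proj₂ (g i p) (return (0# , s)))) ,
         (λ s → ε-stable (proj₁ (g i p) (proj₂ (h i p) s) >>= λ (_ , s) → return s))))

  -- Greedy sets by course-of-values recursion

  module Greedy (A Q : S) where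

    Nextᵇ : BF 3
    Nextᵇ = v₀ ∈ A ∧ᵇ ∀< v₀ (call Memᵇ (v₀ ∷ v₂ ∷ v₃ ∷ []) ⇒ ⟪ v₀ , v₁ ⟫ᵇ ∈ Q)

    Next : N → N → N → Set
    Next x a b = ⟦ Nextᵇ ⟧ᵇ (x ∷ a ∷ b ∷ [])

    -- A correct code is a history of the greedy recursion up to n: each x < n is a member exactly
    -- if it passes the test `Next` against the members before it.
    Corrᵇ : BF 3
    Corrᵇ = ∀< v₂ ((call Memᵇ (v₀ ∷ v₁ ∷ v₂ ∷ []) ⇒ call Nextᵇ (v₀ ∷ v₁ ∷ v₂ ∷ []))
                 ∧ᵇ (call Nextᵇ (v₀ ∷ v₁ ∷ v₂ ∷ []) ⇒ call Memᵇ (v₀ ∷ v₁ ∷ v₂ ∷ [])))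

    Corr : N → N → N → Set
    Corr a b n = ⟦ Corrᵇ ⟧ᵇ (a ∷ b ∷ n ∷ [])

    Corr-≼ : ∀ {a b m n} → m ≼ n → Corr a b n → Corr a b m
    Corr-≼ le c x p = c x (≺-≼-trans p le)

    Next-Iff : ∀ {x a b a′ b′} → (∀ y → y ≺ x → Iff (Mem y a b) (Mem y a′ b′)) → Iff (Next x a b) (Next x a′ b′)
    Next-Iff e = (λ (p , f) → p , λ y q m → f y q (proj₂ (e y q) m)) , (λ (p , f) → p , λ y q m → f y q (proj₁ (e y q) m))

    existsᵇ : BF 2
    existsᵇ = ∃< v₀ (∃< v₁ (call Corrᵇ (v₁ ∷ v₀ ∷ v₃ ∷ [])))

    exists : ∀ n → K (Σ N λ a → Σ N λ b → Corr a b n)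
    exists n = Σ₁-induction existsᵇ (pack {0#} {0#} λ x q → (λ _ → stableᵇ Nextᵇ (x ∷ 0# ∷ 0# ∷ []) λ _ → ≺0 q) , (λ _ _ → ≺0 q)) step n >>= unpack
      where
      pack : ∀ {a b n} → Corr a b n → ∃ᴷ (λ w → ⟦ existsᵇ ⟧ᵇ (w ∷ n ∷ []))
      pack {a} {b} c = return (a + b + 1# , return (a , ≼⇒≺suc (m≼m+n b) , return (b , ≼⇒≺suc (n≼m+n a) , c)))
      unpack : ∀ {n} → Σ N (λ w → ⟦ existsᵇ ⟧ᵇ (w ∷ n ∷ [])) → K (Σ N λ a → Σ N λ b → Corr a b n)
      unpack (w , h) = h >>= λ (a , _ , h) → h >>= λ (b , _ , c) → return (a , b , c)
      step : ∀ n → ∃ᴷ (λ w → ⟦ existsᵇ ⟧ᵇ (w ∷ n ∷ [])) → ∃ᴷ (λ w → ⟦ existsᵇ ⟧ᵇ (w ∷ n + 1# ∷ []))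
      -- The moduli depend on the length, so the history is recoded over a base for n + 1 instead of
      -- being prolonged.
      step n h = h >>= unpack >>= λ (a , b , c) → base (n + 1#) >>= λ C →
        code C (call Nextᵇ (v₁ ∷ con a ∷ con b ∷ [])) >>= λ (a′ , _ , f) →
        let mem′ : ∀ i → i ≺ n + 1# → Iff (Mem i a′ (Base.b C)) (Next i a b)
            mem′ i p = (λ m → stableᵇ Nextᵇ (i ∷ a ∷ b ∷ []) (proj₁ (f i p) m >>= λ (_ , s) → return s)) , (λ s → proj₂ (f i p) (return (0# , s)))
            same : ∀ x → x ≺ n + 1# → ∀ y → y ≺ x → Iff (Mem y a b) (Mem y a′ (Base.b C))
            same x p y q = let y≺n = ≺-≼-trans q (≺suc⇒≼ p) in
              (λ m → proj₂ (mem′ y (≺-step y≺n)) (proj₁ (c y y≺n) m)) ,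
              (λ m → proj₂ (c y y≺n) (proj₁ (mem′ y (≺-step y≺n)) m))
        in pack {a′} {Base.b C} λ x p → (λ m → proj₁ (Next-Iff (same x p)) (proj₁ (mem′ x p) m))
                                      , (λ s → proj₂ (mem′ x p) (proj₂ (Next-Iff (same x p)) s))

    unique : ∀ {a b n a′ b′ n′} → Corr a b n → Corr a′ b′ n′ → ∀ x → x ≺ n → x ≺ n′ → Iff (Mem x a b) (Mem x a′ b′)
    unique {a} {b} {n} {a′} {b′} {n′} c c′ = strong-induction
      (v₀ < con n ⇒ v₀ < con n′ ⇒ (call Memᵇ (v₀ ∷ con a ∷ con b ∷ []) ⇒ call Memᵇ (v₀ ∷ con a′ ∷ con b′ ∷ []))
                               ∧ᵇ (call Memᵇ (v₀ ∷ con a′ ∷ con b′ ∷ []) ⇒ call Memᵇ (v₀ ∷ con a ∷ con b ∷ [])))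
      λ x ih p p′ → let e = Next-Iff (λ y q → ih y q (≺-trans q p) (≺-trans q p′)) in
        (λ m → proj₂ (c′ x p′) (proj₁ e (proj₁ (c x p) m))) , (λ m → proj₂ (c x p) (proj₂ e (proj₁ (c′ x p′) m)))

    -- Histories exist for every length and agree with each other. Hence x lies in some history of
    -- length x + 1 if and only if it lies in all of them, which is a Δ⁰₁ definition.
    greedy : K (Σ S λ H → ∀ x → Iff (x ε H) (x ε A × (∀ y → y ≺ x → y ε H → ⟨ y , x ⟩ ε Q)))
    greedy = Δ₁-comprehension
        (∃< v₀ (∃< v₁ (call Corrᵇ (v₁ ∷ v₀ ∷ v₃ ⊕ con 1# ∷ []) ∧ᵇ call Memᵇ (v₃ ∷ v₁ ∷ v₀ ∷ []))))
        (∀< v₀ (∀< v₁ (call Corrᵇ (v₁ ∷ v₀ ∷ v₃ ⊕ con 1# ∷ []) ⇒ call Memᵇ (v₃ ∷ v₁ ∷ v₀ ∷ []))))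
        (λ x → (λ h w a _ b _ c → h >>= λ (_ , h) → h >>= λ (a′ , _ , h) → h >>= λ (b′ , _ , c′ , m) →
                  proj₁ (unique c′ c x n≺n+1 n≺n+1) m)
             , (λ h → exists (x + 1#) >>= λ (a , b , c) →
                  pack c (h (a + b + 1#) a (≼⇒≺suc (m≼m+n b)) b (≼⇒≺suc (n≼m+n a)) c)))
      >>= λ (H , f) →
      let inH : ∀ {a b n} → Corr a b n → ∀ x → x ≺ n → Iff (x ε H) (Mem x a b)
          inH c x p = (λ m → proj₁ (f x) m >>= λ (_ , h) → h >>= λ (a′ , _ , h) → h >>= λ (b′ , _ , c′ , m) →
                         proj₁ (unique c′ c x n≺n+1 p) m)
                    , (λ m → proj₂ (f x) (pack (Corr-≼ (≺⇒suc≼ p) c) m))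
      in return (H , λ x →
        (λ m → ε-stable (exists (x + 1#) >>= λ (a , b , c) →
                  return (proj₁ (proj₁ (c x n≺n+1) (proj₁ (inH c x n≺n+1) m)))) ,
               λ y q m′ → ε-stable (exists (x + 1#) >>= λ (a , b , c) →
                  return (proj₂ (proj₁ (c x n≺n+1) (proj₁ (inH c x n≺n+1) m)) y q (proj₁ (inH c y (≺-step q)) m′)))) ,
        (λ (p , g) → ε-stable (exists (x + 1#) >>= λ (a , b , c) → return
           (proj₂ (inH c x n≺n+1) (proj₂ (c x n≺n+1) (p , λ y q m → g y q (proj₂ (inH c y (≺-step q)) m)))))))
      where
      pack : ∀ {a b x} → Corr a b (x + 1#) → Mem x a b → ∃ᴷ λ w →
             ∃ᴷ λ a → a ≺ w × (∃ᴷ λ b → b ≺ w × Corr a b (x + 1#) × Mem x a b)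
      pack {a} {b} c m = return (a + b + 1# , return (a , ≼⇒≺suc (m≼m+n b) , return (b , ≼⇒≺suc (n≼m+n a) , c , m)))

  -- Unbounded homogeneous sets and extremal elements

  Unbounded : S → Set
  Unbounded X = ∀ k → ∃ᴷ λ y → y ε X × k ≼ y

  Extendible : S → S → Set
  Extendible A Q = ∀ F k → (∀ x → x ε F → x ε A × x ≺ k) → (∀ x y → x ≺ y → x ε F → y ε F → ⟨ x , y ⟩ ε Q) →
                   ∃ᴷ λ y → y ε A × k ≼ y × (∀ x → x ε F → ⟨ x , y ⟩ ε Q)

  -- If `k` bounded the greedy set, the whole set would be an admissible `F`; the new y would pass
  -- the greedy test and so be a member that is not below `k`.
  greedy-unbounded : ∀ A Q → Extendible A Q →
    K (Σ S λ H → Unbounded H × (∀ x → x ε H → x ε A) × (∀ x y → x ≺ y → x ε H → y ε H → ⟨ x , y ⟩ ε Q))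
  greedy-unbounded A Q ext = Greedy.greedy A Q >>= λ (H , f) → return (H ,
    (λ k ¬y → let below : ∀ x → x ε H → x ≺ k
                  below x m = ≺-stable λ ¬p → ¬y (x , m , ¬p)
      in ext H k (λ x m → proj₁ (proj₁ (f x) m) , below x m) (λ x y p m m′ → proj₂ (proj₁ (f y) m′) x p m)
         λ (y , y∈A , k≼y , g) → k≼y (below y (proj₂ (f y) (y∈A , λ x _ m → g x m)))) ,
    (λ x m → proj₁ (proj₁ (f x) m)) , (λ x y p m m′ → proj₂ (proj₁ (f y) m′) x p m))

  -- The maximum is the predecessor of the least strict upper bound.
  maximum : ∀ F k {a} → a ε F → (∀ x → x ε F → x ≺ k) → ∃ᴷ λ m → m ε F × (∀ x → x ε F → x ≼ m)
  maximum F k {a} a∈F bd = least φ {k} (λ x _ → bd x) >>= λ (j , f , min) → 0-or-suc j >>=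
    [ (λ e _ → ≺0 (≺-resp ≋-refl e (f a (bd a a∈F) a∈F)))
    , (λ (c , e) → em {c ε F} >>=
        [ (λ p → return (c , p , λ x q → ≺suc⇒≼ (≺-resp ≋-refl e (f x (bd x q) q))))
        , (λ ¬p _ → min c (≺-resp ≋-refl (≋-sym e) n≺n+1) λ x x≺k q →
            ≺-stable λ k → ≺-suc⁻ (≺-resp ≋-refl e (f x x≺k q)) [ k , (λ g → ¬p (ε-resp g q)) ]) ]) ]
    where
    φ : BF 1
    φ = ∀< (con k) (v₀ ∈ F ⇒ v₀ < v₁)

  -- By transitivity only the largest element of `F` has to be related to the new one.
  transitive-extendible : ∀ A Q → Unbounded A →
    (∀ x y z → x ε A → y ε A → z ε A → x ≺ y → y ≺ z → ⟨ x , y ⟩ ε Q → ⟨ y , z ⟩ ε Q → ⟨ x , z ⟩ ε Q) →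
    (∀ x → x ε A → ∀ k → ∃ᴷ λ y → y ε A × k ≼ y × ⟨ x , y ⟩ ε Q) → Extendible A Q
  transitive-extendible A Q unb tr one F k bd hom = em {Σ N (_ε F)} >>=
    [ (λ (a , a∈F) → maximum F k a∈F (λ x p → proj₂ (bd x p)) >>= λ (m , m∈F , max) →
        one m (proj₁ (bd m m∈F)) k >>= λ (y , y∈A , k≼y , q) → return (y , y∈A , k≼y , λ x x∈F →
          ε-stable (≼-≺-or-≋ (max x x∈F) >>=
            [ (λ p → return (tr x m y (proj₁ (bd x x∈F)) (proj₁ (bd m m∈F)) y∈A p (≺-≼-trans (proj₂ (bd m m∈F)) k≼y) (hom x m p x∈F m∈F) q))
            , (λ e → return (ε-resp (⟨⟩-cong (≋-sym e) ≋-refl) q)) ])))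
    , (λ ¬a → unb k >>= λ (y , y∈A , k≼y) → return (y , y∈A , k≼y , λ x x∈F → ε-stable λ _ → ¬a (x , x∈F))) ]

  finite-minimum : ∀ X R w → (∀ x y z → ⟨ x , y ⟩ ε R → ⟨ y , z ⟩ ε R → ⟨ x , z ⟩ ε R) → (∀ x → ⟨ x , x ⟩ ε R → B) →
    ∀ {a} → a ε X → a ≺ w → ∃ᴷ λ y → y ε X × (∀ x → x ≺ w → x ε X → ⟨ x , y ⟩ ε R → B)
  finite-minimum X R w tr irr {a} a∈X a≺w = Δ₀-induction φ (λ _ p _ _ → ≺0 p) step w a a≺w a∈X >>= λ (y , _ , p , f) → return (y , p , f)
    where
    φ : BF 1
    φ = ∀< v₀ (v₀ ∈ X ⇒ ∃< v₁ (v₀ ∈ X ∧ᵇ ∀< v₂ (v₀ ∈ X ⇒ ⟪ v₀ , v₁ ⟫ᵇ ∈ R ⇒ ⊥)))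
    step : ∀ w → ⟦ φ ⟧ᵇ (w ∷ []) → ⟦ φ ⟧ᵇ (w + 1# ∷ [])
    step w f a a≺ a∈X = em {w ε X} >>=
      [ (λ w∈X → em {Σ N λ c → c ≺ w × c ε X} >>=
          [ (λ (c , c≺w , c∈X) → f c c≺w c∈X >>= λ (y , y≺w , y∈X , min) → em {⟨ w , y ⟩ ε R} >>=
              [ (λ wRy → return (w , n≺n+1 , w∈X , λ x p q r → ≺-suc⁻ p
                  [ (λ x≺w → min x x≺w q (tr x w y r wRy)) , (λ e → irr w (ε-resp (⟨⟩-cong e ≋-refl) r)) ]))
              , (λ ¬wRy → return (y , ≺-step y≺w , y∈X , λ x p q r → ≺-suc⁻ p
                  [ (λ x≺w → min x x≺w q r) , (λ e → ¬wRy (ε-resp (⟨⟩-cong e ≋-refl) r)) ])) ])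
          , (λ ¬c → return (w , n≺n+1 , w∈X , λ x p q r → ≺-suc⁻ p
              [ (λ x≺w → ¬c (x , x≺w , q)) , (λ e → irr w (ε-resp (⟨⟩-cong e ≋-refl) r)) ])) ])
      , (λ w∉X → ≺-suc⁻ a≺ >>=
          [ (λ a≺w → f a a≺w a∈X >>= λ (y , y≺w , y∈X , min) → return (y , ≺-step y≺w , y∈X , λ x p q r → ≺-suc⁻ p
              [ (λ x≺w → min x x≺w q r) , (λ e → w∉X (ε-resp e q)) ]))
          , (λ e _ → w∉X (ε-resp e a∈X)) ]) ]

  -- Literals

  lit : Bool → Set → Set
  lit true  A = A
  lit false A = A → B

  litᵇ : ∀ {k} → Bool → BF k → BF k
  litᵇ true  φ = φ
  litᵇ false φ = φ ⇒ ⊥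

  litᵇ-lit : ∀ {k} b (φ : BF k) {ξ} → Iff (⟦ litᵇ b φ ⟧ᵇ ξ) (lit b (⟦ φ ⟧ᵇ ξ))
  litᵇ-lit true  φ = id , id
  litᵇ-lit false φ = id , id

  lit-Iff : ∀ b {A C} → Iff A C → lit b A → lit b C
  lit-Iff true  (f , _) p = f p
  lit-Iff false (_ , g) p = p ∘ g

  lit-stable : ∀ b {A} → (K A → A) → K (lit b A) → lit b A
  lit-stable true  s k = s k
  lit-stable false s k = λ a → k λ f → f a

  lit-em : ∀ {A} → K (Σ Bool λ b → lit b A)
  lit-em = em >>= [ (λ a → return (true , a)) , (λ ¬a → return (false , ¬a)) ]

  lit-clash : ∀ b {A} → lit b A → lit (not b) A → B
  lit-clash true  p q = q p
  lit-clash false p q = p q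

  -- The lexicographic order

  module Lexicographic (E : S) where

    -- Comparing the characteristic functions of the neighbourhoods of x and y below n.
    Lexᵇ : BF 3
    Lexᵇ = ∃< v₀ ((∀< v₀ ((⟪ v₃ , v₀ ⟫ᵇ ∈ E ⇒ ⟪ v₄ , v₀ ⟫ᵇ ∈ E) ∧ᵇ (⟪ v₄ , v₀ ⟫ᵇ ∈ E ⇒ ⟪ v₃ , v₀ ⟫ᵇ ∈ E)))
               ∧ᵇ (⟪ v₂ , v₀ ⟫ᵇ ∈ E ⇒ ⊥) ∧ᵇ ⟪ v₃ , v₀ ⟫ᵇ ∈ E)

    Lex : N → N → N → Set
    Lex n x y = ⟦ Lexᵇ ⟧ᵇ (n ∷ x ∷ y ∷ [])

    Agree-≼ : ∀ {m n x y} → m ≼ n → Agree E n x y → Agree E m x y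
    Agree-≼ le f i p = f i (≺-≼-trans p le)

    Agree-sym : ∀ {n x y} → Agree E n x y → Agree E n y x
    Agree-sym f i p = proj₂ (f i p) , proj₁ (f i p)

    Agree-trans : ∀ {n x y z} → Agree E n x y → Agree E n y z → Agree E n x z
    Agree-trans f g i p = Iff-trans (f i p) (g i p)

    Lex-≼ : ∀ {m n x y} → m ≼ n → Lex m x y → Lex n x y
    Lex-≼ le h = h >>= λ (z , p , q) → return (z , ≺-≼-trans p le , q)

    Lex-resp : ∀ {n x y x′ y′} → Agree E n x x′ → Agree E n y y′ → Lex n x y → Lex n x′ y′
    Lex-resp f g h = h >>= λ (z , p , a , ¬x , y) → return (z , p ,
      Agree-trans (Agree-sym (Agree-≼ (≺⇒≼ p) f)) (Agree-trans a (Agree-≼ (≺⇒≼ p) g)) ,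
      (λ q → ¬x (proj₂ (f z p) q)) , proj₁ (g z p) y)

    Lex-asym : ∀ {m n x y} → Lex m x y → Lex n y x → B
    Lex-asym h h′ = h λ (z , _ , a , ¬x , y) → h′ λ (z′ , _ , a′ , ¬y , x) → ≺-cmp z z′
      [ (λ p → ¬x (proj₁ (a′ z p) y))
      , [ (λ e → ¬x (ε-resp (⟨⟩-cong ≋-refl (≋-sym e)) x)) , (λ p → ¬y (proj₁ (a z′ p) x)) ] ]

    least-difference : ∀ {n x y} → (Agree E n x y → B) →
      ∃ᴷ λ z → z ≺ n × Agree E z x y × (Iff (⟨ x , z ⟩ ε E) (⟨ y , z ⟩ ε E) → B)
    least-difference {n} {x} {y} d k = d λ i p → same λ e → least (φ ⇒ ⊥) e λ (z , e′ , min) →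
      k (z , ≼-≺-trans (λ q → min i q e) p , (λ w q → same (min w q)) , e′)
      where
      φ : BF 1
      φ = (⟪ con x , v₀ ⟫ᵇ ∈ E ⇒ ⟪ con y , v₀ ⟫ᵇ ∈ E) ∧ᵇ (⟪ con y , v₀ ⟫ᵇ ∈ E ⇒ ⟪ con x , v₀ ⟫ᵇ ∈ E)
      same : ∀ {i} → ((Iff (⟨ x , i ⟩ ε E) (⟨ y , i ⟩ ε E) → B) → B) → Iff (⟨ x , i ⟩ ε E) (⟨ y , i ⟩ ε E)
      same {i} = stableᵇ φ (i ∷ [])

    order-at : ∀ {x y z} → (Iff (⟨ x , z ⟩ ε E) (⟨ y , z ⟩ ε E) → B) →
      K (((⟨ x , z ⟩ ε E → B) × ⟨ y , z ⟩ ε E) ⊎ (⟨ x , z ⟩ ε E × (⟨ y , z ⟩ ε E → B)))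
    order-at {x} {y} {z} d = em {⟨ x , z ⟩ ε E} >>=
      [ (λ p → return (inj₂ (p , λ q → d ((λ _ → q) , λ _ → p))))
      , (λ ¬p → em {⟨ y , z ⟩ ε E} >>= [ (λ q → return (inj₁ (¬p , q)))
                                       , (λ ¬q _ → d ((λ p → ε-stable λ _ → ¬p p) , λ q → ε-stable λ _ → ¬q q)) ]) ]

    Lex-total : ∀ {n x y} → (Agree E n x y → B) → K (Lex n x y ⊎ Lex n y x)
    Lex-total d = least-difference d >>= λ (z , p , a , e) → order-at e >>=
      [ (λ (¬x , y) → return (inj₁ (return (z , p , a , ¬x , y))))
      , (λ (x , ¬y) → return (inj₂ (return (z , p , Agree-sym a , ¬y , x)))) ]

    -- If u agrees with x below the position z that separates x from y, its own adjacency to z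
    -- decides; otherwise the first difference between u and x does. This one fact yields
    -- transitivity of the order and of its negation.
    Lex-cotrans : ∀ {n x y} → Lex n x y → ∀ u → K (Lex n x u ⊎ Lex n u y)
    Lex-cotrans {n} {x} {y} h u = h >>= λ (z , p , a , ¬x , y∼z) → em {Agree E z x u} >>=
      [ (λ a′ → em {⟨ u , z ⟩ ε E} >>=
          [ (λ u∼z → return (inj₁ (return (z , p , a′ , ¬x , u∼z))))
          , (λ ¬u → return (inj₂ (return (z , p , Agree-trans (Agree-sym a′) a , ¬u , y∼z)))) ])
      , (λ d → least-difference d >>= λ (z′ , q , a′ , e) → order-at e >>=
          [ (λ (¬x , u∼z′) → return (inj₁ (return (z′ , ≺-trans q p , a′ , ¬x , u∼z′))))
          , (λ (x∼z′ , ¬u) → return (inj₂ (return (z′ , ≺-trans q p ,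
              Agree-trans (Agree-sym a′) (Agree-≼ (≺⇒≼ q) a) , ¬u , proj₁ (a z′ q) x∼z′)))) ]) ]

    -- Here x is meant to be the smaller vertex. Stopping at x makes the relation bounded and hence
    -- available to colorings; ties below x count as not left.
    Left : N → N → Set
    Left x y = Lex x x y

    -- Because of ties the negative case is not the mirror image of the positive one: there
    -- `Left x z` is split by cotransitivity at y, and a difference below x is also one below y.
    Left-trans : ∀ b {x y z} → x ≺ y → lit b (Left x y) → lit b (Left y z) → lit b (Left x z)
    Left-trans true p f g = Lex-cotrans f _ >>= [ return , (λ h _ → Lex-asym g h) ] >>= id
    Left-trans false p f g h = Lex-cotrans h _ [ f , (λ h′ → g (Lex-≼ (≺⇒≼ p) h′)) ]

    Left-set : ∀ b → K (Σ S λ Q → ∀ x y → Iff (⟨ x , y ⟩ ε Q) (lit b (Left x y)))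
    Left-set b = Δ₀-comprehension² (litᵇ b (call Lexᵇ (v₀ ∷ v₀ ∷ v₁ ∷ []))) >>= λ (Q , f) →
      return (Q , λ x y → Iff-trans (f x y) (litᵇ-lit b (call Lexᵇ (v₀ ∷ v₀ ∷ v₁ ∷ []))))

    monotone-subset : ∀ b A → Unbounded A → (∀ x → x ε A → ∀ k → ∃ᴷ λ y → y ε A × k ≼ y × lit b (Left x y)) →
      K (Σ S λ H → Unbounded H × (∀ x → x ε H → x ε A) × (∀ x y → x ≺ y → x ε H → y ε H → lit b (Left x y)))
    monotone-subset b A unb one = Left-set b >>= λ (Q , f) →
      greedy-unbounded A Q (transitive-extendible A Q unb
        (λ x y z _ _ _ p _ q r → proj₂ (f x z) (Left-trans b p (proj₁ (f x y) q) (proj₁ (f y z) r)))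
        (λ x x∈A k → one x x∈A k >>= λ (y , y∈A , k≼y , l) → return (y , y∈A , k≼y , proj₂ (f x y) l)))
      >>= λ (H , u , sub , hom) → return (H , u , sub , λ x y p m m′ → proj₁ (f x y) (hom x y p m m′))

  -- The induced subgraph of E on V is a Rado graph.
  record Rado (V E : S) : Set where
    field
      irreflexive : ∀ {x} → ⟨ x , x ⟩ ε E → B
      symmetric   : ∀ {x y} → ⟨ x , y ⟩ ε E → ⟨ y , x ⟩ ε E
      extension   : ∀ F₀ F₁ k → (∀ x → x ε F₀ → x ε V × x ≺ k) → (∀ x → x ε F₁ → x ε V × x ≺ k) →
                    (∀ x → x ε F₀ → x ε F₁ → B) →
                    ∃ᴷ λ y → y ε V × (∀ x → x ε F₀ → ⟨ y , x ⟩ ε E) × (∀ x → x ε F₁ → ⟨ y , x ⟩ ε E → B)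

  -- Combinatorics of Rado graphs

  module RadoProperties {V E : S} (R : Rado V E) where
    open Rado R
    open Lexicographic E

    -- A vertex y not adjacent to some u which is adjacent to all vertices below k
    -- is itself not below k.
    extension⁺ : ∀ F₀ F₁ k → (∀ x → x ε F₀ → x ε V × x ≺ k) → (∀ x → x ε F₁ → x ε V × x ≺ k) →
                 (∀ x → x ε F₀ → x ε F₁ → B) →
                 ∃ᴷ λ y → y ε V × k ≼ y × (∀ x → x ε F₀ → ⟨ y , x ⟩ ε E) × (∀ x → x ε F₁ → ⟨ y , x ⟩ ε E → B)
    extension⁺ F₀ F₁ k p₀ p₁ dis =
      Δ₀-comprehension (v₀ ∈ V ∧ᵇ v₀ < con k) >>= λ (G , g) →
      Δ₀-comprehension ⊥ >>= λ (∅ , e) →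
      extension G ∅ k (λ x m → proj₁ (g x) m) (λ x m → (ε-stable λ _ → proj₁ (e x) m) , ≺-stable λ _ → proj₁ (e x) m)
        (λ x _ m → proj₁ (e x) m) >>= λ (u , u∈V , u∼G , _) →
      Δ₀-comprehension (v₀ ∈ F₁ ∨ᵇ v₀ ≈ con u) >>= λ (F , f) →
      extension F₀ F (k + u + 1#)
        (λ x m → proj₁ (p₀ x m) , ≺-trans (≺-≼-trans (proj₂ (p₀ x m)) (m≼m+n u)) n≺n+1)
        (λ x m → ε-stable (proj₁ (f x) m >>= [ (λ q → return (proj₁ (p₁ x q))) , (λ q → return (ε-resp (≋-sym q) u∈V)) ]) ,
                 ≺-stable (proj₁ (f x) m >>= [ (λ q → return (≺-trans (≺-≼-trans (proj₂ (p₁ x q)) (m≼m+n u)) n≺n+1))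
                                             , (λ q → return (≺-resp (≋-sym q) ≋-refl (≼⇒≺suc (n≼m+n k)))) ]))
        (λ x m m′ → proj₁ (f x) m′ [ dis x m , (λ q → irreflexive (ε-resp (⟨⟩-cong ≋-refl q) (u∼G x (proj₂ (g x) (p₀ x m))))) ])
      >>= λ (y , y∈V , y∼F₀ , y≁F) → return (y , y∈V ,
        (λ y≺k → y≁F u (proj₂ (f u) (return (inj₂ ≋-refl))) (symmetric (u∼G y (proj₂ (g y) (y∈V , y≺k))))) ,
        y∼F₀ , λ x m → y≁F x (proj₂ (f x) (return (inj₁ m))))

    unbounded : Unbounded V
    unbounded k = Δ₀-comprehension ⊥ >>= λ (∅ , e) →
      let none = λ x m → (ε-stable λ _ → proj₁ (e x) m) , ≺-stable λ _ → proj₁ (e x) m in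
      extension⁺ ∅ ∅ k none none (λ x _ m → proj₁ (e x) m) >>= λ (y , y∈V , k≼y , _) → return (y , y∈V , k≼y)

    two-point : ∀ b c {x y} → x ε V → y ε V → x ≺ y → ∀ k →
                ∃ᴷ λ z → z ε V × k ≼ z × lit b (⟨ z , x ⟩ ε E) × lit c (⟨ z , y ⟩ ε E)
    two-point b c {x} {y} x∈V y∈V x≺y k =
      Δ₀-comprehension (call (sel b x ∨ᵇ sel c y) (v₀ ∷ [])) >>= λ (F₀ , f₀) →
      Δ₀-comprehension (call (sel (not b) x ∨ᵇ sel (not c) y) (v₀ ∷ [])) >>= λ (F₁ , f₁) →
      extension⁺ F₀ F₁ (k + y + 1#) (λ a m → inV b c a (proj₁ (f₀ a) m)) (λ a m → inV (not b) (not c) a (proj₁ (f₁ a) m))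
        (λ a m m′ → proj₁ (f₀ a) m λ p → proj₁ (f₁ a) m′ λ q → disjoint b c a p q)
      >>= λ (z , z∈V , le , p₀ , p₁) → return (z , z∈V , ≼-trans (≼-trans (m≼m+n y) (m≼m+n 1#)) le ,
        get b (λ e → p₀ x (proj₂ (f₀ x) (return (inj₁ (sel⁺ b e ≋-refl))))) (λ e → p₁ x (proj₂ (f₁ x) (return (inj₁ (sel⁺ (not b) e ≋-refl))))) ,
        get c (λ e → p₀ y (proj₂ (f₀ y) (return (inj₂ (sel⁺ c e ≋-refl))))) (λ e → p₁ y (proj₂ (f₁ y) (return (inj₂ (sel⁺ (not c) e ≋-refl))))))
      where
      sel : Bool → N → BF 1
      sel true  a = v₀ ≈ con a
      sel false a = ⊥
      sel⁺ : ∀ b {a d} → b ≡ true → d ≋ a → ⟦ sel b a ⟧ᵇ (d ∷ [])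
      sel⁺ true _ e = e
      sel⁻ : ∀ b {a d} → ⟦ sel b a ⟧ᵇ (d ∷ []) → d ≋ a
      sel⁻ true  e = e
      sel⁻ false e = ≋-stable λ _ → e
      sel-not : ∀ b {a d} → ⟦ sel b a ⟧ᵇ (d ∷ []) → ⟦ sel (not b) a ⟧ᵇ (d ∷ []) → B
      sel-not true  _ f = f
      sel-not false f _ = f
      get : ∀ b {A} → (b ≡ true → A) → (not b ≡ true → A → B) → lit b A
      get true  f g = f refl
      get false f g = g refl
      x≢y : ∀ {a} → a ≋ x → a ≋ y → B
      x≢y e f = ≺-irrefl (≺-resp (≋-trans (≋-sym e) f) ≋-refl x≺y)
      inV : ∀ b c a → K (⟦ sel b x ⟧ᵇ (a ∷ []) ⊎ ⟦ sel c y ⟧ᵇ (a ∷ [])) → a ε V × a ≺ k + y + 1#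
      inV b c a h =
        ε-stable (h >>= [ (λ p → return (ε-resp (≋-sym (sel⁻ b p)) x∈V)) , (λ p → return (ε-resp (≋-sym (sel⁻ c p)) y∈V)) ]) ,
        ≺-stable (h >>= [ (λ p → return (≺-resp (≋-sym (sel⁻ b p)) ≋-refl (≺-trans (≺-≼-trans x≺y (n≼m+n k)) n≺n+1)))
                        , (λ p → return (≺-resp (≋-sym (sel⁻ c p)) ≋-refl (≼⇒≺suc (n≼m+n k)))) ])
      disjoint : ∀ b c a → ⟦ sel b x ⟧ᵇ (a ∷ []) ⊎ ⟦ sel c y ⟧ᵇ (a ∷ []) →
                 ⟦ sel (not b) x ⟧ᵇ (a ∷ []) ⊎ ⟦ sel (not c) y ⟧ᵇ (a ∷ []) → B
      disjoint b c a (inj₁ p) (inj₁ q) = sel-not b p q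
      disjoint b c a (inj₁ p) (inj₂ q) = x≢y (sel⁻ b p) (sel⁻ (not c) q)
      disjoint b c a (inj₂ p) (inj₁ q) = x≢y (sel⁻ (not b) q) (sel⁻ c p)
      disjoint b c a (inj₂ p) (inj₂ q) = sel-not c p q

    homogeneous-subset : ∀ b → K (Σ S λ H → Unbounded H × (∀ x → x ε H → x ε V) ×
                                    (∀ x y → x ≺ y → x ε H → y ε H → lit b (⟨ x , y ⟩ ε E)))
    homogeneous-subset b = Δ₀-comprehension² (litᵇ b (⟪ v₀ , v₁ ⟫ᵇ ∈ E)) >>= λ (Q , f) →
      Δ₀-comprehension ⊥ >>= λ (∅ , e) →
      greedy-unbounded V Q (λ F k bd hom → extend b F ∅ k bd (λ x → proj₁ (e x)) >>= λ (y , y∈V , k≼y , g) →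
        return (y , y∈V , k≼y , λ x m → proj₂ (f x y) (proj₂ (litᵇ-lit b (⟪ v₀ , v₁ ⟫ᵇ ∈ E)) (g x m))))
      >>= λ (H , u , sub , hom) → return (H , u , sub , λ x y p m m′ →
        proj₁ (litᵇ-lit b (⟪ v₀ , v₁ ⟫ᵇ ∈ E)) (proj₁ (f x y) (hom x y p m m′)))
      where
      extend : ∀ b F ∅ k → (∀ x → x ε F → x ε V × x ≺ k) → (∀ x → x ε ∅ → B) →
               ∃ᴷ λ y → y ε V × k ≼ y × (∀ x → x ε F → lit b (⟨ x , y ⟩ ε E))
      extend true F ∅ k bd e =
        extension⁺ F ∅ k bd (λ x m → (ε-stable λ _ → e x m) , ≺-stable λ _ → e x m) (λ x _ m → e x m) >>=
        λ (y , y∈V , k≼y , g , _) → return (y , y∈V , k≼y , λ x m → symmetric (g x m))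
      extend false F ∅ k bd e =
        extension⁺ ∅ F k (λ x m → (ε-stable λ _ → e x m) , ≺-stable λ _ → e x m) bd (λ x m _ → e x m) >>=
        λ (y , y∈V , k≼y , _ , g) → return (y , y∈V , k≼y , λ x m p → g x m (symmetric p))

    -- All four types occur: take y whose pattern below x₁ + 1 is lexicographically
    -- extremal and then z to be a later vertex which differs from y at x₁.
    types-occur : ∀ b c → K (Σ N λ x → Σ N λ y → x ε V × y ε V × x ≺ y × lit b (⟨ x , y ⟩ ε E) × lit c (Left x y))
    types-occur b c =
      unbounded 0# >>= λ (x₁ , x₁∈V , _) →
      let n = x₁ + 1# in
      Δ₀-comprehension (v₀ ∈ V ∧ᵇ con x₁ < v₀) >>= λ (X , f) →
      Δ₀-comprehension² (orient c (con n)) >>= λ (R , r) →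
      representatives E X n >>= λ (w , rep) →
      unbounded n >>= λ (a , a∈V , n≼a) →
      rep a (proj₂ (f a) (a∈V , suc≼⇒≺ n≼a)) >>= λ (a′ , a′≺w , a′∈X , _) →
      finite-minimum X R w
        (λ x y z p q → proj₂ (r x z) (orient-trans c n (proj₁ (r x y) p) (proj₁ (r y z) q)))
        (λ x p → orient-irrefl c n (proj₁ (r x x) p)) a′∈X a′≺w >>= λ (y , y∈X , min) →
      let y∈V , x₁≺y = proj₁ (f y) y∈X in
      -- Giving z the other adjacency to x₁ excludes a tie below n, while its adjacency to y can
      -- still be prescribed.
      lit-em {⟨ y , x₁ ⟩ ε E} >>= λ (d , y-x₁) →
      two-point (not d) b x₁∈V y∈V x₁≺y (y + 1#) >>= λ (z , z∈V , y<z , z-x₁ , z-y) →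
      let y≺z = suc≼⇒≺ y<z
          z∈X = proj₂ (f z) (z∈V , ≺-trans x₁≺y y≺z)
          differ : Agree E n y z → B
          differ g = lit-clash d (lit-Iff d (g x₁ n≺n+1) y-x₁) z-x₁
          -- `y` is extremal only among the elements below w, so z is replaced by a representative
          -- below w with the same pattern.
          ¬zRy : ⟦ orient c (con n) ⟧ᵇ (z ∷ y ∷ []) → B
          ¬zRy p = rep z z∈X λ (z′ , z′≺w , z′∈X , g) →
            min z′ z′≺w z′∈X (proj₂ (r z′ y) (orient-resp c n g p))
      in Lex-total differ >>= λ l →
         return (y , z , y∈V , z∈V , y≺z , lit-Iff b (symmetric , symmetric) z-y , decide c n (≺⇒suc≼ x₁≺y) ¬zRy l)
      where
      orient : Bool → Tmᵇ 2 → BF 2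
      orient true  n = call Lexᵇ (n ∷ v₀ ∷ v₁ ∷ [])
      orient false n = call Lexᵇ (n ∷ v₁ ∷ v₀ ∷ [])
      Lex-trans : ∀ n {x y z} → Lex n x y → Lex n y z → Lex n x z
      Lex-trans n p q = Lex-cotrans p _ >>= [ return , (λ h _ → Lex-asym q h) ] >>= id
      orient-trans : ∀ c n {x y z} → ⟦ orient c (con n) ⟧ᵇ (x ∷ y ∷ []) → ⟦ orient c (con n) ⟧ᵇ (y ∷ z ∷ []) →
                     ⟦ orient c (con n) ⟧ᵇ (x ∷ z ∷ [])
      orient-trans true  n p q = Lex-trans n p q
      orient-trans false n p q = Lex-trans n q p
      orient-irrefl : ∀ c n {x} → ⟦ orient c (con n) ⟧ᵇ (x ∷ x ∷ []) → B
      orient-irrefl true  n p = Lex-asym p p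
      orient-irrefl false n p = Lex-asym p p
      orient-resp : ∀ c n {x x′ y} → Agree E n x x′ → ⟦ orient c (con n) ⟧ᵇ (x ∷ y ∷ []) → ⟦ orient c (con n) ⟧ᵇ (x′ ∷ y ∷ [])
      orient-resp true  n g = Lex-resp g (λ _ _ → id , id)
      orient-resp false n g = Lex-resp (λ _ _ → id , id) g
      decide : ∀ c n {y z} → n ≼ y → (⟦ orient c (con n) ⟧ᵇ (z ∷ y ∷ []) → B) → Lex n y z ⊎ Lex n z y → lit c (Left y z)
      decide true  n le ¬r (inj₁ p) = Lex-≼ le p
      decide true  n le ¬r (inj₂ p) = λ _ → ¬r p
      decide false n le ¬r (inj₁ p) = λ _ → ¬r p
      decide false n le ¬r (inj₂ p) = λ q → Lex-asym p q

  -- Colorings determined by the type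

  lit-unique : ∀ b c {A} → lit b A → lit c A → K (b ≡ c)
  lit-unique true  true  p q = return refl
  lit-unique false false p q = return refl
  lit-unique true  false p q = λ _ → q p
  lit-unique false true  p q = λ _ → p q

  xor-solve : ∀ l d b → l xor d ≡ b → l ≡ b xor d
  xor-solve true  true  false refl = refl
  xor-solve true  false true  refl = refl
  xor-solve false true  true  refl = refl
  xor-solve false false false refl = refl

  -- P is regarded as a coloring of pairs x < y with two colors.

  StableSet : S → Set
  StableSet P = ∀ x → K (Σ Bool λ b → Σ N λ s → ∀ y → s ≼ y → x ≺ y → lit b (⟨ x , y ⟩ ε P))

  HomogeneousSet : S → Set
  HomogeneousSet P = Σ S λ H → Unbounded H × (Σ Bool λ c → ∀ x y → x ≺ y → x ε H → y ε H → lit c (⟨ x , y ⟩ ε P))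

  module _ (E : S) where
    open Lexicographic E

    record Canonical (P : S) : Set where
      field
        V     : S
        rado  : Rado V E
        color : Bool → Bool → Bool
        typed : ∀ b l {x y} → x ≺ y → x ε V → y ε V → lit b (⟨ x , y ⟩ ε E) → lit l (Left x y) →
                lit (color b l) (⟨ x , y ⟩ ε P)

    -- `d` tells whether the color is the order (`false`) or its complement (`true`).
    record LexColored (P : S) : Set where
      field
        V    : S
        rado : Rado V E
        d    : Bool
        lex  : ∀ {x y} → x ≺ y → x ε V → y ε V → ∀ l → lit l (Left x y) → lit (l xor d) (⟨ x , y ⟩ ε P)

      lex⁻¹ : ∀ {x y} → x ≺ y → x ε V → y ε V → ∀ b → lit b (⟨ x , y ⟩ ε P) → lit (b xor d) (Left x y)
      lex⁻¹ {x} {y} p x∈V y∈V b q = lit-stable (b xor d) (stableᵇ Lexᵇ (x ∷ x ∷ y ∷ [])) (lit-em >>= λ (l , r) →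
        lit-unique (l xor d) b (lex p x∈V y∈V l r) q >>= λ e → return (subst (λ c → lit c _) (xor-solve l d b e) r))

    module _ {P : S} (stb : StableSet P) (can : Canonical P) where
      open Canonical can
      open RadoProperties rado

      uniform : ∀ b → color b true ≡ color b false → K (HomogeneousSet P)
      uniform b e = homogeneous-subset b >>= λ (H , unb , sub , hom) → return (H , unb , color b true ,
        λ x y p m m′ → lit-stable (color b true) ε-stable (lit-em {Left x y} >>= λ (l , q) →
          return (subst (λ c → lit c _) (same l) (typed b l p (sub x m) (sub y m′) (hom x y p m m′) q))))
        where
        same : ∀ l → color b l ≡ color b true
        same true  = refl
        same false = sym e

      -- If the color were the parity of the type then, for fixed x₁ < x₂ and large z,
      -- the four adjacency patterns of z would realise all combinations of
      -- Left x₁ z and Left x₂ z, against transitivity.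
      not-parity : (∀ b l → color b (not l) ≡ not (color b l)) → (∀ l → color false l ≡ not (color true l)) → B
      not-parity e f =
        unbounded 0# λ (x₁ , x₁∈V , _) → unbounded (x₁ + 1#) λ (x₂ , x₂∈V , x₁<x₂) →
        stb x₁ λ (d₁ , s₁ , g₁) → stb x₂ λ (d₂ , s₂ , g₂) →
        let x₁≺x₂ = suc≼⇒≺ x₁<x₂ in lit-em {Left x₁ x₂} λ (l , p) →
        -- With `l` the status of `Left x₁ x₂`, the adjacencies of z are chosen so that the limit
        -- colors force `Left x₂ z` to have status `l` and `Left x₁ z` status `not l`.
        let b₁ , h₁ = pick (not l) d₁
            b₂ , h₂ = pick l d₂ in
        two-point b₁ b₂ x₁∈V x₂∈V x₁≺x₂ (s₁ + s₂ + (x₂ + 1#)) λ (z , z∈V , le , q₁ , q₂) →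
        let x₂≺z = suc≼⇒≺ (≼-trans (n≼m+n (s₁ + s₂)) le)
            x₁≺z = ≺-trans x₁≺x₂ x₂≺z
            r₁ = g₁ z (≼-trans (m≼m+n s₂) (≼-trans (m≼m+n _) le)) x₁≺z
            r₂ = g₂ z (≼-trans (n≼m+n s₁) (≼-trans (m≼m+n _) le)) x₂≺z
        in forced b₁ (not l) d₁ h₁ x₁≺z x₁∈V z∈V q₁ r₁ λ u₁ →
           forced b₂ l d₂ h₂ x₂≺z x₂∈V z∈V q₂ r₂ λ u₂ →
           lit-clash l (Left-trans l x₁≺x₂ p u₂) u₁
        where
        pick : ∀ l d → Σ Bool λ b → color b l ≡ d
        pick l d with color true l ≟ d
        ... | yes h = true , h
        ... | no h  = false , trans (f l) (trans (cong not (¬-not h)) (not-involutive d))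
        forced : ∀ b l d → color b l ≡ d → ∀ {x z} → x ≺ z → x ε V → z ε V → lit b (⟨ z , x ⟩ ε E) →
                 lit d (⟨ x , z ⟩ ε P) → K (lit l (Left x z))
        forced b l d refl {x} {z} p x∈V z∈V q r = lit-em {Left x z} >>= λ (l′ , u) →
          lit-unique _ _ (typed b l′ p x∈V z∈V (lit-Iff b (Rado.symmetric rado , Rado.symmetric rado) q) u) r >>= λ h →
          return (subst (λ c → lit c (Left x z)) (same l′ l h) u)
          where
          same : ∀ l′ l → color b l′ ≡ color b l → l′ ≡ l
          same true  true  _ = refl
          same false false _ = refl
          same true  false h = ⊥-elim (not-¬ (sym h) (e b true))
          same false true  h = ⊥-elim (not-¬ h (e b true))

      cases : K (HomogeneousSet P ⊎ LexColored P)
      cases with color true true ≟ color true false | color false true ≟ color false false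
      ... | yes e | _     = uniform true e >>= λ h → return (inj₁ h)
      ... | no _  | yes e = uniform false e >>= λ h → return (inj₁ h)
      ... | no e  | no e′ with color true true ≟ color false true
      -- The color alternates with the order both on edges and on non-edges. In opposite phase this
      -- is the parity; in equal phase only the order remains.
      ...   | no f  = λ _ → not-parity alternate opposite
        where
        alternate : ∀ b l → color b (not l) ≡ not (color b l)
        alternate true  true  = ¬-not (e ∘ sym)
        alternate true  false = ¬-not e
        alternate false true  = ¬-not (e′ ∘ sym)
        alternate false false = ¬-not e′
        opposite : ∀ l → color false l ≡ not (color true l)
        opposite true  = ¬-not (f ∘ sym)
        opposite false = trans (alternate false true) (cong not (trans (opposite true) (sym (alternate true true))))
      ...   | yes f = return (inj₂ record { V = V ; rado = rado ; d = not (color true true) ; lex = lex })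
        where
        value : ∀ b l → color b l ≡ l xor not (color true true)
        value true  true  = sym (not-involutive _)
        value false true  = trans (sym f) (sym (not-involutive _))
        value true  false = ¬-not (e ∘ sym)
        value false false = trans (¬-not (e′ ∘ sym)) (cong not (sym f))
        lex : ∀ {x y} → x ≺ y → x ε V → y ε V → ∀ l → lit l (Left x y) → lit (l xor not (color true true)) (⟨ x , y ⟩ ε P)
        lex {x} {y} p x∈V y∈V l q = lit-stable (l xor not (color true true)) ε-stable (lit-em {⟨ x , y ⟩ ε E} >>= λ (b , r) →
          return (subst (λ c → lit c _) (value b l) (typed b l p x∈V y∈V r q)))

    lex-homogeneous : ∀ {P} (L : LexColored P) l A → Unbounded A → (∀ x → x ε A → x ε LexColored.V L) →
      (∀ x → x ε A → ∀ k → ∃ᴷ λ y → y ε A × k ≼ y × lit l (Left x y)) → K (HomogeneousSet P)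
    lex-homogeneous L l A unb sub one = monotone-subset l A unb one >>= λ (H , unb′ , sub′ , hom) →
      return (H , unb′ , l xor d , λ x y p m m′ → lex p (sub x (sub′ x m)) (sub y (sub′ y m′)) l (hom x y p m m′))
      where open LexColored L

    module _ (canonical : ∀ P → K (Canonical P)) where

      -- The infinite pigeonhole principle (equivalently BΣ⁰₂) for patterns below n.
      -- Otherwise the coloring P, which tells whether the patterns of the last elements
      -- of X up to x and y agree, is stable with all limits equal, so that the lexicographic
      -- case yields a homogeneous set too; but its elements would have distinct patterns.
      pigeonhole : ∀ G X n → Unbounded X → ∃ᴷ λ y → y ε X × (∀ k → ∃ᴷ λ t → t ε X × k ≼ t × Agree G n y t)
      pigeonhole G X n unb absurd =
        unb 0# λ (m , m∈X , _) →
        -- The vertices of the copy need not lie in `X`, so every number borrows the pattern of an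
        -- element of `X`.
        let module L = Last m m∈X in
        Δ₀-comprehension² L.G′ᵇ λ (G′ , g′) →
        Δ₀-comprehension² (∀< (con n) ((⟪ v₁ , v₀ ⟫ᵇ ∈ G′ ⇒ ⟪ v₂ , v₀ ⟫ᵇ ∈ G′) ∧ᵇ (⟪ v₂ , v₀ ⟫ᵇ ∈ G′ ⇒ ⟪ v₁ , v₀ ⟫ᵇ ∈ G′))) λ (P , p) →
        let row : ∀ {x t} → L.Last x t → ∀ i → Iff (⟨ x , i ⟩ ε G′) (⟨ t , i ⟩ ε G)
            row {x} {t} l i = Iff-trans (g′ x i) (L.row l)
            -- By `absurd` the pattern borrowed by x occurs only boundedly often in `X`, and for
            -- large y the element assigned to y lies beyond that bound.
            limit : ∀ x → ∃ᴷ λ s → ∀ y → s ≼ y → ⟨ x , y ⟩ ε P → B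
            limit x = L.last x >>= λ (t , l) → bounded t (proj₁ l) >>= λ (k , h) → unb k >>= λ (u , u∈X , k≼u) →
              return (u , λ y u≼y q → L.last y λ (w , l′) →
                h w (proj₁ l′) (≼-trans k≼u (L.last-max l′ u∈X u≼y))
                  λ i r → Iff-trans (proj₂ (row l i) , proj₁ (row l i)) (Iff-trans (proj₁ (p x y) q i r) (row l′ i)))
            stb : StableSet P
            stb x = limit x >>= λ (s , h) → return (false , s , λ y le _ → h y le)
            -- Color `true` contradicts the limits. Color `false` contradicts the finiteness of the
            -- number of patterns: an element beyond w shares its pattern with one below w.
            no-homogeneous : HomogeneousSet P → B
            no-homogeneous = λ { (H , unbH , true , hom) → unbH 0# λ (x , x∈H , _) → limit x λ (s , h) →
              unbH (s + (x + 1#)) λ (y , y∈H , le) →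
              h y (≼-trans (m≼m+n _) le) (hom x y (suc≼⇒≺ (≼-trans (n≼m+n s) le)) x∈H y∈H)
                               ; (H , unbH , false , hom) → representatives G′ H n λ (w , rep) → unbH w λ (x , x∈H , w≼x) →
              rep x x∈H λ (y , y≺w , y∈H , agree) →
              hom y x (≺-≼-trans y≺w w≼x) y∈H x∈H (proj₂ (p y x) λ i r → proj₂ (agree i r) , proj₁ (agree i r)) }
        in canonical P λ can → cases stb can
          [ no-homogeneous
          , (λ L → let open LexColored L
                       open RadoProperties rado in
              -- All limits are `false`, and `false xor d` is `d`.
              lex-homogeneous L d V unbounded (λ _ → id)
                (λ x x∈V k → limit x >>= λ (s , h) → unbounded (s + (x + 1# + k)) >>= λ (y , y∈V , le) →
                  let le′ = ≼-trans (n≼m+n s) le in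
                  return (y , y∈V , ≼-trans (n≼m+n _) le′ ,
                    lex⁻¹ (suc≼⇒≺ (≼-trans (m≼m+n k) le′)) x∈V y∈V false (h y (≼-trans (m≼m+n _) le))))
                no-homogeneous) ]
        where
        bounded : ∀ y → y ε X → ∃ᴷ λ k → ∀ t → t ε X → k ≼ t → Agree G n y t → B
        bounded y y∈X ¬k = absurd (y , y∈X , λ k ¬t → ¬k (k , λ t t∈X k≼t a → ¬t (t , t∈X , k≼t , a)))

        -- Last x t: t is the last element of X up to x + m, where m ∈ X ensures existence.
        module Last (m : N) (m∈X : m ε X) where
          Lastᵇ : BF 2
          Lastᵇ = v₁ ∈ X ∧ᵇ v₁ < v₀ ⊕ con (m + 1#) ∧ᵇ ∀< (v₀ ⊕ con (m + 1#)) (v₀ ∈ X ⇒ v₀ < v₂ ⊕ con 1#)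

          Last : N → N → Set
          Last x t = ⟦ Lastᵇ ⟧ᵇ (x ∷ t ∷ [])

          last : ∀ x → ∃ᴷ (Last x)
          last x = Δ₀-comprehension (v₀ ∈ X ∧ᵇ v₀ < con (x + (m + 1#))) >>= λ (F , f) →
            maximum F (x + (m + 1#)) (proj₂ (f m) (m∈X , ≺-≼-trans n≺n+1 (n≼m+n x))) (λ y q → proj₂ (proj₁ (f y) q)) >>= λ (t , t∈F , max) →
            return (t , proj₁ (proj₁ (f t) t∈F) , proj₂ (proj₁ (f t) t∈F) , λ u q u∈X → ≼⇒≺suc (max u (proj₂ (f u) (u∈X , q))))

          last-max : ∀ {x t} → Last x t → ∀ {u} → u ε X → u ≼ x → u ≼ t
          last-max {x} (_ , _ , h) {u} u∈X u≼x = ≺suc⇒≼ (h u (≺-≼-trans (≼-≺-trans u≼x n≺n+1)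
            (+⇒≼ m (solve 2 (λ x m → x :+ (m :+ :con 1) := x :+ :con 1 :+ m) ≋-refl x m))) u∈X)

          G′ᵇ : BF 2
          G′ᵇ = ∃< (v₀ ⊕ con (m + 1#)) (call Lastᵇ (v₁ ∷ v₀ ∷ []) ∧ᵇ ⟪ v₀ , v₂ ⟫ᵇ ∈ G)

          row : ∀ {x t i} → Last x t → Iff (⟦ G′ᵇ ⟧ᵇ (x ∷ i ∷ [])) (⟨ t , i ⟩ ε G)
          row {x} {t} l@(t∈X , t≺ , h) =
            (λ q → ε-stable (q >>= λ (u , u≺ , (u∈X , _ , h′) , r) → return (ε-resp (⟨⟩-cong
              (≼-antisym (≺suc⇒≼ (h u u≺ u∈X)) (≺suc⇒≼ (h′ t t≺ t∈X))) ≋-refl) r))) ,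
            (λ q → return (t , t≺ , l , q))

      -- The vertices sharing a pattern which occurs infinitely often below x₁ + 1 all
      -- have the same limit, as is seen by comparing them with a late vertex u that
      -- differs from them at x₁.
      lex-case : ∀ {P} → StableSet P → LexColored P → K (HomogeneousSet P)
      lex-case {P} stb L =
        unbounded 0# >>= λ (x₁ , x₁∈V , _) →
        let n = x₁ + 1# in
        Δ₀-comprehension (v₀ ∈ V ∧ᵇ con x₁ < v₀) >>= λ (X , f) →
        pigeonhole E X n (λ k → unbounded (n + k) >>= λ (y , y∈V , le) →
          return (y , proj₂ (f y) (y∈V , suc≼⇒≺ (≼-trans (m≼m+n k) le)) , ≼-trans (n≼m+n n) le)) >>= λ (y₀ , y₀∈X , often) →
        Δ₀-comprehension (v₀ ∈ X ∧ᵇ ∀< (con n) ((⟪ con y₀ , v₀ ⟫ᵇ ∈ E ⇒ ⟪ v₁ , v₀ ⟫ᵇ ∈ E) ∧ᵇ (⟪ v₁ , v₀ ⟫ᵇ ∈ E ⇒ ⟪ con y₀ , v₀ ⟫ᵇ ∈ E))) >>= λ (A , g) →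
        stb y₀ >>= λ (b₀ , s₀ , h₀) →
        lit-em {⟨ y₀ , x₁ ⟩ ε E} >>= λ (c , y₀-x₁) →
        let y₀∈V , x₁≺y₀ = proj₁ (f y₀) y₀∈X
            toV : ∀ x → x ε A → x ε V
            toV x m = proj₁ (proj₁ (f x) (proj₁ (proj₁ (g x) m)))
            unbA : Unbounded A
            unbA k = often k >>= λ (t , t∈X , k≼t , a) → return (t , proj₂ (g t) (t∈X , a) , k≼t)
        in lex-homogeneous L (b₀ xor d) A unbA toV λ y y∈A k →
          let y∈V = toV y y∈A
              y∈X , agree = proj₁ (g y) y∈A
              x₁≺y = proj₂ (proj₁ (f y) y∈X) in
          stb y >>= λ (b , s , h) →
          -- `u` differs from `y₀` at x₁, hence also from `y`, and it lies beyond the stages at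
          -- which the colors of both have settled.
          two-point (not c) true x₁∈V y₀∈V x₁≺y₀ (s₀ + s + (y₀ + 1# + (y + 1#))) >>= λ (u , u∈V , le , u-x₁ , _) →
          let y₀≺u = suc≼⇒≺ (≼-trans (m≼m+n (y + 1#)) (≼-trans (n≼m+n (s₀ + s)) le))
              y≺u = suc≼⇒≺ (≼-trans (n≼m+n (y₀ + 1#)) (≼-trans (n≼m+n (s₀ + s)) le))
              differ : Agree E n y₀ u → B
              differ a = lit-clash c (lit-Iff c (a x₁ n≺n+1) y₀-x₁) u-x₁
              differ′ : Agree E n y u → B
              differ′ a = differ (Agree-trans agree a)
              l₀ = lex⁻¹ y₀≺u y₀∈V u∈V b₀ (h₀ u (≼-trans (m≼m+n s) (≼-trans (m≼m+n _) le)) y₀≺u)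
              l  = lex⁻¹ y≺u y∈V u∈V b (h u (≼-trans (n≼m+n s₀) (≼-trans (m≼m+n _) le)) y≺u)
              i₀ = Left-Lex (≺⇒suc≼ x₁≺y₀) differ
              i  = Left-Lex (≺⇒suc≼ x₁≺y) differ′
              -- Since `y₀` and `y` lie beyond x₁ and differ from `u` below n, their positions
              -- relative to `u` are decided below n, where the two have the same pattern.
              i₁ : Iff (Lex n y₀ u) (Lex n y u)
              i₁ = Lex-resp agree (λ _ _ → id , id) , Lex-resp (Agree-sym agree) (λ _ _ → id , id)
          in lit-unique (b xor d) (b₀ xor d) l (lit-Iff (b₀ xor d) (Iff-trans i₀ (Iff-trans i₁ (proj₂ i , proj₁ i))) l₀) >>= λ e →
             unbA (k + s + (y + 1#)) >>= λ (t , t∈A , le′) →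
             let y≺t = suc≼⇒≺ (≼-trans (n≼m+n (k + s)) le′) in
             return (t , t∈A , ≼-trans (m≼m+n s) (≼-trans (m≼m+n _) le′) ,
               subst (λ l → lit l (Left y t)) e
                 (lex⁻¹ y≺t y∈V (toV t t∈A) b (h t (≼-trans (n≼m+n k) (≼-trans (m≼m+n _) le′)) y≺t)))
        where
        open LexColored L
        open RadoProperties rado
        Left-Lex : ∀ {n x u} → n ≼ x → (Agree E n x u → B) → Iff (Left x u) (Lex n x u)
        Left-Lex le differ = (λ p → Lex-total differ >>= [ return , (λ q _ → Lex-asym p q) ] >>= id) , Lex-≼ le

      homogeneous : ∀ {P} → StableSet P → K (HomogeneousSet P)
      homogeneous {P} stb = canonical P >>= cases stb >>= [ return , lex-case stb ]

  -- Finite choice, numerals and codes of pairs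

  K-bool : ∀ {A : Bool → Set} → (∀ b → K (A b)) → K (∀ b → A b)
  K-bool f = f true >>= λ p → f false >>= λ q → return λ { true → p ; false → q }

  K-fin : ∀ {n} {A : Fin n → Set} → (∀ i → K (A i)) → K (∀ i → A i)
  K-fin {zero}  f = return λ ()
  K-fin {suc n} f = f zero >>= λ p → K-fin (f ∘ suc) >>= λ q → return λ { zero → p ; (suc i) → q i }

  numeral : ℕ → N
  numeral zero    = 0#
  numeral (suc k) = numeral k + 1#

  numeral-mono : ∀ {i j} → i ℕ.< j → numeral i ≺ numeral j
  numeral-mono {i} {suc j} (s≤s p) with ℕ.m≤n⇒m<n∨m≡n p
  ... | inj₁ q    = ≺-step (numeral-mono q)
  ... | inj₂ refl = n≺n+1

  numeral-injective : ∀ i j → numeral i ≋ numeral j → K (i ≡ j)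
  numeral-injective i j e with ℕ.<-cmp i j
  ... | tri< p _ _ = λ _ → ≺-irrefl (≺-resp e ≋-refl (numeral-mono p))
  ... | tri≈ _ p _ = return p
  ... | tri> _ _ p = λ _ → ≺-irrefl (≺-resp (≋-sym e) ≋-refl (numeral-mono p))

  Pair : S → N → Set
  Pair V q = ⟦ Pairs ⟦ zero ⟧ x₀ ⟧ᶠ (q ∷ []) (V ∷ [])

  pair⁻ : ∀ {V q} → Pair V q → K (Σ N λ x → Σ N λ y → q ≋ ⟨ x , y ⟩ × x ≺ y × x ε V × y ε V)
  pair⁻ h = unex h >>= λ (x , h) → unex h >>= λ (y , h) → unpair h >>= λ (e , h) → unpair h >>= λ (p , h) →
    unpair h >>= λ (m , m′) → return (x , y , e , p , m , m′)

  pair⁺ : ∀ {V q x y} → q ≋ ⟨ x , y ⟩ → x ≺ y → x ε V → y ε V → Pair V q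
  pair⁺ {x = x} {y} e p m m′ k = k x λ k → k y (pair e (pair p (pair m m′)))

  -- Types of pairs

  Bool³ : Set
  Bool³ = Bool × Bool × Bool

  orᵇ : ∀ {k} → (Bool → BF k) → BF k
  orᵇ f = f true ∨ᵇ f false

  orᵇ⁻ : ∀ {k} (f : Bool → BF k) ξ → ⟦ orᵇ f ⟧ᵇ ξ → K (Σ Bool λ b → ⟦ f b ⟧ᵇ ξ)
  orᵇ⁻ f ξ h = h >>= [ (λ p → return (true , p)) , (λ p → return (false , p)) ]

  orᵇ⁺ : ∀ {k} (f : Bool → BF k) ξ b → ⟦ f b ⟧ᵇ ξ → ⟦ orᵇ f ⟧ᵇ ξ
  orᵇ⁺ f ξ true  p = return (inj₁ p)
  orᵇ⁺ f ξ false p = return (inj₂ p)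

  anyᵇ : ∀ {k} → (Bool³ → BF k) → BF k
  anyᵇ f = orᵇ λ b → orᵇ λ l → orᵇ λ c → f (b , l , c)

  anyᵇ⁻ : ∀ {k} (f : Bool³ → BF k) ξ → ⟦ anyᵇ f ⟧ᵇ ξ → K (Σ Bool³ λ t → ⟦ f t ⟧ᵇ ξ)
  anyᵇ⁻ f ξ h = orᵇ⁻ (λ b → orᵇ λ l → orᵇ λ c → f (b , l , c)) ξ h >>= λ (b , h) →
    orᵇ⁻ (λ l → orᵇ λ c → f (b , l , c)) ξ h >>= λ (l , h) → orᵇ⁻ (λ c → f (b , l , c)) ξ h >>= λ (c , p) →
    return ((b , l , c) , p)

  anyᵇ⁺ : ∀ {k} (f : Bool³ → BF k) ξ t → ⟦ f t ⟧ᵇ ξ → ⟦ anyᵇ f ⟧ᵇ ξ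
  anyᵇ⁺ f ξ (b , l , c) p = orᵇ⁺ (λ b → orᵇ λ l → orᵇ λ c → f (b , l , c)) ξ b
    (orᵇ⁺ (λ l → orᵇ λ c → f (b , l , c)) ξ l (orᵇ⁺ (λ c → f (b , l , c)) ξ c p))

  number : Bool³ → ℕ
  number (true  , true  , true)  = 0
  number (true  , true  , false) = 1
  number (true  , false , true)  = 2
  number (true  , false , false) = 3
  number (false , true  , true)  = 4
  number (false , true  , false) = 5
  number (false , false , true)  = 6
  number (false , false , false) = 7

  unnumber : ℕ → Bool³
  unnumber 0 = true  , true  , true
  unnumber 1 = true  , true  , false
  unnumber 2 = true  , false , true
  unnumber 3 = true  , false , false
  unnumber 4 = false , true  , true
  unnumber 5 = false , true  , false
  unnumber 6 = false , false , true
  unnumber _ = false , false , false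

  unnumber-number : ∀ t → unnumber (number t) ≡ t
  unnumber-number (true  , true  , true)  = refl
  unnumber-number (true  , true  , false) = refl
  unnumber-number (true  , false , true)  = refl
  unnumber-number (true  , false , false) = refl
  unnumber-number (false , true  , true)  = refl
  unnumber-number (false , true  , false) = refl
  unnumber-number (false , false , true)  = refl
  unnumber-number (false , false , false) = refl

  number<8 : ∀ t → number t ℕ.< 8
  number<8 (true  , true  , true)  = s≤s z≤n
  number<8 (true  , true  , false) = s≤s (s≤s z≤n)
  number<8 (true  , false , true)  = s≤s (s≤s (s≤s z≤n))
  number<8 (true  , false , false) = s≤s (s≤s (s≤s (s≤s z≤n)))
  number<8 (false , true  , true)  = s≤s (s≤s (s≤s (s≤s (s≤s z≤n))))
  number<8 (false , true  , false) = s≤s (s≤s (s≤s (s≤s (s≤s (s≤s z≤n)))))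
  number<8 (false , false , true)  = s≤s (s≤s (s≤s (s≤s (s≤s (s≤s (s≤s z≤n))))))
  number<8 (false , false , false) = s≤s (s≤s (s≤s (s≤s (s≤s (s≤s (s≤s (s≤s z≤n)))))))

  number-injective : ∀ {t u} → number t ≡ number u → t ≡ u
  number-injective {t} {u} e = trans (sym (unnumber-number t)) (trans (cong unnumber e) (unnumber-number u))

  module EightColors (V E P : S) where
    open Lexicographic E

    Typeᵇ : Bool³ → BF 2
    Typeᵇ (b , l , c) = litᵇ b (⟪ v₀ , v₁ ⟫ᵇ ∈ E) ∧ᵇ litᵇ l (call Lexᵇ (v₀ ∷ v₀ ∷ v₁ ∷ [])) ∧ᵇ litᵇ c (⟪ v₀ , v₁ ⟫ᵇ ∈ P)

    Type : Bool³ → N → N → Set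
    Type (b , l , c) x y = lit b (⟨ x , y ⟩ ε E) × lit l (Left x y) × lit c (⟨ x , y ⟩ ε P)

    Typeᵇ-Type : ∀ t {x y} → Iff (⟦ Typeᵇ t ⟧ᵇ (x ∷ y ∷ [])) (Type t x y)
    Typeᵇ-Type (b , l , c) =
      (λ (p , q , r) → proj₁ (litᵇ-lit b (⟪ v₀ , v₁ ⟫ᵇ ∈ E)) p , proj₁ (litᵇ-lit l (call Lexᵇ (v₀ ∷ v₀ ∷ v₁ ∷ []))) q ,
                       proj₁ (litᵇ-lit c (⟪ v₀ , v₁ ⟫ᵇ ∈ P)) r) ,
      (λ (p , q , r) → proj₂ (litᵇ-lit b (⟪ v₀ , v₁ ⟫ᵇ ∈ E)) p , proj₂ (litᵇ-lit l (call Lexᵇ (v₀ ∷ v₀ ∷ v₁ ∷ []))) q ,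
                       proj₂ (litᵇ-lit c (⟪ v₀ , v₁ ⟫ᵇ ∈ P)) r)

    type : ∀ x y → K (Σ Bool³ λ t → Type t x y)
    type x y = lit-em >>= λ (b , p) → lit-em >>= λ (l , q) → lit-em >>= λ (c , r) → return ((b , l , c) , p , q , r)

    type-unique : ∀ {t u x y} → Type t x y → Type u x y → K (t ≡ u)
    type-unique {b , l , c} {b′ , l′ , c′} (p , q , r) (p′ , q′ , r′) =
      lit-unique b b′ p p′ >>= λ { refl → lit-unique l l′ q q′ >>= λ { refl → lit-unique c c′ r r′ >>= λ { refl → return refl } } }

    type-resp : ∀ t {x y x′ y′} → x ≋ x′ → y ≋ y′ → Type t x y → Type t x′ y′
    type-resp t {x} {y} {x′} e f p = proj₁ (Typeᵇ-Type t) (respect (call (Typeᵇ t) (con x′ ∷ v₀ ∷ [])) [] f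
      (respect (Typeᵇ t) (y ∷ []) e (proj₂ (Typeᵇ-Type t) p)))

    colorᵇ-at : Bool³ → BF 4
    colorᵇ-at t = v₃ ≈ con (numeral (number t)) ∧ᵇ call (Typeᵇ t) (v₁ ∷ v₀ ∷ [])

    colorᵇ : BF 2
    colorᵇ = ∃< (v₀ ⊕ con 1#) (∃< (v₁ ⊕ con 1#)
      ((v₂ ≈ ⟪ v₁ , v₀ ⟫ᵇ ∧ᵇ v₁ < v₀ ∧ᵇ v₁ ∈ V ∧ᵇ v₀ ∈ V) ∧ᵇ anyᵇ colorᵇ-at))

    Color : N → N → Set
    Color q n = Σ N λ x → Σ N λ y → (q ≋ ⟨ x , y ⟩ × x ≺ y × x ε V × y ε V) × (Σ Bool³ λ t → n ≋ numeral (number t) × Type t x y)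

    color⁻ : ∀ {q n} → ⟦ colorᵇ ⟧ᵇ (q ∷ n ∷ []) → K (Color q n)
    color⁻ {q} {n} h = h >>= λ (x , _ , h) → h >>= λ (y , _ , p , h) →
      anyᵇ⁻ colorᵇ-at (y ∷ x ∷ q ∷ n ∷ []) h >>= λ (t , e , r) →
      return (x , y , p , t , e , proj₁ (Typeᵇ-Type t) r)

    color⁺ : ∀ {q n} → Color q n → ⟦ colorᵇ ⟧ᵇ (q ∷ n ∷ [])
    color⁺ {q} {n} (x , y , (e , p) , t , f , r) = return (x , ≺-resp ≋-refl (suc-cong (≋-sym e)) (i≺⟨i,j⟩+1 x y) ,
      return (y , ≺-resp ≋-refl (suc-cong (≋-sym e)) (j≺⟨i,j⟩+1 x y) , (e , p) ,
        anyᵇ⁺ colorᵇ-at (y ∷ x ∷ q ∷ n ∷ []) t (f , proj₂ (Typeᵇ-Type t) r)))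

    coloring : K (Σ S λ C → (∀ q n → Iff (⟨ q , n ⟩ ε C) (K (Color q n))) ×
                            ⟦ Coloring zero ⟦ suc (suc zero) ⟧ 8 ⟧ᶠ [] (C ∷ E ∷ V ∷ []))
    coloring = Δ₀-relation colorᵇ >>= λ (C , f , g) →
      let g′ : ∀ q n → Iff (⟨ q , n ⟩ ε C) (K (Color q n))
          g′ q n = (λ m → color⁻ (proj₁ (g q n) m)) , λ h → proj₂ (g q n) (h >>= color⁺)
      in return (C , g′ , pair
        (λ p m → ex (f p m >>= λ (q , n , e) → proj₁ (g′ q n) (ε-resp e m) >>= λ (x , y , (e′ , l , x∈V , y∈V) , t , e″ , _) →
           return (q , ex (return (n , pair e (pair (pair⁺ {V} e′ l x∈V y∈V) (≺-resp (≋-sym e″) ≋-refl (numeral-mono (number<8 t)))))))))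
        (pair
          (λ q h → ex (pair⁻ {V} h >>= λ (x , y , h) → type x y >>= λ (t , r) →
             return (numeral (number t) , proj₂ (g′ _ _) (return (x , y , h , t , ≋-refl , r)))))
          (λ q n n′ h → ≋-stable (unpair h >>= λ (m , m′) → proj₁ (g′ q n) m >>= λ (x , y , (e , _) , t , e₁ , r) →
             proj₁ (g′ q n′) m′ >>= λ (x′ , y′ , (e′ , _) , t′ , e₂ , r′) →
             let f₁ , f₂ = ⟨⟩-injective (≋-trans (≋-sym e) e′) in
             type-unique {t} {t′} (type-resp t f₁ f₂ r) r′ >>= λ { refl → return (≋-trans e₁ (≋-sym e₂)) }))))

    -- If one of the four types had two colors, there would be five colors.
    module _ {C V′ : S} (C-Color : ∀ q n → Iff (⟨ q , n ⟩ ε C) (K (Color q n))) (R : Rado V′ E)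
             (V′⊆V : ∀ x → x ε V′ → x ε V) (w : Vec N 4)
             (four : ∀ n q → Pair V′ q → ⟨ q , n ⟩ ε C → K (Σ (Fin 4) λ i → n ≋ lookup w i)) where
      open RadoProperties R

      Realised : Bool³ → Set
      Realised t = Σ N λ x → Σ N λ y → x ε V′ × y ε V′ × x ≺ y × Type t x y

      five-colors : (t : Fin 5 → Bool³) → (∀ i → Realised (t i)) → (∀ i j → i Fin.< j → t i ≡ t j → Empty.⊥) → B
      five-colors t r distinct = K-fin place λ p →
        let i , j , i<j , e = Fin-pigeonhole ℕ.≤-refl (proj₁ ∘ p) in
        numeral-injective _ _ (≋-trans (proj₂ (p i)) (subst (λ k → lookup w k ≋ numeral (number (t j))) (sym e) (≋-sym (proj₂ (p j)))))
          λ h → ⊥-elim (distinct i j i<j (number-injective h))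
        where
        place : ∀ i → K (Σ (Fin 4) λ k → numeral (number (t i)) ≋ lookup w k)
        place i with x , y , x∈V′ , y∈V′ , x≺y , h ← r i =
          four _ ⟨ x , y ⟩ (pair⁺ {V′} ≋-refl x≺y x∈V′ y∈V′)
            (proj₂ (C-Color _ _) (return (x , y , (≋-refl , x≺y , V′⊆V x x∈V′ , V′⊆V y y∈V′) , t i , ≋-refl , h)))

      occurs : ∀ b l → K (Σ Bool λ c → Realised (b , l , c))
      occurs b l = types-occur b l >>= λ (x , y , x∈V′ , y∈V′ , x≺y , p , q) → lit-em >>= λ (c , r) →
        return (c , x , y , x∈V′ , y∈V′ , x≺y , p , q , r)

      not-both : ∀ b l → Realised (b , l , true) → Realised (b , l , false) → B
      not-both b l r₀ r₁ = occurs (not b) l λ (c₂ , r₂) → occurs b (not l) λ (c₃ , r₃) → occurs (not b) (not l) λ (c₄ , r₄) →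
        five-colors
          (lookup ((b , l , true) ∷ (b , l , false) ∷ (not b , l , c₂) ∷ (b , not l , c₃) ∷ (not b , not l , c₄) ∷ []))
          (λ { zero → r₀ ; (suc zero) → r₁ ; (suc (suc zero)) → r₂ ; (suc (suc (suc zero))) → r₃ ; (suc (suc (suc (suc zero)))) → r₄ })
          (λ { zero (suc zero) _ ()
             ; zero (suc (suc zero)) _ e → not-¬ refl (cong proj₁ e)
             ; zero (suc (suc (suc zero))) _ e → not-¬ refl (cong (proj₁ ∘ proj₂) e)
             ; zero (suc (suc (suc (suc zero)))) _ e → not-¬ refl (cong proj₁ e)
             ; (suc zero) (suc (suc zero)) _ e → not-¬ refl (cong proj₁ e)
             ; (suc zero) (suc (suc (suc zero))) _ e → not-¬ refl (cong (proj₁ ∘ proj₂) e)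
             ; (suc zero) (suc (suc (suc (suc zero)))) _ e → not-¬ refl (cong proj₁ e)
             ; (suc (suc zero)) (suc (suc (suc zero))) _ e → not-¬ refl (sym (cong proj₁ e))
             ; (suc (suc zero)) (suc (suc (suc (suc zero)))) _ e → not-¬ refl (cong (proj₁ ∘ proj₂) e)
             ; (suc (suc (suc zero))) (suc (suc (suc (suc zero)))) _ e → not-¬ refl (cong proj₁ e)
             ; (suc zero) (suc zero) (s≤s ()) _
             ; (suc (suc zero)) (suc zero) (s≤s ()) _
             ; (suc (suc zero)) (suc (suc zero)) (s≤s (s≤s ())) _
             ; (suc (suc (suc zero))) (suc zero) (s≤s ()) _
             ; (suc (suc (suc zero))) (suc (suc zero)) (s≤s (s≤s ())) _
             ; (suc (suc (suc zero))) (suc (suc (suc zero))) (s≤s (s≤s (s≤s ()))) _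
             ; (suc (suc (suc (suc zero)))) (suc zero) (s≤s ()) _
             ; (suc (suc (suc (suc zero)))) (suc (suc zero)) (s≤s (s≤s ())) _
             ; (suc (suc (suc (suc zero)))) (suc (suc (suc zero))) (s≤s (s≤s (s≤s ()))) _
             ; (suc (suc (suc (suc zero)))) (suc (suc (suc (suc zero)))) (s≤s (s≤s (s≤s (s≤s ())))) _ })

      one-color : ∀ b l → K (Σ Bool λ c → ∀ {x y} → x ≺ y → x ε V′ → y ε V′ →
                             lit b (⟨ x , y ⟩ ε E) → lit l (Left x y) → lit c (⟨ x , y ⟩ ε P))
      one-color b l = em {Realised (b , l , true)} >>=
        [ (λ r → return (true , λ {x} {y} p m m′ q q′ → ε-stable λ ¬r → not-both b l r (x , y , m , m′ , p , q , q′ , ¬r)))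
        , (λ ¬r → return (false , λ {x} {y} p m m′ q q′ r → ¬r (x , y , m , m′ , p , q , q′ , r))) ]

      canonical : K (Canonical E P)
      canonical = K-bool (λ b → K-bool (one-color b)) >>= λ c → return record
        { V = V′ ; rado = R ; color = λ b l → proj₁ (c b l) ; typed = λ b l → proj₂ (c b l) }

  -- Copies of a Rado graph

  module _ {V E V′ E′ g : S}
    (extend : ⟦ RadoGraph (suc zero) zero ⟧ᶠ [] (E ∷ V ∷ []))
    (induced : ⟦ InducedSubgraph zero (suc zero) (suc (suc zero)) (suc (suc (suc zero))) ⟧ᶠ [] (V′ ∷ E′ ∷ V ∷ E ∷ []))
    (iso : ⟦ GraphIsomorphism zero (suc zero) (suc (suc zero)) (suc (suc (suc zero))) (suc (suc (suc (suc zero)))) ⟧ᶠ []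
             (g ∷ V ∷ E ∷ V′ ∷ E′ ∷ [])) where

    -- Both finite sets are pulled back along the isomorphism, a vertex is found in the original
    -- graph, and its image is taken.
    copy : K (Rado V′ E)
    copy =
      unpair extend >>= λ (graph , ext) →
      unpair graph >>= λ (_ , h) → unpair h >>= λ (irr , sym) →
      unpair induced >>= λ (V′⊆V , ind) →
      unpair iso >>= λ (bij , pres) →
      unpair bij >>= λ (fun , h) → unpair h >>= λ (inj , surj) →
      unpair fun >>= λ (dom , h) → unpair h >>= λ (total , func) →
      return record
        { irreflexive = irr _
        ; symmetric = sym _ _
        ; extension = λ F₀ F₁ k p₀ p₁ dis →
            -- The preimages have to be bounded too: strong bounding gives each value below k that
            -- is taken an argument below w, and by injectivity it is the only one.
            strong-bounding (⟪ v₀ , v₁ ⟫ᵇ ∈ g) k >>= λ (w , bd) →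
            Δ₀-comprehension (∃< (con k) (⟪ v₁ , v₀ ⟫ᵇ ∈ g ∧ᵇ v₀ ∈ F₀)) >>= λ (G₀ , g₀) →
            Δ₀-comprehension (∃< (con k) (⟪ v₁ , v₀ ⟫ᵇ ∈ g ∧ᵇ v₀ ∈ F₁)) >>= λ (G₁ , g₁) →
            let inV : ∀ {a y} → ⟨ a , y ⟩ ε g → a ε V × y ε V′
                inV m = let h = unex (dom _ m) >>= λ (c , h) → unex h >>= λ (d , h) → unpair h >>= λ (e , h) → unpair h >>= λ (q , q′) →
                                  return (ε-resp (≋-sym (proj₁ (⟨⟩-injective e))) q , ε-resp (≋-sym (proj₂ (⟨⟩-injective e))) q′) in
                        ε-stable (h >>= λ (q , _) → return q) , ε-stable (h >>= λ (_ , q) → return q)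
                below : ∀ {a y} → y ≺ k → ⟨ a , y ⟩ ε g → a ≺ w
                below {a} {y} p m = ≺-stable (bd y p a m >>= λ (a′ , q , m′) →
                  return (≺-resp (inj a′ a y (pair m′ m)) ≋-refl q))
                edge : ∀ {u z a y} → ⟨ u , z ⟩ ε g → ⟨ a , y ⟩ ε g → Iff (⟨ u , a ⟩ ε E) (⟨ z , y ⟩ ε E)
                edge {u} {z} {a} {y} m m′ =
                  let h = unpair (pres u a z y (pair m m′)) >>= λ i → unpair (ind z y) >>= λ j → return (i , j) in
                  (λ p → ε-stable (h >>= λ ((i , _) , (j , _)) → unpair (j (i p)) >>= λ (_ , h) → unpair h >>= λ (_ , q) → return q)) ,
                  (λ p → ε-stable (h >>= λ ((_ , i) , (_ , j)) → return (i (j (pair (proj₂ (inV m)) (pair (proj₂ (inV m′)) p))))))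
            in unex (ext G₀ G₁ (pair
                 (λ a m → ε-stable (proj₁ (g₀ a) m >>= λ (y , _ , q , _) → return (proj₁ (inV q)))) (pair
                 (λ a m → ε-stable (proj₁ (g₁ a) m >>= λ (y , _ , q , _) → return (proj₁ (inV q)))) (pair
                 (λ c → c w λ a m → ≺-stable (proj₁ (g₀ a) m >>= λ (y , p , q , _) → return (below p q))) (pair
                 (λ c → c w λ a m → ≺-stable (proj₁ (g₁ a) m >>= λ (y , p , q , _) → return (below p q)))
                 (λ a h → unpair h λ (m , m′) → proj₁ (g₀ a) m λ (y , _ , q , r) → proj₁ (g₁ a) m′ λ (y′ , _ , q′ , r′) →
                    dis y r (ε-resp (func a y′ y (pair q′ q)) r′))))))) >>= λ (u , h) →
               unpair h >>= λ (u∈V , h) → unpair h >>= λ (adj , nadj) →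
               unex (total u u∈V) >>= λ (z , m) →
               return (z , proj₂ (inV m) ,
                 (λ y y∈F → ε-stable (unex (surj y (proj₁ (p₀ y y∈F))) >>= λ (a , m′) →
                    return (proj₁ (edge m m′) (adj a (proj₂ (g₀ a) (return (y , proj₂ (p₀ y y∈F) , m′ , y∈F))))))) ,
                 (λ y y∈F q → unex (surj y (proj₁ (p₁ y y∈F))) λ (a , m′) →
                    nadj a (proj₂ (g₁ a) (return (y , proj₂ (p₁ y y∈F) , m′ , y∈F))) (proj₂ (edge m m′) q)))
        }

  -- The implication in the model

  stable-Iff : ∀ {m s} (φ ψ : Formula m s) {η ρ} → ⟦ φ ⇔ ψ ⟧ᶠ η ρ → Iff (⟦ φ ⟧ᶠ η ρ) (⟦ ψ ⟧ᶠ η ρ)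
  stable-Iff φ ψ h = (λ p → stable ψ (unpair h >>= λ (f , _) → return (f p))) ,
                     (λ p → stable φ (unpair h >>= λ (_ , f) → return (f p)))

  Δ⁰₁-relation : (φ ψ : Formula 2 0) → Σ⁰₁ φ → Π⁰₁ ψ →
    (∀ a b → Iff (⟦ φ ⟧ᶠ (a ∷ b ∷ []) []) (⟦ ψ ⟧ᶠ (a ∷ b ∷ []) [])) →
    K (Σ S λ X → ∀ a b → Iff (⟨ a , b ⟩ ε X) (⟦ φ ⟧ᶠ (a ∷ b ∷ []) []))
  Δ⁰₁-relation _ _ (∃Δ⁰₀ {θ} Δθ) (∀Δ⁰₀ {χ} Δχ) e =
    Δ₁-comprehension² (raw θ Δθ (v₀ ∷ v₁ ∷ v₂ ∷ [])) (raw χ Δχ (v₀ ∷ v₁ ∷ v₂ ∷ []))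
      (λ a b → Iff-trans (ex , unex) (e a b)) >>= λ (X , _ , f) →
    return (X , λ a b → Iff-trans (f a b) (ex , unex))

  module _ (R : ComputableRadoGraph) where
    open ComputableRadoGraph R

    RG⇒SRT : ⟦ (∀¹ (vertexΣ ⇔ vertexΠ)) ⇒ (∀¹ ∀¹ (edgeΣ ⇔ edgeΠ)) ⇒
               (∀² ∀² (Is (suc zero) zero ⇒ RadoGraph (suc zero) zero)) ⇒ RG² R 8 4 ⇒ SRT²₂ ⟧ᶠ [] []
    RG⇒SRT vertexΔ edgeΔ rado rg f colored = ex (
      comprehension vertexΣ vertexΠ vertexΣ-Σ⁰₁ vertexΠ-Π⁰₁ [] [] (λ a → stable-Iff vertexΣ vertexΠ (vertexΔ a)) >>= λ (V , hV) →
      Δ⁰₁-relation edgeΣ edgeΠ edgeΣ-Σ⁰₁ edgeΠ-Π⁰₁ (λ a b → stable-Iff edgeΣ edgeΠ (edgeΔ b a)) >>= λ (E , hE) →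
      unpair colored >>= λ (col , stb) →
      unpair col >>= λ (dom , h) → unpair h >>= λ (total , func) →
      Δ₀-comprehension² (⟪ ⟪ v₀ , v₁ ⟫ᵇ , con 1# ⟫ᵇ ∈ f) >>= λ (P , hP) →
      let is : ⟦ Is (suc zero) zero ⟧ᶠ [] (E ∷ V ∷ [])
          is = pair
            (λ a → let i = ⟦⟧-sub vertexΣ {η = a ∷ []} (λ { zero → refl }) (λ ()) in
               pair (λ m → proj₂ i (proj₁ (hV a) m)) (λ p → proj₂ (hV a) (proj₁ i p)))
            (λ a b → let i = ⟦⟧-sub edgeΣ {η = a ∷ b ∷ []} (λ { zero → refl ; (suc zero) → refl }) (λ ()) in
               pair (λ m → proj₂ i (proj₁ (hE a b) m)) (λ p → proj₂ (hE a b) (proj₁ i p)))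
          can : ∀ P → K (Canonical E P)
          can P = let open EightColors V E P in
            coloring >>= λ (C , C-Color , isColoring) →
            unex (rg V E is C isColoring) >>= λ (V′ , h) → unex h >>= λ (E′ , h) → unex h >>= λ (g , h) →
            unpair h >>= λ (ind , h) → unpair h >>= λ (iso , atMost) →
            copy (rado V E is) ind iso >>= λ R′ →
            unpair ind >>= λ (V′⊆V , _) →
            -- The quantifier unpacked last is the innermost and has index 0, so the four values
            -- enter the vector in reverse.
            unex atMost >>= λ (a , h) → unex h >>= λ (b , h) → unex h >>= λ (c , h) → unex h >>= λ (d , h) →
            canonical C-Color R′ V′⊆V (d ∷ c ∷ b ∷ a ∷ []) λ n q p m k →
              h n (λ k′ → k′ q (pair p m)) (λ e → k (zero , e)) (λ e → k (suc zero , e)) (λ e → k (suc (suc zero) , e))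
                (λ e → k (suc (suc (suc zero)) , e))
          -- `P` records only color 1. As colors are below 2, not having color 1 means having color
          -- 0.
          bit : ∀ {x y} → x ≺ y → K (⟨ ⟨ x , y ⟩ , 0# ⟩ ε f ⊎ ⟨ ⟨ x , y ⟩ , 1# ⟩ ε f)
          bit {x} {y} p = unex (total ⟨ x , y ⟩ λ k → k x λ k → k y (pair ≋-refl (pair p (pair id id)))) >>= λ (n , m) →
            unex (dom _ m) >>= λ (q , h) → unex h >>= λ (n′ , h) → unpair h >>= λ (e , h) → unpair h >>= λ (_ , l) →
            ≺-suc⁻ (≺-resp (≋-sym (proj₂ (⟨⟩-injective e))) ≋-refl l) >>=
            [ (λ l → ≺-suc⁻ l >>= [ (λ l _ → ≺0 l) , (λ e → return (inj₁ (ε-resp (⟨⟩-cong ≋-refl e) m))) ])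
            , (λ e → return (inj₂ (ε-resp (⟨⟩-cong ≋-refl (≋-trans e (+-identityˡ 1#))) m))) ]
          stbP : StableSet P
          stbP x = unex (stb x) >>= λ (c , h) → unex h >>= λ (s , h) → em {c ≋ 1#} >>=
            -- `Stable` speaks of y strictly beyond the stage, `StableSet` allows equality; hence
            -- `s + 1#`.
            [ (λ e → return (true , s + 1# , λ y le p → proj₂ (hP x y) (ε-resp (⟨⟩-cong ≋-refl e) (h y (pair (suc≼⇒≺ le) p)))))
            , (λ ne → return (false , s + 1# , λ y le p m → ne (func _ _ _ (pair (h y (pair (suc≼⇒≺ le) p)) (proj₁ (hP x y) m))))) ]
      in homogeneous E can stbP >>= λ (H , unb , c , hom) →
      return (H , pair
        (λ k → ex (unb (k + 1#) >>= λ (y , y∈H , le) → return (y , pair y∈H (suc≼⇒≺ le))))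
        (monochromatic c bit hP hom)))
      where
      monochromatic : ∀ {P H} c → (∀ {x y} → x ≺ y → K (⟨ ⟨ x , y ⟩ , 0# ⟩ ε f ⊎ ⟨ ⟨ x , y ⟩ , 1# ⟩ ε f)) →
        (∀ x y → Iff (⟨ x , y ⟩ ε P) (⟨ ⟨ x , y ⟩ , 1# ⟩ ε f)) →
        (∀ x y → x ≺ y → x ε H → y ε H → lit c (⟨ x , y ⟩ ε P)) → ⟦ Homogeneous (suc zero) zero ⟧ᶠ [] (H ∷ f ∷ [])
      monochromatic {H = H} true bit hP hom = ex (return (1# , λ p h → ε-stable (pair⁻ {H} h >>= λ (x , y , e , l , m , m′) →
        return (ε-resp (⟨⟩-cong (≋-sym e) ≋-refl) (proj₁ (hP x y) (hom x y l m m′))))))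
      monochromatic {H = H} false bit hP hom = ex (return (0# , λ p h → ε-stable (pair⁻ {H} h >>= λ (x , y , e , l , m , m′) →
        bit l >>= [ (λ q → return (ε-resp (⟨⟩-cong (≋-sym e) ≋-refl) q))
                  , (λ q _ → hom x y l m m′ (proj₂ (hP x y) q)) ])))

theorem6p50 : (R : ComputableRadoGraph) → RCA₀ ⊢ RG² R 8 4 ⇒ SRT²₂
theorem6p50 R = ⇒E (⇒E (⇒E (complete _ λ M → InModel.RG⇒SRT M R) vertex-Δ⁰₁) edge-Δ⁰₁) isRado
  where open ComputableRadoGraph R
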